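{- Let $p$ be a prime. Let $w^{(1)},\ldots,w^{(\ell)}$ be pairwise distinct admissible words (elements of $W$) and let $k_1,\ldots,k_\ell$ be positive integers. For $j\ge 0$ let $c_j$ be the coefficient of the monomial $$X_{w^{(1)}}^{k_1}\cdots X_{w^{(\ell)}}^{k_\ell}$$ in the polynomial $P_j$. Then, as power series in $x$, $$\sum_{j\ge 0}c_jx^j=\frac{1}{k_1!}\bigl(\log r_{w^{(1)}}(x)\bigr)^{k_1}\cdots\frac{1}{k_\ell!}\bigl(\log r_{w^{(\ell)}}(x)\bigr)^{k_\ell}.$$
   Context: Fix a prime $p$. Digits are elements of $\{0,\ldots,p-1\}$. Words are written $w=w_{\mu-1}\cdots w_0$ with $w_{\mu-1}$ leftmost; $|w|=\mu$ is the length and $\varepsilon$ is the empty word. For a finite word $v=v_{\mu-1}\cdots v_0$ put $(v)_p=\sum_i v_ip^i$ (so $(\varepsilon)_p=0$). For a nonnegative integer $n$ with base-$p$ expansion $n=\sum_{i\ge 0}n_ip^i$ (padded with infinitely many zero digits) and a word $w$ of length $\mu$ containing a nonzero digit, $|n|_w=|\{i\ge 0: n_{i+\mu-1}\cdots n_i=w_{\mu-1}\cdots w_0\}|$ is the number of (possibly overlapping) occurrences of $w$ in the expansion of $n$. For $j,n\ge 0$, $\vartheta_p(j,n)=|\{t\in\{0,\ldots,n\}:\nu_p\binom nt=j\}|$, where $\nu_p(m)$ is the exponent of $p$ in $m$. The set $W$ of admissible words consists of all words $w_{\mu-1}\cdots w_0$ over $\{0,\ldots,p-1\}$ with $\mu\ge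 2$, $w_{\mu-1}\ne 0$, $w_0\ne p-1$. The set $\widetilde W$ consists of all words $w_{\mu-1}\cdots w_0$ with $\mu\ge 1$ and $w_{\mu-1}\neq 0$. For each $j\ge0$, $P_j$ denotes the polynomial in the variables $X_w$ ($w\in W$) such that $\vartheta_p(j,n)/\vartheta_p(0,n)=P_j\bigl((|n|_w)_{w\in W}\bigr)$ for all $n\ge 0$; such a polynomial exists and is unique. Define $T_n(x)=\sum_{j\ge0}\vartheta_p(j,n)x^j=\sum_{0\le t\le n}x^{\nu_p\binom nt}$ and $\overline T_n(x)=T_n(x)/\vartheta_p(0,n)$, so $\overline T_n(0)=1$. For a finite word $v$ put $\overline T_v=\overline T_{(v)_p}$. For $w\in\widetilde W\cup\{\varepsilon\}$, the left truncation $w_L$ and right truncation $w_R$ are defined by $\varepsilon_L=\varepsilon_R=\varepsilon$ and, for $w\in\widetilde W$: $w_L$ is the longest proper suffix $u$ of $w$ (i.e. ending at the rightmost letter) with $u\in\widetilde W\cup\{\varepsilon\}$, and $w_R$ is the longest proper prefix $u$ of $w$ (i.e. starting at the leftmost letter) with $u\in\widetilde W\cup\{\varepsilon\}$. One has $(w_L)_R=(w_R)_L$, denoted $w_{LR}$. For $w\in\widetilde W$ define the rational function $$r_w(x)=\frac{\overline T_w(x)\,\overline T_{w_{LR}}(x)}{\overline T_{w_R}(x)\,\overline T_{w_L}(x)},$$ which satisfies $r_w(0)=1$; $\log r_w(x)$ is understood as a power series at $0$ with zero constant term. -}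

module Defs where

open import Algebra.Bundles using (RawSemiring)
import Algebra.Definitions.RawSemiring as RawSemiringDefs
open import Data.Empty using (⊥)
open import Data.Fin using (Fin; toℕ)
import Data.Fin.Properties as Fin
open import Data.Digit using (fromDigits)
open import Data.Integer using (+_)
open import Data.List using (List; []; _∷_; _++_; length; map; filter; foldr; upTo; downFrom; reverse; inits; tails; drop; find; concat; replicate; tabulate)
import Data.List.Properties as List
open import Data.List.Relation.Unary.All using (All; all?)
open import Data.List.Relation.Unary.Any using (here)
open import Data.Maybe using (fromMaybe)
open import Data.Nat as ℕ using (ℕ; zero; suc; NonZero; _≤_; _∸_; _!)
open import Data.Nat.Combinatorics using (_C_)
open import Data.Nat.DivMod using (_/_; _mod_)
open import Data.Nat.Divisibility using (_∣_; _∣?_; ∣-refl; ∣1⇒≡1)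
open import Data.Nat.Primality using (Prime; prime⇒nonZero; prime⇒nonTrivial)
import Data.Nat.Properties as ℕₚ
open import Data.Product using (_×_; _,_)
open import Data.Rational as ℚ using (ℚ; 0ℚ; 1ℚ)
open import Data.Refinement using (value; Refinement-syntax)
import Data.Refinement as Refinement
open import Data.Unit using (⊤)
open import Data.Vec.Functional using (Vector)
open import Level using (0ℓ)
open import Relation.Binary.Definitions using (DecidableEquality)
open import Relation.Binary.PropositionalEquality using (_≡_; _≢_; trans; sym)
open import Relation.Nullary using (¬_; Dec; yes; no; ¬?)
open import Relation.Nullary.Decidable using (_×-dec_)

fromℕ : ℕ → ℚ
fromℕ n = + n ℚ./ 1

-- A power series is its sequence of coefficients.
PowerSeries : Set
PowerSeries = ℕ → ℚ

private module ℚ-alg = RawSemiringDefs ℚ.+-*-rawSemiring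

powerSeries : RawSemiring 0ℓ 0ℓ
powerSeries = record
  { Carrier = PowerSeries
  ; _≈_     = λ f g → ∀ n → f n ≡ g n
  ; _+_     = λ f g n → f n ℚ.+ g n
  ; _*_     = λ f g n → ℚ-alg.sum {suc n} λ i → f (toℕ i) ℚ.* g (n ∸ toℕ i)
  ; 0#      = λ _ → 0ℚ
  ; 1#      = λ { zero → 1ℚ ; (suc _) → 0ℚ }
  }

module Series where
  open RawSemiring powerSeries public using (_≈_; _+_; _*_; 0#; 1#)
  open RawSemiringDefs powerSeries public using (_^_; product)

  infixr 8 _•_
  infixl 6 _-_

  _•_ : ℚ → PowerSeries → PowerSeries
  (c • f) n = c ℚ.* f n

  _-_ : PowerSeries → PowerSeries → PowerSeries
  (f - g) n = f n ℚ.- g n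

  -- 1/f = Σ_{m≥0} (1 - f)^m, for f with constant term 1.  Since 1 - f then
  -- has zero constant term, only m ≤ n contributes to the coefficient of x^n.
  recip : PowerSeries → PowerSeries
  recip f n = ℚ-alg.sum {suc n} λ m → ((1# - f) ^ toℕ m) n

  -- log f = Σ_{m≥1} (-1)^(m-1) (f - 1)^m / m, for f with constant term 1.
  -- Here m = suc (toℕ i); again only m ≤ n contributes to the coefficient of x^n.
  log : PowerSeries → PowerSeries
  log f n = ℚ-alg.sum {n} λ i →
    ((ℚ.- 1ℚ) ℚ-alg.^ toℕ i) ℚ.* (+ 1 ℚ./ suc (toℕ i)) ℚ.* ((f - 1#) ^ suc (toℕ i)) n

  divPow : PowerSeries → ℕ → PowerSeries
  divPow f k = (+ 1 ℚ./ (k !)) {{ k ℕₚ.!≢0 }} • (f ^ k)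

-- A monomial is a list of variables, with multiplicity, read up to reordering.
Monomial : Set → Set
Monomial V = List V

-- A polynomial is a formal sum of terms.  Several terms may carry the same
-- monomial; `coeff` below adds up their coefficients.
Polynomial : Set → Set
Polynomial V = List (ℚ × Monomial V)

module _ {V : Set} where

  evalMonomial : (V → ℚ) → Monomial V → ℚ
  evalMonomial ρ m = foldr ℚ._*_ 1ℚ (map ρ m)

  eval : (V → ℚ) → Polynomial V → ℚ
  eval ρ P = foldr ℚ._+_ 0ℚ (map (λ { (c , m) → c ℚ.* evalMonomial ρ m }) P)

  monomial : ∀ {ℓ} → Vector V ℓ → Vector ℕ ℓ → Monomial V
  monomial w k = concat (tabulate λ i → replicate (k i) (w i))

module _ {V : Set} (_≟_ : DecidableEquality V) where

  exponent : V → Monomial V → ℕ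
  exponent v m = length (filter (v ≟_) m)

  SameMonomial : Monomial V → Monomial V → Set
  SameMonomial m m′ = All (λ v → exponent v m ≡ exponent v m′) (m ++ m′)

  sameMonomial? : ∀ m m′ → Dec (SameMonomial m m′)
  sameMonomial? m m′ = all? (λ v → exponent v m ℕ.≟ exponent v m′) (m ++ m′)

  coeff : Monomial V → Polynomial V → ℚ
  coeff m []             = 0ℚ
  coeff m ((c , m′) ∷ P) with sameMonomial? m m′
  ... | yes _ = c ℚ.+ coeff m P
  ... | no  _ = coeff m P

-- ν_p(m) = j.  (For p ≥ 2 this never holds for m = 0, where ν_p(m) = ∞.)
Valuation : (p m j : ℕ) → Set
Valuation p m j = p ℕ.^ j ∣ m × ¬ (p ℕ.^ suc j ∣ m)

valuation? : ∀ p m j → Dec (Valuation p m j)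
valuation? p m j = (p ℕ.^ j ∣? m) ×-dec ¬? (p ℕ.^ suc j ∣? m)

ϑ : (p j n : ℕ) → ℕ
ϑ p j n = length (filter (λ t → valuation? p (n C t) j) (upTo (suc n)))

module _ {p : ℕ} (p-prime : Prime p) where

  ϑ₀-nonZero : ∀ n → NonZero (ϑ p 0 n)
  ϑ₀-nonZero n = ℕ.>-nonZero (List.filter-some (λ t → valuation? p (n C t) 0)
    {upTo (suc n)} (here (∣-refl , p∤1)))
    where
    p∤1 : ¬ (p ℕ.^ 1 ∣ 1)
    p∤1 p∣1 = ℕ.nonTrivial⇒≢1 {{prime⇒nonTrivial p-prime}}
      (trans (sym (ℕₚ.^-identityʳ p)) (∣1⇒≡1 p∣1))

module Words {p : ℕ} (p-prime : Prime p) where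

  private instance
    p-nonZero : NonZero p
    p-nonZero = prime⇒nonZero p-prime

  -- Lists are in written order: w_{μ-1} ∷ … ∷ w_0 ∷ [].
  Word : Set
  Word = List (Fin p)

  -- (v)_p; `fromDigits` expects the least significant digit first.
  ⟦_⟧ : Word → ℕ
  ⟦ v ⟧ = fromDigits (reverse v)

  LeadingNonzero : Word → Set
  LeadingNonzero []      = ⊥
  LeadingNonzero (d ∷ _) = toℕ d ≢ 0

  LastNotMax : Word → Set
  LastNotMax []           = ⊥
  LastNotMax (d ∷ [])     = toℕ d ≢ p ∸ 1
  LastNotMax (_ ∷ d ∷ ds) = LastNotMax (d ∷ ds)

  Admissible : Word → Set
  Admissible w = 2 ≤ length w × LeadingNonzero w × LastNotMax w

  W : Set
  W = [ w ∈ Word ∣ Admissible w ]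

  _≟W_ : DecidableEquality W
  _≟W_ = Refinement._≟_ (List.≡-dec Fin._≟_)

  digit : ℕ → ℕ → Fin p
  digit n i = (n / p ℕ.^ i) {{ ℕₚ.m^n≢0 p i }} mod p

  -- n_{i+μ-1} ⋯ n_i
  window : (n i μ : ℕ) → Word
  window n i μ = map (λ k → digit n (i ℕ.+ k)) (downFrom μ)

  -- |n|_w, for w containing a nonzero digit.  An occurrence of such a w at
  -- position i forces i < p^i ≤ n, so the positions i < n suffice.
  occurrences : ℕ → Word → ℕ
  occurrences n w = length (filter (λ i → List.≡-dec Fin._≟_ (window n i (length w)) w) (upTo n))

  W̃ε : Word → Set
  W̃ε []         = ⊤
  W̃ε w@(_ ∷ _) = LeadingNonzero w

  W̃ε? : ∀ w → Dec (W̃ε w)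
  W̃ε? []      = yes _
  W̃ε? (d ∷ _) = ¬? (toℕ d ℕ.≟ 0)

  -- `tails w` lists the suffixes of w in order of decreasing length, starting
  -- with w; `reverse (inits w)` does the same for prefixes.  The default value
  -- is used only for w = ε, which has no proper suffix or prefix.
  left right : Word → Word
  left  w = fromMaybe [] (find W̃ε? (drop 1 (tails w)))
  right w = fromMaybe [] (find W̃ε? (drop 1 (reverse (inits w))))

  ratio : (j n : ℕ) → ℚ
  ratio j n = (+ ϑ p j n ℚ./ ϑ p 0 n) {{ ϑ₀-nonZero p-prime n }}

  -- T̄_n(x) = T_n(x) / ϑ_p(0,n), where T_n(x) = Σ_j ϑ_p(j,n) x^j
  T̄ : ℕ → PowerSeries
  T̄ n j = ratio j n

  -- Both T̄-products have constant term 1, so `recip` applies and r w is the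
  -- expansion at 0 of the rational function r_w.
  r : Word → PowerSeries
  r w = (T̄ ⟦ w ⟧ * T̄ ⟦ right (left w) ⟧) * recip (T̄ ⟦ right w ⟧ * T̄ ⟦ left w ⟧)
    where open Series

  -- P_j is the unique P with this property.
  Represents : ℕ → Polynomial W → Set
  Represents j P = ∀ n → ratio j n ≡ eval (λ w → fromℕ (occurrences n (value w))) P

module Submission where

-- Over the prefixes of a digit string the series r_v telescope, so T̄_n is the product of r_v^{|n|_v} over the words
-- v with nonzero leading digit, and r_v = 1 unless v is admissible, because T̄ is 1 on digits and does not change when
-- a last digit p-1 is appended.  Together with a companion Ῡ that keeps track of a carry, T̄ obeys a recurrence that
-- reads a digit through a 2×2 matrix whose determinant is divisible by x.  Hence r_v ≡ 1 mod x^(|v|-2), and modulo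
-- x^(j+1) only a finite set S of words matters.  There T̄_n = exp (Σ |n|_v log r_v), so P_j agrees at every
-- occurrence vector (|n|_v) with the coefficient of x^j in ∏_{v ∈ S} exp (X_v log r_v).
--
-- Putting the block 0^M (p-1)^M u on top of n, any number of times, moves the occurrence vector along a fixed line,
-- and a polynomial identity at the natural points of a line holds on the whole line.  The directions for aub, au, ub
-- and u combine, with signs +, -, -, +, to the coordinate vector of the word aub.  So the two polynomials agree
-- everywhere and have the same coefficients.

-- Occurrence vectors do not fill out the natural points of the coordinate space: an occurrence of a
-- long word may force occurrences of shorter ones inside it. A comparison of the two polynomials on
-- a grid is therefore out of reach, and lines take its place. The directions come from actual
-- blocks and can at first only be added, a natural number of times; once each multiplicity has been
-- freed to an arbitrary rational number, directions can also be subtracted. The companion series is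
-- the sum of x^e over t < n, where e is the valuation of p n C(n-1,t). Carries never appear as
-- objects: both recurrences rest on the single fact that (s + n p)! and p^n n! have the same
-- valuation for s < p. Since P_j is any polynomial with the defining property, S has to contain its
-- variables besides the words of length at most j+2. The passage from powers to exponentials uses
-- the derivation x d/dx: exp (m log f) and f^m solve the same linear equation.

open import Defs
open import Data.Nat as ℕ using (ℕ; zero; suc; _≤_; _<_; _∸_; _⊔_; z≤n; s≤s; _!; NonZero)
open import Data.Nat.Primality using (Prime; prime⇒nonZero; prime⇒nonTrivial; euclidsLemma)
open import Data.Refinement using (value; value-injective; _,_)
open import Data.Vec.Functional using (Vector)
open import Function.Definitions using (Injective)
open import Relation.Binary.PropositionalEquality

open import Algebra.Bundles using (CommutativeRing)
import Algebra.Definitions.RawSemiring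
import Algebra.Properties.Group
import Algebra.Properties.Semiring.Exp
import Algebra.Solver.Ring.NaturalCoefficients.Default as NaturalCoefficients
open import Algebra.Structures using (IsCommutativeRing)
open import Data.Digit using (fromDigits)
open import Data.Empty using (⊥-elim)
open import Data.Fin using (Fin; toℕ; fromℕ<) renaming (zero to fzero; suc to fsuc)
import Data.Fin.Properties as Finₚ
open import Data.Integer as ℤ using (+_)
import Data.Integer.Properties as ℤₚ
open import Data.Irrelevant using ([_])
open import Data.List using (List; []; _∷_; _++_; length; map; filter; reverse; replicate; concatMap; allFin; applyUpTo; downFrom; applyDownFrom; inits; tails; find; drop; tabulate; deduplicate; initLast; _∷ʳ′_)
import Data.List.Properties as Listₚ
import Data.List.Membership.DecPropositional as DecMembership
open import Data.List.Membership.Propositional using (_∈_; _∉_)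
open import Data.List.Membership.Propositional.Properties using (∈-concatMap⁺; ∈-map⁺; ∈-allFin; ∈-deduplicate⁺; ∈-++⁺ˡ; ∈-++⁺ʳ; ∈-tabulate⁺)
open import Data.List.Relation.Unary.All as All using (All; []; _∷_)
import Data.List.Relation.Unary.All.Properties as Allₚ
open import Data.List.Relation.Unary.AllPairs using ([]; _∷_)
open import Data.List.Relation.Unary.Any as Any using (here; there)
open import Data.List.Relation.Unary.Unique.DecPropositional.Properties using (deduplicate-!)
open import Data.List.Relation.Unary.Unique.Propositional using (Unique)
open import Data.List.Reverse using (Reverse; []; _∶_∶ʳ_; reverseView)
open import Data.Maybe using (just; fromMaybe)
open import Data.Nat.Combinatorics using (_C_; nCk≡n!/k![n-k]!; k![n∸k]!∣n!)
open import Data.Nat.Divisibility using (_∣_; _∤_; divides; 1∣_; ∣-trans; ∣1⇒≡1; m∣m*n; n∣m*n; ∣n⇒∣m*n; ∣m+n∣m⇒∣n; *-monoʳ-∣; *-cancelˡ-∣; >⇒∤)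
import Data.Nat.DivMod as ℕ/
import Data.Nat.Properties as ℕₚ
import Data.Nat.Tactic.RingSolver as ℕ-Solver
open import Data.Product using (_×_; _,_; proj₁; proj₂; ∃)
open import Data.Rational as ℚ using (ℚ; 0ℚ; 1ℚ)
import Data.Rational.Properties as ℚₚ
import Data.Rational.Unnormalised as ℚᵘ
import Data.Rational.Unnormalised.Properties as ℚᵘₚ
open import Data.Sum using (inj₁; inj₂)
open import Data.Unit using (⊤; tt)
open import Function using (_∘_; id)
open import Level using (0ℓ)
open import Relation.Binary.Definitions using (DecidableEquality)
import Relation.Binary.Reasoning.Setoid as SetoidReasoning
open import Relation.Nullary using (yes; no; Dec; ¬_; ¬?)
open import Relation.Nullary.Decidable using (_×-dec_; recompute; dec-true; dec-false; dec⇒maybe)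
open import Relation.Unary using (Decidable)
open import Tactic.RingSolver using (solve-∀)
open import Tactic.RingSolver.Core.AlmostCommutativeRing using (AlmostCommutativeRing; fromCommutativeRing)

-- The ring of power series

ℚ-ring : AlmostCommutativeRing 0ℓ 0ℓ
ℚ-ring = fromCommutativeRing ℚₚ.+-*-commutativeRing λ q → dec⇒maybe (0ℚ ℚₚ.≟ q)

-- This is (f - f(0))/x. The Cauchy sum unfolds definitionally: coefficient `suc n` of f g is
-- `f 0 * g (suc n)` plus coefficient `n` of `shift f * g`. The ring laws are inductions along this
-- unfolding.
shift : PowerSeries → PowerSeries
shift f n = f (suc n)

module Cauchy where
  open Series

  *-cong-upto : ∀ n {f f′ g g′ : PowerSeries} → (∀ i → i ≤ n → f i ≡ f′ i) → (∀ i → i ≤ n → g i ≡ g′ i) →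
    (f * g) n ≡ (f′ * g′) n
  *-cong-upto zero    f≡ g≡ = cong₂ (λ a b → a ℚ.* b ℚ.+ 0ℚ) (f≡ 0 z≤n) (g≡ 0 z≤n)
  *-cong-upto (suc n) f≡ g≡ = cong₂ ℚ._+_ (cong₂ ℚ._*_ (f≡ 0 z≤n) (g≡ (suc n) ℕₚ.≤-refl))
    (*-cong-upto n (λ i i≤n → f≡ (suc i) (s≤s i≤n)) (λ i i≤n → g≡ i (ℕₚ.m≤n⇒m≤1+n i≤n)))

  *-cong : ∀ {f f′ g g′ : PowerSeries} → f ≈ f′ → g ≈ g′ → f * g ≈ f′ * g′
  *-cong f≈ g≈ n = *-cong-upto n (λ i _ → f≈ i) (λ i _ → g≈ i)

  *-distribʳ-+ : ∀ f g h → (g + h) * f ≈ g * f + h * f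
  *-distribʳ-+ f g h zero    = lemma (f 0) (g 0) (h 0)
    where
    lemma : ∀ a b c → (b ℚ.+ c) ℚ.* a ℚ.+ 0ℚ ≡ (b ℚ.* a ℚ.+ 0ℚ) ℚ.+ (c ℚ.* a ℚ.+ 0ℚ)
    lemma = solve-∀ ℚ-ring
  *-distribʳ-+ f g h (suc n) = begin
    (g 0 ℚ.+ h 0) ℚ.* f (suc n) ℚ.+ ((shift g + shift h) * f) n
      ≡⟨ cong ((g 0 ℚ.+ h 0) ℚ.* f (suc n) ℚ.+_) (*-distribʳ-+ f (shift g) (shift h) n) ⟩
    (g 0 ℚ.+ h 0) ℚ.* f (suc n) ℚ.+ ((shift g * f) n ℚ.+ (shift h * f) n)
      ≡⟨ lemma (f (suc n)) (g 0) (h 0) ((shift g * f) n) ((shift h * f) n) ⟩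
    (g 0 ℚ.* f (suc n) ℚ.+ (shift g * f) n) ℚ.+ (h 0 ℚ.* f (suc n) ℚ.+ (shift h * f) n) ∎
    where
    open ≡-Reasoning
    lemma : ∀ a b c x y → (b ℚ.+ c) ℚ.* a ℚ.+ (x ℚ.+ y) ≡ (b ℚ.* a ℚ.+ x) ℚ.+ (c ℚ.* a ℚ.+ y)
    lemma = solve-∀ ℚ-ring

  •-*-assoc : ∀ c f g → (c • f) * g ≈ c • (f * g)
  •-*-assoc c f g zero = lemma c (f 0) (g 0)
    where
    lemma : ∀ a b c → (a ℚ.* b) ℚ.* c ℚ.+ 0ℚ ≡ a ℚ.* (b ℚ.* c ℚ.+ 0ℚ)
    lemma = solve-∀ ℚ-ring
  •-*-assoc c f g (suc n) = trans (cong (c ℚ.* f 0 ℚ.* g (suc n) ℚ.+_) (•-*-assoc c (shift f) g n))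
    (lemma c (f 0) (g (suc n)) ((shift f * g) n))
    where
    lemma : ∀ a b c d → (a ℚ.* b) ℚ.* c ℚ.+ a ℚ.* d ≡ a ℚ.* (b ℚ.* c ℚ.+ d)
    lemma = solve-∀ ℚ-ring

  *-assoc : ∀ f g h → (f * g) * h ≈ f * (g * h)
  *-assoc f g h zero = lemma (f 0) (g 0) (h 0)
    where
    lemma : ∀ a b c → (a ℚ.* b ℚ.+ 0ℚ) ℚ.* c ℚ.+ 0ℚ ≡ a ℚ.* (b ℚ.* c ℚ.+ 0ℚ) ℚ.+ 0ℚ
    lemma = solve-∀ ℚ-ring
  *-assoc f g h (suc n) = begin
    (f 0 ℚ.* g 0 ℚ.+ 0ℚ) ℚ.* h (suc n) ℚ.+ ((f 0 • shift g + shift f * g) * h) n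
      ≡⟨ cong ((f 0 ℚ.* g 0 ℚ.+ 0ℚ) ℚ.* h (suc n) ℚ.+_) (*-distribʳ-+ h (f 0 • shift g) (shift f * g) n) ⟩
    (f 0 ℚ.* g 0 ℚ.+ 0ℚ) ℚ.* h (suc n) ℚ.+ (((f 0 • shift g) * h) n ℚ.+ ((shift f * g) * h) n)
      ≡⟨ cong ((f 0 ℚ.* g 0 ℚ.+ 0ℚ) ℚ.* h (suc n) ℚ.+_)
           (cong₂ ℚ._+_ (•-*-assoc (f 0) (shift g) h n) (*-assoc (shift f) g h n)) ⟩
    (f 0 ℚ.* g 0 ℚ.+ 0ℚ) ℚ.* h (suc n) ℚ.+ (f 0 ℚ.* (shift g * h) n ℚ.+ (shift f * (g * h)) n)
      ≡⟨ lemma (f 0) (g 0) (h (suc n)) ((shift g * h) n) ((shift f * (g * h)) n) ⟩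
    f 0 ℚ.* (g 0 ℚ.* h (suc n) ℚ.+ (shift g * h) n) ℚ.+ (shift f * (g * h)) n ∎
    where
    open ≡-Reasoning
    lemma : ∀ a b c d e → (a ℚ.* b ℚ.+ 0ℚ) ℚ.* c ℚ.+ (a ℚ.* d ℚ.+ e) ≡ a ℚ.* (b ℚ.* c ℚ.+ d) ℚ.+ e
    lemma = solve-∀ ℚ-ring

  -- The definitional unfolding peels off the first term of the Cauchy sum; commutativity needs the
  -- last one peeled off as well.
  *-suc : ∀ f g n → (f * g) (suc n) ≡ f (suc n) ℚ.* g 0 ℚ.+ (f * shift g) n
  *-suc f g zero = lemma (f 0) (g 1) (f 1) (g 0)
    where
    lemma : ∀ a b c d → a ℚ.* b ℚ.+ (c ℚ.* d ℚ.+ 0ℚ) ≡ c ℚ.* d ℚ.+ (a ℚ.* b ℚ.+ 0ℚ)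
    lemma = solve-∀ ℚ-ring
  *-suc f g (suc n) = trans (cong (f 0 ℚ.* g (2 ℕ.+ n) ℚ.+_) (*-suc (shift f) g n))
    (lemma (f 0 ℚ.* g (2 ℕ.+ n)) (f (2 ℕ.+ n) ℚ.* g 0) ((shift f * shift g) n))
    where
    lemma : ∀ a b c → a ℚ.+ (b ℚ.+ c) ≡ b ℚ.+ (a ℚ.+ c)
    lemma = solve-∀ ℚ-ring

  *-comm : ∀ f g → f * g ≈ g * f
  *-comm f g zero = cong (ℚ._+ 0ℚ) (ℚₚ.*-comm (f 0) (g 0))
  *-comm f g (suc n) = trans (cong₂ ℚ._+_ (ℚₚ.*-comm (f 0) (g (suc n))) (*-comm (shift f) g n)) (sym (*-suc g f n))

  zero-* : ∀ f → (λ _ → 0ℚ) * f ≈ (λ _ → 0ℚ)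
  zero-* f zero    = trans (ℚₚ.+-identityʳ (0ℚ ℚ.* f 0)) (ℚₚ.*-zeroˡ (f 0))
  zero-* f (suc n) = trans (cong₂ ℚ._+_ (ℚₚ.*-zeroˡ (f (suc n))) (zero-* f n)) (ℚₚ.+-identityʳ 0ℚ)

  one-* : ∀ f → 1# * f ≈ f
  one-* f zero    = trans (ℚₚ.+-identityʳ (1ℚ ℚ.* f 0)) (ℚₚ.*-identityˡ (f 0))
  one-* f (suc n) = trans (cong₂ ℚ._+_ (ℚₚ.*-identityˡ (f (suc n))) (zero-* f n)) (ℚₚ.+-identityʳ (f (suc n)))

infixl 7 _⊛_
infixl 6 _⊕_
infixr 8 _◂_
infix  4 _≋_

_≋_ : PowerSeries → PowerSeries → Set
f ≋ g = ∀ n → f n ≡ g n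

-- Opaque copies of the series operations: unification can then decompose
-- products, which it cannot do through the unfolded Cauchy sums.
opaque
  _⊕_ _⊛_ : PowerSeries → PowerSeries → PowerSeries
  _⊕_ = Series._+_
  _⊛_ = Series._*_

  ⊖_ : PowerSeries → PowerSeries
  (⊖ f) n = ℚ.- f n

  𝟘 𝟙 : PowerSeries
  𝟘 = Series.0#
  𝟙 = Series.1#

  _◂_ : ℚ → PowerSeries → PowerSeries
  _◂_ = Series._•_

opaque
  unfolding _⊕_

  ⊕-coeff : ∀ f g n → (f ⊕ g) n ≡ f n ℚ.+ g n
  ⊕-coeff f g n = refl

  ⊖-coeff : ∀ f n → (⊖ f) n ≡ ℚ.- f n
  ⊖-coeff f n = refl

  𝟘-coeff : ∀ n → 𝟘 n ≡ 0ℚ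
  𝟘-coeff n = refl

  𝟙-coeff₀ : 𝟙 0 ≡ 1ℚ
  𝟙-coeff₀ = refl

  ◂-coeff : ∀ c f n → (c ◂ f) n ≡ c ℚ.* f n
  ◂-coeff c f n = refl

  ⊛-coeff₀ : ∀ f g → (f ⊛ g) 0 ≡ f 0 ℚ.* g 0
  ⊛-coeff₀ f g = ℚₚ.+-identityʳ (f 0 ℚ.* g 0)

  ⊛-suc : ∀ f g n → (f ⊛ g) (suc n) ≡ f 0 ℚ.* g (suc n) ℚ.+ (shift f ⊛ g) n
  ⊛-suc f g n = refl

  ⊛-cong-upto : ∀ n {f f′ g g′} → (∀ i → i ≤ n → f i ≡ f′ i) → (∀ i → i ≤ n → g i ≡ g′ i) →
    (f ⊛ g) n ≡ (f′ ⊛ g′) n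
  ⊛-cong-upto = Cauchy.*-cong-upto

  -- The `-def` equations lead back from the opaque copies to the operations in which the theorem is
  -- stated.
  ⊛-def : ∀ f g → f ⊛ g ≡ f Series.* g
  ⊛-def f g = refl

  𝟙-def : 𝟙 ≡ Series.1#
  𝟙-def = refl

  ◂-def : ∀ c f → c ◂ f ≡ c Series.• f
  ◂-def c f = refl

  seriesIsCommutativeRing : IsCommutativeRing _≋_ _⊕_ _⊛_ ⊖_ 𝟘 𝟙
  seriesIsCommutativeRing = record
    { isRing = record
      { +-isAbelianGroup = record
        { isGroup = record
          { isMonoid = record
            { isSemigroup = record
              { isMagma = record
                { isEquivalence = record
                  { refl = λ _ → refl ; sym = λ e n → sym (e n) ; trans = λ e e′ n → trans (e n) (e′ n) }
                ; ∙-cong = λ e e′ n → cong₂ ℚ._+_ (e n) (e′ n) }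
              ; assoc = λ f g h n → ℚₚ.+-assoc (f n) (g n) (h n) }
            ; identity = (λ f n → ℚₚ.+-identityˡ (f n)) , (λ f n → ℚₚ.+-identityʳ (f n)) }
          ; inverse = (λ f n → ℚₚ.+-inverseˡ (f n)) , (λ f n → ℚₚ.+-inverseʳ (f n))
          ; ⁻¹-cong = λ e n → cong ℚ.-_ (e n) }
        ; comm = λ f g n → ℚₚ.+-comm (f n) (g n) }
      ; *-cong = Cauchy.*-cong
      ; *-assoc = Cauchy.*-assoc
      ; *-identity = Cauchy.one-* , λ f n → trans (Cauchy.*-comm f Series.1# n) (Cauchy.one-* f n)
      ; distrib = (λ f g h n → trans (Cauchy.*-comm f (g Series.+ h) n) (trans (Cauchy.*-distribʳ-+ f g h n)
          (cong₂ ℚ._+_ (Cauchy.*-comm g f n) (Cauchy.*-comm h f n)))) , Cauchy.*-distribʳ-+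
      }
    ; *-comm = Cauchy.*-comm
    }

  ◂-⊛-assoc : ∀ c f g → (c ◂ f) ⊛ g ≋ c ◂ (f ⊛ g)
  ◂-⊛-assoc = Cauchy.•-*-assoc

seriesRing : CommutativeRing 0ℓ 0ℓ
seriesRing = record { isCommutativeRing = seriesIsCommutativeRing }

module 𝕊 = CommutativeRing seriesRing
module 𝕊-Solver = NaturalCoefficients 𝕊.commutativeSemiring
module 𝕊-Reasoning = SetoidReasoning 𝕊.setoid
module 𝕊-Group = Algebra.Properties.Group 𝕊.+-group
open Algebra.Properties.Semiring.Exp 𝕊.semiring using (_^_; ^-congˡ; ^-congʳ; ^-homo-*)
open 𝕊-Solver using (_:*_; _:+_; _:=_) renaming (solve to 𝕊-solve)

◂-cong : ∀ {c d f g} → c ≡ d → f ≋ g → c ◂ f ≋ d ◂ g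
◂-cong {c} {d} {f} {g} refl f≈g n = trans (◂-coeff c f n) (trans (cong (c ℚ.*_) (f≈g n)) (sym (◂-coeff c g n)))

◂-assoc : ∀ c d f → c ◂ d ◂ f ≋ (c ℚ.* d) ◂ f
◂-assoc c d f n = begin
  (c ◂ d ◂ f) n        ≡⟨ ◂-coeff c (d ◂ f) n ⟩
  c ℚ.* (d ◂ f) n      ≡⟨ cong (c ℚ.*_) (◂-coeff d f n) ⟩
  c ℚ.* (d ℚ.* f n)    ≡⟨ ℚₚ.*-assoc c d (f n) ⟨
  c ℚ.* d ℚ.* f n      ≡⟨ ◂-coeff (c ℚ.* d) f n ⟨
  ((c ℚ.* d) ◂ f) n    ∎
  where open ≡-Reasoning

◂-identity : ∀ f → 1ℚ ◂ f ≋ f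
◂-identity f n = trans (◂-coeff 1ℚ f n) (ℚₚ.*-identityˡ (f n))

◂-zero : ∀ f → 0ℚ ◂ f ≋ 𝟘
◂-zero f n = trans (◂-coeff 0ℚ f n) (trans (ℚₚ.*-zeroˡ (f n)) (sym (𝟘-coeff n)))

⊛-◂-assoc : ∀ c f g → f ⊛ (c ◂ g) ≋ c ◂ (f ⊛ g)
⊛-◂-assoc c f g = 𝕊.trans (𝕊.*-comm f (c ◂ g)) (𝕊.trans (◂-⊛-assoc c g f) (◂-cong refl (𝕊.*-comm g f)))

◂-distribʳ : ∀ c d f → (c ℚ.+ d) ◂ f ≋ c ◂ f ⊕ d ◂ f
◂-distribʳ c d f n = begin
  ((c ℚ.+ d) ◂ f) n            ≡⟨ ◂-coeff (c ℚ.+ d) f n ⟩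
  (c ℚ.+ d) ℚ.* f n            ≡⟨ ℚₚ.*-distribʳ-+ (f n) c d ⟩
  c ℚ.* f n ℚ.+ d ℚ.* f n      ≡⟨ cong₂ ℚ._+_ (◂-coeff c f n) (◂-coeff d f n) ⟨
  (c ◂ f) n ℚ.+ (d ◂ f) n      ≡⟨ ⊕-coeff (c ◂ f) (d ◂ f) n ⟨
  (c ◂ f ⊕ d ◂ f) n            ∎
  where open ≡-Reasoning

module ℚ-Alg = Algebra.Definitions.RawSemiring ℚ.+-*-rawSemiring
open ℚ-Alg using () renaming (_^_ to _^ℚ_)

-- Finite sums and summable families

-- Fractions `m / d` are normalised by a gcd that is stuck on variables. Identities between them are
-- therefore checked as integer identities in the unnormalised rationals and transported along
-- `fromℚᵘ`.
fromℚᵘ-homo-+ : ∀ p q → ℚ.fromℚᵘ (p ℚᵘ.+ q) ≡ ℚ.fromℚᵘ p ℚ.+ ℚ.fromℚᵘ q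
fromℚᵘ-homo-+ p q = ℚₚ.toℚᵘ-injective (begin
  ℚ.toℚᵘ (ℚ.fromℚᵘ (p ℚᵘ.+ q))                       ≈⟨ ℚₚ.toℚᵘ-fromℚᵘ (p ℚᵘ.+ q) ⟩
  p ℚᵘ.+ q                                           ≈⟨ ℚᵘₚ.+-cong (ℚₚ.toℚᵘ-fromℚᵘ p) (ℚₚ.toℚᵘ-fromℚᵘ q) ⟨
  ℚ.toℚᵘ (ℚ.fromℚᵘ p) ℚᵘ.+ ℚ.toℚᵘ (ℚ.fromℚᵘ q)       ≈⟨ ℚₚ.toℚᵘ-homo-+ (ℚ.fromℚᵘ p) (ℚ.fromℚᵘ q) ⟨
  ℚ.toℚᵘ (ℚ.fromℚᵘ p ℚ.+ ℚ.fromℚᵘ q)                 ∎)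
  where open ℚᵘₚ.≃-Reasoning

fromℚᵘ-homo-* : ∀ p q → ℚ.fromℚᵘ (p ℚᵘ.* q) ≡ ℚ.fromℚᵘ p ℚ.* ℚ.fromℚᵘ q
fromℚᵘ-homo-* p q = ℚₚ.toℚᵘ-injective (begin
  ℚ.toℚᵘ (ℚ.fromℚᵘ (p ℚᵘ.* q))                       ≈⟨ ℚₚ.toℚᵘ-fromℚᵘ (p ℚᵘ.* q) ⟩
  p ℚᵘ.* q                                           ≈⟨ ℚᵘₚ.*-cong (ℚₚ.toℚᵘ-fromℚᵘ p) (ℚₚ.toℚᵘ-fromℚᵘ q) ⟨
  ℚ.toℚᵘ (ℚ.fromℚᵘ p) ℚᵘ.* ℚ.toℚᵘ (ℚ.fromℚᵘ q)       ≈⟨ ℚₚ.toℚᵘ-homo-* (ℚ.fromℚᵘ p) (ℚ.fromℚᵘ q) ⟨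
  ℚ.toℚᵘ (ℚ.fromℚᵘ p ℚ.* ℚ.fromℚᵘ q)                 ∎)
  where open ℚᵘₚ.≃-Reasoning

fromℕ-homo-+ : ∀ m n → fromℕ (m ℕ.+ n) ≡ fromℕ m ℚ.+ fromℕ n
fromℕ-homo-+ m n = trans
  (ℚₚ.fromℚᵘ-cong {ℚᵘ.mkℚᵘ (+ (m ℕ.+ n)) 0} {ℚᵘ.mkℚᵘ (+ m) 0 ℚᵘ.+ ℚᵘ.mkℚᵘ (+ n) 0} (ℚᵘ.*≡* (cong (ℤ._* (+ 1))
    (sym (cong₂ ℤ._+_ (ℤₚ.*-identityʳ (+ m)) (ℤₚ.*-identityʳ (+ n)))))))
  (fromℚᵘ-homo-+ (ℚᵘ.mkℚᵘ (+ m) 0) (ℚᵘ.mkℚᵘ (+ n) 0))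

fromℕ-homo-* : ∀ m n → fromℕ (m ℕ.* n) ≡ fromℕ m ℚ.* fromℕ n
fromℕ-homo-* m n = trans
  (ℚₚ.fromℚᵘ-cong {ℚᵘ.mkℚᵘ (+ (m ℕ.* n)) 0} {ℚᵘ.mkℚᵘ (+ m) 0 ℚᵘ.* ℚᵘ.mkℚᵘ (+ n) 0} (ℚᵘ.*≡* (cong (ℤ._* (+ 1)) (ℤₚ.pos-* m n))))
  (fromℚᵘ-homo-* (ℚᵘ.mkℚᵘ (+ m) 0) (ℚᵘ.mkℚᵘ (+ n) 0))

/≡*1/ : ∀ a d .{{_ : ℕ.NonZero d}} → (+ a) ℚ./ d ≡ fromℕ a ℚ.* ((+ 1) ℚ./ d)
/≡*1/ a (suc d) = trans
  (ℚₚ.fromℚᵘ-cong {ℚᵘ.mkℚᵘ (+ a) d} {ℚᵘ.mkℚᵘ (+ a) 0 ℚᵘ.* ℚᵘ.mkℚᵘ (+ 1) d} (ℚᵘ.*≡*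
    (cong₂ ℤ._*_ (sym (ℤₚ.*-identityʳ (+ a))) (cong (λ m → + suc m) (ℕₚ.+-identityʳ d)))))
  (fromℚᵘ-homo-* (ℚᵘ.mkℚᵘ (+ a) 0) (ℚᵘ.mkℚᵘ (+ 1) d))

*-inverse : ∀ d .{{_ : ℕ.NonZero d}} → fromℕ d ℚ.* ((+ 1) ℚ./ d) ≡ 1ℚ
*-inverse (suc d) = trans (sym (/≡*1/ (suc d) (suc d)))
  (ℚₚ.fromℚᵘ-cong {ℚᵘ.mkℚᵘ (+ suc d) d} {ℚᵘ.mkℚᵘ (+ 1) 0} (ℚᵘ.*≡* (ℤₚ.*-comm (+ suc d) (+ 1))))

fromℕ-cancel : ∀ d .{{_ : ℕ.NonZero d}} {x y} → fromℕ d ℚ.* x ≡ fromℕ d ℚ.* y → x ≡ y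
fromℕ-cancel d {x} {y} eq = begin
  x                                       ≡⟨ lemma x ⟩
  ((+ 1) ℚ./ d) ℚ.* (fromℕ d ℚ.* x)       ≡⟨ cong (((+ 1) ℚ./ d) ℚ.*_) eq ⟩
  ((+ 1) ℚ./ d) ℚ.* (fromℕ d ℚ.* y)       ≡⟨ lemma y ⟨
  y                                       ∎
  where
  open ≡-Reasoning
  lemma : ∀ z → z ≡ ((+ 1) ℚ./ d) ℚ.* (fromℕ d ℚ.* z)
  lemma z = begin
    z                                     ≡⟨ ℚₚ.*-identityˡ z ⟨
    1ℚ ℚ.* z                              ≡⟨ cong (ℚ._* z) (*-inverse d) ⟨
    fromℕ d ℚ.* ((+ 1) ℚ./ d) ℚ.* z       ≡⟨ cong (ℚ._* z) (ℚₚ.*-comm (fromℕ d) ((+ 1) ℚ./ d)) ⟩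
    ((+ 1) ℚ./ d) ℚ.* fromℕ d ℚ.* z       ≡⟨ ℚₚ.*-assoc ((+ 1) ℚ./ d) (fromℕ d) z ⟩
    ((+ 1) ℚ./ d) ℚ.* (fromℕ d ℚ.* z)     ∎

Σ< : ℕ → (ℕ → ℚ) → ℚ
Σ< zero    f = 0ℚ
Σ< (suc n) f = f 0 ℚ.+ Σ< n (f ∘ suc)

sum≡Σ< : ∀ n f → ℚ-Alg.sum {n} (λ i → f (toℕ i)) ≡ Σ< n f
sum≡Σ< zero    f = refl
sum≡Σ< (suc n) f = cong (f 0 ℚ.+_) (sum≡Σ< n (f ∘ suc))

Σ<-cong : ∀ n {f g} → (∀ i → i < n → f i ≡ g i) → Σ< n f ≡ Σ< n g
Σ<-cong zero    f≡g = refl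
Σ<-cong (suc n) f≡g = cong₂ ℚ._+_ (f≡g 0 (s≤s z≤n)) (Σ<-cong n (λ i i<n → f≡g (suc i) (s≤s i<n)))

Σ<-zero : ∀ n {f} → (∀ i → i < n → f i ≡ 0ℚ) → Σ< n f ≡ 0ℚ
Σ<-zero zero    f≡0 = refl
Σ<-zero (suc n) f≡0 = trans (cong₂ ℚ._+_ (f≡0 0 (s≤s z≤n)) (Σ<-zero n (λ i i<n → f≡0 (suc i) (s≤s i<n)))) (ℚₚ.+-identityʳ 0ℚ)

Σ<-distribˡ : ∀ n c f → c ℚ.* Σ< n f ≡ Σ< n (λ i → c ℚ.* f i)
Σ<-distribˡ zero    c f = ℚₚ.*-zeroʳ c
Σ<-distribˡ (suc n) c f = trans (ℚₚ.*-distribˡ-+ c (f 0) (Σ< n (f ∘ suc)))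
  (cong (c ℚ.* f 0 ℚ.+_) (Σ<-distribˡ n c (f ∘ suc)))

Σ<-last : ∀ n f → Σ< (suc n) f ≡ Σ< n f ℚ.+ f n
Σ<-last zero    f = ℚₚ.+-comm (f 0) 0ℚ
Σ<-last (suc n) f = trans (cong (f 0 ℚ.+_) (Σ<-last n (f ∘ suc))) (sym (ℚₚ.+-assoc (f 0) (Σ< n (f ∘ suc)) (f (suc n))))

Σ<-extend : ∀ {m n} f → m ≤ n → (∀ i → m ≤ i → f i ≡ 0ℚ) → Σ< n f ≡ Σ< m f
Σ<-extend {n = n} f z≤n       f≡0 = Σ<-zero n (λ i _ → f≡0 i z≤n)
Σ<-extend         f (s≤s m≤n) f≡0 = cong (f 0 ℚ.+_) (Σ<-extend (f ∘ suc) m≤n (λ i m≤i → f≡0 (suc i) (s≤s m≤i)))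

Ord : ℕ → PowerSeries → Set
Ord k f = ∀ i → i < k → f i ≡ 0ℚ

Ord-⊛ʳ : ∀ {l} f {g} → Ord l g → Ord l (f ⊛ g)
Ord-⊛ʳ {l} f {g} o i i<l = begin
  (f ⊛ g) i  ≡⟨ ⊛-cong-upto i {f} {f} {g} {𝟘} (λ _ _ → refl)
                  (λ j j≤i → trans (o j (ℕₚ.≤-<-trans j≤i i<l)) (sym (𝟘-coeff j))) ⟩
  (f ⊛ 𝟘) i  ≡⟨ 𝕊.zeroʳ f i ⟩
  𝟘 i        ≡⟨ 𝟘-coeff i ⟩
  0ℚ         ∎
  where open ≡-Reasoning

Ord-⊛ : ∀ k {l f g} → Ord k f → Ord l g → Ord (k ℕ.+ l) (f ⊛ g)
Ord-⊛ zero    {f = f} o₁ o₂ = Ord-⊛ʳ f o₂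
Ord-⊛ (suc k) {f = f} {g} o₁ o₂ zero i<k+l = trans (⊛-coeff₀ f g)
  (trans (cong (ℚ._* g 0) (o₁ 0 (s≤s z≤n))) (ℚₚ.*-zeroˡ (g 0)))
Ord-⊛ (suc k) {f = f} {g} o₁ o₂ (suc i) (s≤s i<k+l) = begin
  (f ⊛ g) (suc i)                               ≡⟨ ⊛-suc f g i ⟩
  f 0 ℚ.* g (suc i) ℚ.+ (shift f ⊛ g) i         ≡⟨ cong₂ ℚ._+_ (trans (cong (ℚ._* g (suc i)) (o₁ 0 (s≤s z≤n))) (ℚₚ.*-zeroˡ (g (suc i))))
                                                     (Ord-⊛ k {f = shift f} {g} (λ j j<k → o₁ (suc j) (s≤s j<k)) o₂ i i<k+l) ⟩
  0ℚ ℚ.+ 0ℚ                                     ≡⟨ ℚₚ.+-identityʳ 0ℚ ⟩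
  0ℚ                                            ∎
  where open ≡-Reasoning

Ord-^ : ∀ {f} k → Ord 1 f → Ord k (f ^ k)
Ord-^ zero    o = λ _ ()
Ord-^ (suc k) o = Ord-⊛ 1 o (Ord-^ k o)

Ord-◂ : ∀ {k} c {f} → Ord k f → Ord k (c ◂ f)
Ord-◂ c {f} o i i<k = trans (◂-coeff c f i) (trans (cong (c ℚ.*_) (o i i<k)) (ℚₚ.*-zeroʳ c))

-- Equals the infinite sum of F only if F is Summable.
Sum : (ℕ → PowerSeries) → PowerSeries
Sum F n = Σ< (suc n) (λ k → F k n)

Summable : (ℕ → PowerSeries) → Set
Summable F = ∀ k → Ord k (F k)

Sum-cong : ∀ {F G} → (∀ k → F k ≋ G k) → Sum F ≋ Sum G
Sum-cong F≋G n = Σ<-cong (suc n) (λ k _ → F≋G k n)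

Sum-truncate : ∀ {F} → Summable F → ∀ {n K} → n < K → Σ< K (λ k → F k n) ≡ Sum F n
Sum-truncate {F} o {n} n<K = Σ<-extend (λ k → F k n) n<K (λ k n<k → o k n n<k)

partialSum : ℕ → (ℕ → PowerSeries) → PowerSeries
partialSum K F n = Σ< K (λ k → F k n)

⊛-partialSum : ∀ A K F → A ⊛ partialSum K F ≋ partialSum K (λ k → A ⊛ F k)
⊛-partialSum A zero    F n = trans (𝕊.*-congˡ {A} {partialSum 0 F} {𝟘} (λ i → sym (𝟘-coeff i)) n)
  (trans (𝕊.zeroʳ A n) (𝟘-coeff n))
⊛-partialSum A (suc K) F n = begin
  (A ⊛ partialSum (suc K) F) n                         ≡⟨ 𝕊.*-congˡ {A} {partialSum (suc K) F} {F 0 ⊕ partialSum K (F ∘ suc)}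
                                                            (λ i → sym (⊕-coeff (F 0) (partialSum K (F ∘ suc)) i)) n ⟩
  (A ⊛ (F 0 ⊕ partialSum K (F ∘ suc))) n               ≡⟨ 𝕊.distribˡ A (F 0) (partialSum K (F ∘ suc)) n ⟩
  (A ⊛ F 0 ⊕ A ⊛ partialSum K (F ∘ suc)) n             ≡⟨ ⊕-coeff (A ⊛ F 0) (A ⊛ partialSum K (F ∘ suc)) n ⟩
  (A ⊛ F 0) n ℚ.+ (A ⊛ partialSum K (F ∘ suc)) n       ≡⟨ cong ((A ⊛ F 0) n ℚ.+_) (⊛-partialSum A K (F ∘ suc) n) ⟩
  (A ⊛ F 0) n ℚ.+ partialSum K (λ k → A ⊛ F (suc k)) n ∎
  where open ≡-Reasoning

-- Coefficient `n` of the product sees only coefficients up to `n` of the sum, and for these one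
-- partial sum of a summable family suffices.
⊛-Sum : ∀ A {F} → Summable F → A ⊛ Sum F ≋ Sum (λ k → A ⊛ F k)
⊛-Sum A {F} o n = trans
  (⊛-cong-upto n {A} {A} {Sum F} {partialSum (suc n) F} (λ _ _ → refl) (λ i i≤n → sym (Sum-truncate o (s≤s i≤n))))
  (⊛-partialSum A (suc n) F n)

-- At x^n the right-hand side has one term more, `F (suc n) n`, which summability makes zero.
Sum-suc : ∀ {F} → Summable F → Sum F ≋ F 0 ⊕ Sum (F ∘ suc)
Sum-suc {F} o n = begin
  F 0 n ℚ.+ Σ< n (λ k → F (suc k) n)           ≡⟨ cong (F 0 n ℚ.+_) (ℚₚ.+-identityʳ (Σ< n (λ k → F (suc k) n))) ⟨
  F 0 n ℚ.+ (Σ< n (λ k → F (suc k) n) ℚ.+ 0ℚ)  ≡⟨ cong (λ z → F 0 n ℚ.+ (Σ< n (λ k → F (suc k) n) ℚ.+ z)) (o (suc n) n ℕₚ.≤-refl) ⟨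
  F 0 n ℚ.+ (Σ< n (λ k → F (suc k) n) ℚ.+ F (suc n) n) ≡⟨ cong (F 0 n ℚ.+_) (Σ<-last n (λ k → F (suc k) n)) ⟨
  F 0 n ℚ.+ Σ< (suc n) (λ k → F (suc k) n)     ≡⟨ ⊕-coeff (F 0) (Sum (F ∘ suc)) n ⟨
  (F 0 ⊕ Sum (F ∘ suc)) n                      ∎
  where open ≡-Reasoning

-- The derivation x d/dx; unlike d/dx it preserves divisibility by x^k.
θ : PowerSeries → PowerSeries
θ f n = fromℕ n ℚ.* f n

θ-cong : ∀ {f g} → f ≋ g → θ f ≋ θ g
θ-cong f≋g n = cong (fromℕ n ℚ.*_) (f≋g n)

θ-Ord₁ : ∀ f → Ord 1 (θ f)
θ-Ord₁ f zero    _        = ℚₚ.*-zeroˡ (f 0)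
θ-Ord₁ f (suc i) (s≤s ())

θ-⊕ : ∀ f g → θ (f ⊕ g) ≋ θ f ⊕ θ g
θ-⊕ f g n = trans (cong (fromℕ n ℚ.*_) (⊕-coeff f g n)) (trans (ℚₚ.*-distribˡ-+ (fromℕ n) (f n) (g n)) (sym (⊕-coeff (θ f) (θ g) n)))

θ-◂ : ∀ c f → θ (c ◂ f) ≋ c ◂ θ f
θ-◂ c f n = begin
  fromℕ n ℚ.* (c ◂ f) n      ≡⟨ cong (fromℕ n ℚ.*_) (◂-coeff c f n) ⟩
  fromℕ n ℚ.* (c ℚ.* f n)    ≡⟨ lemma (fromℕ n) c (f n) ⟩
  c ℚ.* (fromℕ n ℚ.* f n)    ≡⟨ ◂-coeff c (θ f) n ⟨
  (c ◂ θ f) n                ∎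
  where
  open ≡-Reasoning
  lemma : ∀ a b c → a ℚ.* (b ℚ.* c) ≡ b ℚ.* (a ℚ.* c)
  lemma = solve-∀ ℚ-ring

θ-Sum : ∀ F → θ (Sum F) ≋ Sum (θ ∘ F)
θ-Sum F n = Σ<-distribˡ (suc n) (fromℕ n) (λ k → F k n)

shift-θ : ∀ f → shift (θ f) ≋ shift f ⊕ θ (shift f)
shift-θ f n = begin
  fromℕ (suc n) ℚ.* f (suc n)             ≡⟨ cong (ℚ._* f (suc n)) (fromℕ-homo-+ 1 n) ⟩
  (1ℚ ℚ.+ fromℕ n) ℚ.* f (suc n)          ≡⟨ lemma (fromℕ n) (f (suc n)) ⟩
  f (suc n) ℚ.+ fromℕ n ℚ.* f (suc n)     ≡⟨ ⊕-coeff (shift f) (θ (shift f)) n ⟨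
  (shift f ⊕ θ (shift f)) n               ∎
  where
  open ≡-Reasoning
  lemma : ∀ a b → (1ℚ ℚ.+ a) ℚ.* b ≡ b ℚ.+ a ℚ.* b
  lemma = solve-∀ ℚ-ring

θ-⊛ : ∀ f g → θ (f ⊛ g) ≋ θ f ⊛ g ⊕ f ⊛ θ g
θ-⊛ f g zero = begin
  0ℚ ℚ.* (f ⊛ g) 0                         ≡⟨ lemma (f 0) (g 0) ((f ⊛ g) 0) ⟩
  0ℚ ℚ.* f 0 ℚ.* g 0 ℚ.+ f 0 ℚ.* (0ℚ ℚ.* g 0)  ≡⟨ cong₂ ℚ._+_ (⊛-coeff₀ (θ f) g) (⊛-coeff₀ f (θ g)) ⟨
  (θ f ⊛ g) 0 ℚ.+ (f ⊛ θ g) 0              ≡⟨ ⊕-coeff (θ f ⊛ g) (f ⊛ θ g) 0 ⟨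
  (θ f ⊛ g ⊕ f ⊛ θ g) 0                    ∎
  where
  open ≡-Reasoning
  lemma : ∀ a b c → 0ℚ ℚ.* c ≡ 0ℚ ℚ.* a ℚ.* b ℚ.+ a ℚ.* (0ℚ ℚ.* b)
  lemma = solve-∀ ℚ-ring
θ-⊛ f g (suc n) = begin
  fromℕ (suc n) ℚ.* (f ⊛ g) (suc n)
    ≡⟨ cong (fromℕ (suc n) ℚ.*_) (⊛-suc f g n) ⟩
  fromℕ (suc n) ℚ.* (f 0 ℚ.* g (suc n) ℚ.+ (shift f ⊛ g) n)
    ≡⟨ lemma₁ (fromℕ (suc n)) (fromℕ n) (f 0) (g (suc n)) ((shift f ⊛ g) n) (fromℕ-homo-+ 1 n) ⟩
  f 0 ℚ.* (fromℕ (suc n) ℚ.* g (suc n)) ℚ.+ ((shift f ⊛ g) n ℚ.+ θ (shift f ⊛ g) n)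
    ≡⟨ cong (λ z → f 0 ℚ.* (fromℕ (suc n) ℚ.* g (suc n)) ℚ.+ ((shift f ⊛ g) n ℚ.+ z))
         (trans (θ-⊛ (shift f) g n) (⊕-coeff (θ (shift f) ⊛ g) (shift f ⊛ θ g) n)) ⟩
  f 0 ℚ.* θ g (suc n) ℚ.+ ((shift f ⊛ g) n ℚ.+ ((θ (shift f) ⊛ g) n ℚ.+ (shift f ⊛ θ g) n))
    ≡⟨ lemma₂ (f 0) (θ g (suc n)) ((shift f ⊛ g) n) ((θ (shift f) ⊛ g) n) ((shift f ⊛ θ g) n) (g (suc n)) ⟩
  (0ℚ ℚ.* f 0 ℚ.* g (suc n) ℚ.+ ((shift f ⊛ g) n ℚ.+ (θ (shift f) ⊛ g) n)) ℚ.+ (f 0 ℚ.* θ g (suc n) ℚ.+ (shift f ⊛ θ g) n)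
    ≡⟨ cong₂ (λ y z → (0ℚ ℚ.* f 0 ℚ.* g (suc n) ℚ.+ y) ℚ.+ z) distr (⊛-suc f (θ g) n) ⟨
  (0ℚ ℚ.* f 0 ℚ.* g (suc n) ℚ.+ (shift (θ f) ⊛ g) n) ℚ.+ (f ⊛ θ g) (suc n)
    ≡⟨ cong (ℚ._+ (f ⊛ θ g) (suc n)) (⊛-suc (θ f) g n) ⟨
  (θ f ⊛ g) (suc n) ℚ.+ (f ⊛ θ g) (suc n)
    ≡⟨ ⊕-coeff (θ f ⊛ g) (f ⊛ θ g) (suc n) ⟨
  (θ f ⊛ g ⊕ f ⊛ θ g) (suc n) ∎
  where
  open ≡-Reasoning
  lemma₁ : ∀ m k a b c → m ≡ 1ℚ ℚ.+ k → m ℚ.* (a ℚ.* b ℚ.+ c) ≡ a ℚ.* (m ℚ.* b) ℚ.+ (c ℚ.+ k ℚ.* c)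
  lemma₁ m k a b c refl = go k a b c
    where
    go : ∀ k a b c → (1ℚ ℚ.+ k) ℚ.* (a ℚ.* b ℚ.+ c) ≡ a ℚ.* ((1ℚ ℚ.+ k) ℚ.* b) ℚ.+ (c ℚ.+ k ℚ.* c)
    go = solve-∀ ℚ-ring
  lemma₂ : ∀ a b c d e g → a ℚ.* b ℚ.+ (c ℚ.+ (d ℚ.+ e)) ≡ (0ℚ ℚ.* a ℚ.* g ℚ.+ (c ℚ.+ d)) ℚ.+ (a ℚ.* b ℚ.+ e)
  lemma₂ = solve-∀ ℚ-ring
  distr : (shift (θ f) ⊛ g) n ≡ (shift f ⊛ g) n ℚ.+ (θ (shift f) ⊛ g) n
  distr = trans (𝕊.*-congʳ {g} {shift (θ f)} {shift f ⊕ θ (shift f)} (shift-θ f) n)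
    (trans (𝕊.distribʳ g (shift f) (θ (shift f)) n) (⊕-coeff (shift f ⊛ g) (θ (shift f) ⊛ g) n))

-- The Leibniz rule for 1 = 1 * 1 makes each coefficient equal to its own double.
θ-𝟙 : θ 𝟙 ≋ 𝟘
θ-𝟙 n = begin
  θ 𝟙 n                ≡⟨ lemma (θ 𝟙 n) double ⟩
  0ℚ                   ≡⟨ 𝟘-coeff n ⟨
  𝟘 n                  ∎
  where
  open ≡-Reasoning
  double : θ 𝟙 n ≡ θ 𝟙 n ℚ.+ θ 𝟙 n
  double = begin
    θ 𝟙 n                       ≡⟨ θ-cong (𝕊.*-identityˡ 𝟙) n ⟨
    θ (𝟙 ⊛ 𝟙) n                 ≡⟨ θ-⊛ 𝟙 𝟙 n ⟩
    (θ 𝟙 ⊛ 𝟙 ⊕ 𝟙 ⊛ θ 𝟙) n       ≡⟨ ⊕-coeff (θ 𝟙 ⊛ 𝟙) (𝟙 ⊛ θ 𝟙) n ⟩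
    (θ 𝟙 ⊛ 𝟙) n ℚ.+ (𝟙 ⊛ θ 𝟙) n ≡⟨ cong₂ ℚ._+_ (𝕊.*-identityʳ (θ 𝟙) n) (𝕊.*-identityˡ (θ 𝟙) n) ⟩
    θ 𝟙 n ℚ.+ θ 𝟙 n             ∎
  lemma : ∀ a → a ≡ a ℚ.+ a → a ≡ 0ℚ
  lemma a e = trans (go₁ a) (trans (cong (ℚ._+ (ℚ.- a)) (sym e)) (ℚₚ.+-inverseʳ a))
    where
    go₁ : ∀ a → a ≡ a ℚ.+ a ℚ.+ (ℚ.- a)
    go₁ = solve-∀ ℚ-ring

-- Reciprocal, logarithm and exponential

^-def : ∀ f k → f ^ k ≡ f Series.^ k
^-def f zero    = 𝟙-def
^-def f (suc k) = trans (⊛-def f (f ^ k)) (cong (f Series.*_) (^-def f k))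

opaque
  unfolding _⊕_

  one-minus : ∀ f → 𝟙 ⊕ ⊖ f ≡ Series.1# Series.- f
  one-minus f = refl

  minus-one : ∀ f → f ⊕ ⊖ 𝟙 ≡ f Series.- Series.1#
  minus-one f = refl

one-minus-Ord : ∀ f → f 0 ≡ 1ℚ → Ord 1 (𝟙 ⊕ ⊖ f)
one-minus-Ord f f₀ (suc i) (s≤s ())
one-minus-Ord f f₀ zero _ = begin
  (𝟙 ⊕ ⊖ f) 0        ≡⟨ ⊕-coeff 𝟙 (⊖ f) 0 ⟩
  𝟙 0 ℚ.+ (⊖ f) 0    ≡⟨ cong₂ ℚ._+_ 𝟙-coeff₀ (trans (⊖-coeff f 0) (cong ℚ.-_ f₀)) ⟩
  1ℚ ℚ.- 1ℚ          ≡⟨ ℚₚ.+-inverseʳ 1ℚ ⟩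
  0ℚ                 ∎
  where open ≡-Reasoning

geometric : PowerSeries → PowerSeries
geometric v = Sum (v ^_)

geometric-unfold : ∀ {v} → Ord 1 v → geometric v ≋ 𝟙 ⊕ v ⊛ geometric v
geometric-unfold {v} o = 𝕊.trans (Sum-suc (λ k → Ord-^ k o))
  (𝕊.+-congˡ {𝟙} (𝕊.sym (⊛-Sum v (λ k → Ord-^ k o))))

recip-def : ∀ f → Series.recip f ≋ geometric (𝟙 ⊕ ⊖ f)
recip-def f n = trans (sum≡Σ< (suc n) (λ m → ((Series.1# Series.- f) Series.^ m) n))
  (Σ<-cong (suc n) (λ m _ → cong-app (sym (trans (^-def (𝟙 ⊕ ⊖ f) m) (cong (Series._^ m) (one-minus f)))) n))

-- With v = 1 - f and R the geometric series of v, R = 1 + v R, while f + v = 1 gives R = f R + v R.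
-- Cancel v R.
recip-inverse : ∀ f → f 0 ≡ 1ℚ → f ⊛ Series.recip f ≋ 𝟙
recip-inverse f f₀ = 𝕊-Group.∙-cancelʳ (v ⊛ R) (f ⊛ R) 𝟙 (begin
  f ⊛ R ⊕ v ⊛ R          ≈⟨ 𝕊.distribʳ R f v ⟨
  (f ⊕ (𝟙 ⊕ ⊖ f)) ⊛ R    ≈⟨ 𝕊.*-congʳ {R} f+v ⟩
  𝟙 ⊛ R                  ≈⟨ 𝕊.*-identityˡ R ⟩
  R                      ≈⟨ recip-def f ⟩
  geometric v            ≈⟨ geometric-unfold (one-minus-Ord f f₀) ⟩
  𝟙 ⊕ v ⊛ geometric v    ≈⟨ 𝕊.+-congˡ {𝟙} (𝕊.*-congˡ {v} (recip-def f)) ⟨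
  𝟙 ⊕ v ⊛ R              ∎)
  where
  open 𝕊-Reasoning
  v = 𝟙 ⊕ ⊖ f
  R = Series.recip f
  f+v : f ⊕ (𝟙 ⊕ ⊖ f) ≋ 𝟙
  f+v = begin
    f ⊕ (𝟙 ⊕ ⊖ f)   ≈⟨ 𝕊.+-congˡ {f} (𝕊.+-comm 𝟙 (⊖ f)) ⟩
    f ⊕ (⊖ f ⊕ 𝟙)   ≈⟨ 𝕊.+-assoc f (⊖ f) 𝟙 ⟨
    f ⊕ ⊖ f ⊕ 𝟙     ≈⟨ 𝕊.+-congʳ {𝟙} (𝕊.-‿inverseʳ f) ⟩
    𝟘 ⊕ 𝟙           ≈⟨ 𝕊.+-identityˡ 𝟙 ⟩
    𝟙               ∎

θ-^ : ∀ f k → θ (f ^ suc k) ≋ fromℕ (suc k) ◂ (f ^ k ⊛ θ f)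
θ-^ f zero = begin
  θ (f ⊛ 𝟙)        ≈⟨ θ-cong (𝕊.*-identityʳ f) ⟩
  θ f              ≈⟨ 𝕊.*-identityˡ (θ f) ⟨
  𝟙 ⊛ θ f          ≈⟨ ◂-identity (𝟙 ⊛ θ f) ⟨
  1ℚ ◂ (𝟙 ⊛ θ f)   ∎
  where open 𝕊-Reasoning
θ-^ f (suc k) = begin
  θ (f ⊛ f ^ suc k)                                        ≈⟨ θ-⊛ f (f ^ suc k) ⟩
  θ f ⊛ f ^ suc k ⊕ f ⊛ θ (f ^ suc k)                      ≈⟨ 𝕊.+-congˡ {θ f ⊛ f ^ suc k} (𝕊.*-congˡ {f} (θ-^ f k)) ⟩
  θ f ⊛ f ^ suc k ⊕ f ⊛ (fromℕ (suc k) ◂ (f ^ k ⊛ θ f))    ≈⟨ 𝕊.+-congˡ {θ f ⊛ f ^ suc k} (⊛-◂-assoc (fromℕ (suc k)) f (f ^ k ⊛ θ f)) ⟩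
  θ f ⊛ f ^ suc k ⊕ fromℕ (suc k) ◂ (f ⊛ (f ^ k ⊛ θ f))    ≈⟨ 𝕊.+-cong (𝕊.trans (𝕊.*-comm (θ f) (f ^ suc k)) (𝕊.sym (◂-identity (f ^ suc k ⊛ θ f))))
                                                                (◂-cong {fromℕ (suc k)} refl (𝕊.sym (𝕊.*-assoc f (f ^ k) (θ f)))) ⟩
  1ℚ ◂ (f ^ suc k ⊛ θ f) ⊕ fromℕ (suc k) ◂ (f ^ suc k ⊛ θ f) ≈⟨ ◂-distribʳ 1ℚ (fromℕ (suc k)) (f ^ suc k ⊛ θ f) ⟨
  (1ℚ ℚ.+ fromℕ (suc k)) ◂ (f ^ suc k ⊛ θ f)               ≈⟨ ◂-cong {1ℚ ℚ.+ fromℕ (suc k)} (sym (fromℕ-homo-+ 1 (suc k))) 𝕊.refl ⟩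
  fromℕ (2 ℕ.+ k) ◂ (f ^ suc k ⊛ θ f)                      ∎
  where open 𝕊-Reasoning

◂-^ : ∀ c f k → (c ^ℚ k) ◂ f ^ k ≋ (c ◂ f) ^ k
◂-^ c f zero    = ◂-identity 𝟙
◂-^ c f (suc k) = begin
  (c ℚ.* c ^ℚ k) ◂ (f ⊛ f ^ k)     ≈⟨ ◂-assoc c (c ^ℚ k) (f ⊛ f ^ k) ⟨
  c ◂ (c ^ℚ k) ◂ (f ⊛ f ^ k)       ≈⟨ ◂-cong {c} refl (𝕊.sym (⊛-◂-assoc (c ^ℚ k) f (f ^ k))) ⟩
  c ◂ (f ⊛ (c ^ℚ k) ◂ f ^ k)       ≈⟨ ◂-⊛-assoc c f ((c ^ℚ k) ◂ f ^ k) ⟨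
  (c ◂ f) ⊛ (c ^ℚ k) ◂ f ^ k       ≈⟨ 𝕊.*-congˡ {c ◂ f} (◂-^ c f k) ⟩
  (c ◂ f) ⊛ (c ◂ f) ^ k            ∎
  where open 𝕊-Reasoning

neg-minus-one : ∀ f → (ℚ.- 1ℚ) ◂ (f ⊕ ⊖ 𝟙) ≋ 𝟙 ⊕ ⊖ f
neg-minus-one f n = begin
  ((ℚ.- 1ℚ) ◂ (f ⊕ ⊖ 𝟙)) n         ≡⟨ ◂-coeff (ℚ.- 1ℚ) (f ⊕ ⊖ 𝟙) n ⟩
  (ℚ.- 1ℚ) ℚ.* (f ⊕ ⊖ 𝟙) n         ≡⟨ cong ((ℚ.- 1ℚ) ℚ.*_) (trans (⊕-coeff f (⊖ 𝟙) n) (cong (f n ℚ.+_) (⊖-coeff 𝟙 n))) ⟩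
  (ℚ.- 1ℚ) ℚ.* (f n ℚ.- 𝟙 n)       ≡⟨ lemma (f n) (𝟙 n) ⟩
  𝟙 n ℚ.- f n                      ≡⟨ trans (⊕-coeff 𝟙 (⊖ f) n) (cong (𝟙 n ℚ.+_) (⊖-coeff f n)) ⟨
  (𝟙 ⊕ ⊖ f) n                      ∎
  where
  open ≡-Reasoning
  lemma : ∀ a b → (ℚ.- 1ℚ) ℚ.* (a ℚ.+ (ℚ.- b)) ≡ b ℚ.+ (ℚ.- a)
  lemma = solve-∀ ℚ-ring

θ-minus-one : ∀ f → θ (f ⊕ ⊖ 𝟙) ≋ θ f
θ-minus-one f = begin
  θ u                   ≈⟨ 𝕊.+-identityʳ (θ u) ⟨
  θ u ⊕ 𝟘               ≈⟨ 𝕊.+-congˡ {θ u} θ-𝟙 ⟨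
  θ u ⊕ θ 𝟙             ≈⟨ θ-⊕ u 𝟙 ⟨
  θ (f ⊕ ⊖ 𝟙 ⊕ 𝟙)       ≈⟨ θ-cong (𝕊.trans (𝕊.+-assoc f (⊖ 𝟙) 𝟙) (𝕊.trans (𝕊.+-congˡ {f} (𝕊.-‿inverseˡ 𝟙)) (𝕊.+-identityʳ f))) ⟩
  θ f                   ∎
  where
  open 𝕊-Reasoning
  u = f ⊕ ⊖ 𝟙

log-def : ∀ f n → Series.log f n ≡ Σ< n (λ i → ((ℚ.- 1ℚ) ^ℚ i) ℚ.* (+ 1 ℚ./ suc i) ℚ.* ((f ⊕ ⊖ 𝟙) ^ suc i) n)
log-def f n = trans (sum≡Σ< n (λ i → ((ℚ.- 1ℚ) ^ℚ i) ℚ.* (+ 1 ℚ./ suc i) ℚ.* ((f Series.- Series.1#) Series.^ suc i) n))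
  (Σ<-cong n (λ i _ → cong (((ℚ.- 1ℚ) ^ℚ i) ℚ.* (+ 1 ℚ./ suc i) ℚ.*_)
    (cong-app (sym (trans (^-def (f ⊕ ⊖ 𝟙) (suc i)) (cong (Series._^ suc i) (minus-one f)))) n)))

log-Ord : ∀ f → Ord 1 (Series.log f)
log-Ord f zero    _        = refl
log-Ord f (suc i) (s≤s ())

-- With u = f - 1, the derivation turns (-1)^i u^(i+1) / (i+1) into (1 - f)^i θ f, and the powers of
-- 1 - f sum to the reciprocal of f.
θ-log : ∀ f → f 0 ≡ 1ℚ → θ (Series.log f) ≋ θ f ⊛ Series.recip f
θ-log f f₀ n = begin
  fromℕ n ℚ.* Series.log f n
    ≡⟨ cong (fromℕ n ℚ.*_) (log-def f n) ⟩
  fromℕ n ℚ.* Σ< n (λ i → c i ℚ.* (u ^ suc i) n)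
    ≡⟨ Σ<-distribˡ n (fromℕ n) (λ i → c i ℚ.* (u ^ suc i) n) ⟩
  Σ< n (λ i → fromℕ n ℚ.* (c i ℚ.* (u ^ suc i) n))
    ≡⟨ Σ<-cong n (λ i _ → term i) ⟩
  Σ< n (λ i → (θ f ⊛ v ^ i) n)
    -- At x^n the logarithm has n terms and `Sum` has n+1. The extra one vanishes because θ f
    -- contributes a further factor x.
    ≡⟨ Σ<-extend {n} {suc n} (λ i → (θ f ⊛ v ^ i) n) (ℕₚ.n≤1+n n)
         (λ i n≤i → Ord-⊛ 1 {i} (θ-Ord₁ f) (Ord-^ i (one-minus-Ord f f₀)) n (s≤s n≤i)) ⟨
  Sum (λ i → θ f ⊛ v ^ i) n
    ≡⟨ ⊛-Sum (θ f) {v ^_} (λ k → Ord-^ k (one-minus-Ord f f₀)) n ⟨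
  (θ f ⊛ geometric v) n
    ≡⟨ 𝕊.*-congˡ {θ f} (recip-def f) n ⟨
  (θ f ⊛ Series.recip f) n ∎
  where
  open ≡-Reasoning
  u = f ⊕ ⊖ 𝟙
  v = 𝟙 ⊕ ⊖ f
  c : ℕ → ℚ
  c i = ((ℚ.- 1ℚ) ^ℚ i) ℚ.* (+ 1 ℚ./ suc i)
  arith : ∀ s d m x → m ℚ.* d ≡ 1ℚ → s ℚ.* d ℚ.* (m ℚ.* x) ≡ s ℚ.* x
  arith s d m x e = trans (go s d m x) (trans (cong (λ z → s ℚ.* (z ℚ.* x)) e) (cong (s ℚ.*_) (ℚₚ.*-identityˡ x)))
    where
    go : ∀ s d m x → s ℚ.* d ℚ.* (m ℚ.* x) ≡ s ℚ.* (m ℚ.* d ℚ.* x)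
    go = solve-∀ ℚ-ring
  swap : ∀ a b c → a ℚ.* (b ℚ.* c) ≡ b ℚ.* (a ℚ.* c)
  swap = solve-∀ ℚ-ring
  term : ∀ i → fromℕ n ℚ.* (c i ℚ.* (u ^ suc i) n) ≡ (θ f ⊛ v ^ i) n
  term i = begin
    fromℕ n ℚ.* (c i ℚ.* (u ^ suc i) n)                ≡⟨ swap (fromℕ n) (c i) ((u ^ suc i) n) ⟩
    c i ℚ.* θ (u ^ suc i) n                            ≡⟨ cong (c i ℚ.*_) (trans (θ-^ u i n) (◂-coeff (fromℕ (suc i)) (u ^ i ⊛ θ u) n)) ⟩
    c i ℚ.* (fromℕ (suc i) ℚ.* (u ^ i ⊛ θ u) n)        ≡⟨ arith ((ℚ.- 1ℚ) ^ℚ i) (+ 1 ℚ./ suc i) (fromℕ (suc i)) ((u ^ i ⊛ θ u) n) (*-inverse (suc i)) ⟩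
    (ℚ.- 1ℚ) ^ℚ i ℚ.* (u ^ i ⊛ θ u) n                  ≡⟨ ◂-coeff ((ℚ.- 1ℚ) ^ℚ i) (u ^ i ⊛ θ u) n ⟨
    (((ℚ.- 1ℚ) ^ℚ i) ◂ (u ^ i ⊛ θ u)) n                ≡⟨ ◂-⊛-assoc ((ℚ.- 1ℚ) ^ℚ i) (u ^ i) (θ u) n ⟨
    ((((ℚ.- 1ℚ) ^ℚ i) ◂ u ^ i) ⊛ θ u) n                ≡⟨ 𝕊.*-cong (𝕊.trans (◂-^ (ℚ.- 1ℚ) u i) (^-congˡ i (neg-minus-one f))) (θ-minus-one f) n ⟩
    (v ^ i ⊛ θ f) n                                    ≡⟨ 𝕊.*-comm (v ^ i) (θ f) n ⟩
    (θ f ⊛ v ^ i) n                                    ∎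

dividedPower : PowerSeries → ℕ → PowerSeries
dividedPower G k = (+ 1 ℚ./ (k !)) {{ k ℕₚ.!≢0 }} ◂ (G ^ k)

divPow-def : ∀ G k → Series.divPow G k ≡ dividedPower G k
divPow-def G k = trans (cong ((+ 1 ℚ./ (k !)) {{ k ℕₚ.!≢0 }} Series.•_) (sym (^-def G k)))
  (sym (◂-def ((+ 1 ℚ./ (k !)) {{ k ℕₚ.!≢0 }}) (G ^ k)))

dividedPower-zero : ∀ G → dividedPower G 0 ≋ 𝟙
dividedPower-zero G = ◂-identity 𝟙

dividedPower-Ord : ∀ {G} k → Ord 1 G → Ord k (dividedPower G k)
dividedPower-Ord k o = Ord-◂ ((+ 1 ℚ./ (k !)) {{ k ℕₚ.!≢0 }}) (Ord-^ k o)

θ-dividedPower : ∀ G k → θ (dividedPower G (suc k)) ≋ θ G ⊛ dividedPower G k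
θ-dividedPower G k = begin
  θ (c ◂ G ^ suc k)                              ≈⟨ θ-◂ c (G ^ suc k) ⟩
  c ◂ θ (G ^ suc k)                              ≈⟨ ◂-cong {c} refl (θ-^ G k) ⟩
  c ◂ fromℕ (suc k) ◂ (G ^ k ⊛ θ G)              ≈⟨ ◂-assoc c (fromℕ (suc k)) (G ^ k ⊛ θ G) ⟩
  (c ℚ.* fromℕ (suc k)) ◂ (G ^ k ⊛ θ G)          ≈⟨ ◂-cong {c ℚ.* fromℕ (suc k)} {d} coefficient (𝕊.*-comm (G ^ k) (θ G)) ⟩
  d ◂ (θ G ⊛ G ^ k)                              ≈⟨ ⊛-◂-assoc d (θ G) (G ^ k) ⟨
  θ G ⊛ d ◂ G ^ k                                ∎
  where
  open 𝕊-Reasoning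
  instance
    k!≢0 = k ℕₚ.!≢0
    1+k!≢0 = suc k ℕₚ.!≢0
  c = + 1 ℚ./ (suc k !)
  d = + 1 ℚ./ (k !)
  coefficient : c ℚ.* fromℕ (suc k) ≡ d
  coefficient = fromℕ-cancel (k !) (trans (lemma (fromℕ (k !)) c (fromℕ (suc k)))
    (trans (cong (ℚ._* c) (sym (fromℕ-homo-* (suc k) (k !)))) (trans (*-inverse (suc k !)) (sym (*-inverse (k !))))))
    where
    lemma : ∀ a b c → a ℚ.* (b ℚ.* c) ≡ c ℚ.* a ℚ.* b
    lemma = solve-∀ ℚ-ring

expTerm : PowerSeries → ℚ → ℕ → PowerSeries
expTerm G s k = (s ^ℚ k) ◂ dividedPower G k

-- The series exp (s G), provided that G has zero constant term.
exp : PowerSeries → ℚ → PowerSeries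
exp G s = Sum (expTerm G s)

expTerm-Ord : ∀ {G} s → Ord 1 G → Summable (expTerm G s)
expTerm-Ord s o k = Ord-◂ (s ^ℚ k) (dividedPower-Ord k o)

θ-exp : ∀ {G} s → Ord 1 G → θ (exp G s) ≋ (s ◂ θ G) ⊛ exp G s
θ-exp {G} s o = begin
  θ (Sum (expTerm G s))                             ≈⟨ θ-Sum (expTerm G s) ⟩
  Sum (λ k → θ (expTerm G s k))                     ≈⟨ Sum-suc {θ ∘ expTerm G s} (λ k i i<k → trans (cong (fromℕ i ℚ.*_) (expTerm-Ord s o k i i<k)) (ℚₚ.*-zeroʳ (fromℕ i))) ⟩
  θ (expTerm G s 0) ⊕ Sum (λ k → θ (expTerm G s (suc k))) ≈⟨ 𝕊.+-cong first (Sum-cong rest) ⟩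
  𝟘 ⊕ Sum (λ k → (s ◂ θ G) ⊛ expTerm G s k)         ≈⟨ 𝕊.+-identityˡ (Sum (λ k → (s ◂ θ G) ⊛ expTerm G s k)) ⟩
  Sum (λ k → (s ◂ θ G) ⊛ expTerm G s k)             ≈⟨ ⊛-Sum (s ◂ θ G) (expTerm-Ord s o) ⟨
  (s ◂ θ G) ⊛ exp G s                               ∎
  where
  open 𝕊-Reasoning
  first : θ (expTerm G s 0) ≋ 𝟘
  first = 𝕊.trans (θ-cong (𝕊.trans (◂-identity (dividedPower G 0)) (dividedPower-zero G))) θ-𝟙
  rest : ∀ k → θ (expTerm G s (suc k)) ≋ (s ◂ θ G) ⊛ expTerm G s k
  rest k = begin
    θ ((s ℚ.* s ^ℚ k) ◂ dividedPower G (suc k))     ≈⟨ θ-◂ (s ℚ.* s ^ℚ k) (dividedPower G (suc k)) ⟩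
    (s ℚ.* s ^ℚ k) ◂ θ (dividedPower G (suc k))     ≈⟨ ◂-cong {s ℚ.* s ^ℚ k} refl (θ-dividedPower G k) ⟩
    (s ℚ.* s ^ℚ k) ◂ (θ G ⊛ dividedPower G k)       ≈⟨ ◂-assoc s (s ^ℚ k) (θ G ⊛ dividedPower G k) ⟨
    s ◂ (s ^ℚ k) ◂ (θ G ⊛ dividedPower G k)         ≈⟨ ◂-cong {s} refl (⊛-◂-assoc (s ^ℚ k) (θ G) (dividedPower G k)) ⟨
    s ◂ (θ G ⊛ expTerm G s k)                       ≈⟨ ◂-⊛-assoc s (θ G) (expTerm G s k) ⟨
    (s ◂ θ G) ⊛ expTerm G s k                       ∎

exp-coeff₀ : ∀ G s → exp G s 0 ≡ 1ℚ
exp-coeff₀ G s = trans (ℚₚ.+-identityʳ (expTerm G s 0 0))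
  (trans (𝕊.trans (◂-identity (dividedPower G 0)) (dividedPower-zero G) 0) 𝟙-coeff₀)

-- As A has no constant term, coefficient n+1 of A y involves only the coefficients of y up to n. On
-- the other side stands (n+1) times coefficient n+1 of y, and n+1 can be cancelled.
θ-unique : ∀ {A y z} → A 0 ≡ 0ℚ → θ y ≋ A ⊛ y → θ z ≋ A ⊛ z → y 0 ≡ z 0 → y ≋ z
θ-unique {A} {y} {z} A₀ y′ z′ y₀ n = upto n n ℕₚ.≤-refl
  where
  upto : ∀ n i → i ≤ n → y i ≡ z i
  upto zero    zero    _         = y₀
  upto (suc n) i       i≤1+n with ℕₚ.m≤n⇒m<n∨m≡n i≤1+n
  ... | inj₁ (s≤s i≤n) = upto n i i≤n
  ... | inj₂ refl = fromℕ-cancel (suc n) (begin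
    fromℕ (suc n) ℚ.* y (suc n)                      ≡⟨ trans (y′ (suc n)) (⊛-suc A y n) ⟩
    A 0 ℚ.* y (suc n) ℚ.+ (shift A ⊛ y) n            ≡⟨ cong₂ ℚ._+_ (trans (cong (ℚ._* y (suc n)) A₀) (trans (ℚₚ.*-zeroˡ (y (suc n)))
                                                          (sym (trans (cong (ℚ._* z (suc n)) A₀) (ℚₚ.*-zeroˡ (z (suc n)))))))
                                                          (⊛-cong-upto n {shift A} {shift A} (λ _ _ → refl) (upto n)) ⟩
    A 0 ℚ.* z (suc n) ℚ.+ (shift A ⊛ z) n            ≡⟨ trans (z′ (suc n)) (⊛-suc A z n) ⟨
    fromℕ (suc n) ℚ.* z (suc n)                      ∎)
    where open ≡-Reasoning

^-coeff₀ : ∀ {f} → f 0 ≡ 1ℚ → ∀ m → (f ^ m) 0 ≡ 1ℚ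
^-coeff₀ {f} f₀ zero    = 𝟙-coeff₀
^-coeff₀ {f} f₀ (suc m) = trans (⊛-coeff₀ f (f ^ m)) (cong₂ ℚ._*_ f₀ (^-coeff₀ f₀ m))

θ-^-log : ∀ f → f 0 ≡ 1ℚ → ∀ m → θ (f ^ m) ≋ (fromℕ m ◂ θ (Series.log f)) ⊛ f ^ m
θ-^-log f f₀ zero = 𝕊.trans θ-𝟙 (𝕊.sym (𝕊.trans (𝕊.*-congʳ {𝟙} (◂-zero (θ (Series.log f)))) (𝕊.zeroˡ 𝟙)))
θ-^-log f f₀ (suc m) = begin
  θ (f ^ suc m)                                       ≈⟨ θ-^ f m ⟩
  c ◂ (f ^ m ⊛ θ f)                                   ≈⟨ ◂-cong {c} refl (𝕊.sym (𝕊.*-identityˡ (f ^ m ⊛ θ f))) ⟩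
  c ◂ (𝟙 ⊛ (f ^ m ⊛ θ f))                             ≈⟨ ◂-cong {c} refl (𝕊.*-congʳ {f ^ m ⊛ θ f} (recip-inverse f f₀)) ⟨
  c ◂ (f ⊛ R ⊛ (f ^ m ⊛ θ f))                         ≈⟨ ◂-cong {c} refl (rearrange f R (f ^ m) (θ f)) ⟩
  c ◂ (θ f ⊛ R ⊛ (f ⊛ f ^ m))                         ≈⟨ ◂-cong {c} refl (𝕊.*-congʳ {f ⊛ f ^ m} (θ-log f f₀)) ⟨
  c ◂ (θ (Series.log f) ⊛ f ^ suc m)                  ≈⟨ ◂-⊛-assoc c (θ (Series.log f)) (f ^ suc m) ⟨
  (c ◂ θ (Series.log f)) ⊛ f ^ suc m                  ∎
  where
  open 𝕊-Reasoning
  R = Series.recip f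
  c = fromℕ (suc m)
  rearrange : ∀ a b c d → a ⊛ b ⊛ (c ⊛ d) ≋ d ⊛ b ⊛ (a ⊛ c)
  rearrange = 𝕊-Solver.solve 4 (λ a b c d → a 𝕊-Solver.:* b 𝕊-Solver.:* (c 𝕊-Solver.:* d)
    𝕊-Solver.:= d 𝕊-Solver.:* b 𝕊-Solver.:* (a 𝕊-Solver.:* c)) 𝕊.refl

-- Both sides solve θ y = (m θ (log f)) y with constant term 1.
exp-log : ∀ f → f 0 ≡ 1ℚ → ∀ m → exp (Series.log f) (fromℕ m) ≋ f ^ m
exp-log f f₀ m = θ-unique
  (trans (◂-coeff (fromℕ m) (θ (Series.log f)) 0) (trans (cong (fromℕ m ℚ.*_) (ℚₚ.*-zeroˡ (Series.log f 0))) (ℚₚ.*-zeroʳ (fromℕ m))))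
  (θ-exp (fromℕ m) (log-Ord f)) (θ-^-log f f₀ m)
  (trans (exp-coeff₀ (Series.log f) (fromℕ m)) (sym (^-coeff₀ f₀ m)))

-- Valuations of binomial coefficients

Σ<-split : ∀ m n f → Σ< (m ℕ.+ n) f ≡ Σ< m f ℚ.+ Σ< n (λ i → f (m ℕ.+ i))
Σ<-split zero    n f = sym (ℚₚ.+-identityˡ (Σ< n f))
Σ<-split (suc m) n f = trans (cong (f 0 ℚ.+_) (Σ<-split m n (f ∘ suc)))
  (sym (ℚₚ.+-assoc (f 0) (Σ< m (f ∘ suc)) (Σ< n (λ i → f (suc m ℕ.+ i)))))

Σ<-const : ∀ n {f c} → (∀ i → i < n → f i ≡ c) → Σ< n f ≡ fromℕ n ℚ.* c
Σ<-const zero    {c = c} f≡c = sym (ℚₚ.*-zeroˡ c)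
Σ<-const (suc n) {f} {c} f≡c = begin
  f 0 ℚ.+ Σ< n (f ∘ suc)       ≡⟨ cong₂ ℚ._+_ (f≡c 0 (s≤s z≤n)) (Σ<-const n (λ i i<n → f≡c (suc i) (s≤s i<n))) ⟩
  c ℚ.+ fromℕ n ℚ.* c          ≡⟨ lemma c (fromℕ n) ⟩
  (1ℚ ℚ.+ fromℕ n) ℚ.* c       ≡⟨ cong (ℚ._* c) (fromℕ-homo-+ 1 n) ⟨
  fromℕ (suc n) ℚ.* c          ∎
  where
  open ≡-Reasoning
  lemma : ∀ c m → c ℚ.+ m ℚ.* c ≡ (1ℚ ℚ.+ m) ℚ.* c
  lemma = solve-∀ ℚ-ring

χ : ∀ {A : Set} → Dec A → ℚ
χ (yes _) = 1ℚ
χ (no _)  = 0ℚ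

χ-⇔ : ∀ {A B : Set} (a? : Dec A) (b? : Dec B) → (A → B) → (B → A) → χ a? ≡ χ b?
χ-⇔ (yes a) (yes b) f g = refl
χ-⇔ (yes a) (no ¬b) f g = ⊥-elim (¬b (f a))
χ-⇔ (no ¬a) (yes b) f g = ⊥-elim (¬a (g b))
χ-⇔ (no ¬a) (no ¬b) f g = refl

χ-no : ∀ {A : Set} (a? : Dec A) → ¬ A → χ a? ≡ 0ℚ
χ-no (yes a) ¬a = ⊥-elim (¬a a)
χ-no (no _)  ¬a = refl

fromℕ-length-filter : ∀ {A : Set} {P : A → Set} (P? : Decidable P) (f : ℕ → A) n →
  fromℕ (length (filter P? (applyUpTo f n))) ≡ Σ< n (λ i → χ (P? (f i)))
fromℕ-length-filter P? f zero = refl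
fromℕ-length-filter P? f (suc n) with P? (f 0)
... | yes _ = trans (fromℕ-homo-+ 1 (length (filter P? (applyUpTo (f ∘ suc) n))))
  (cong (1ℚ ℚ.+_) (fromℕ-length-filter P? (f ∘ suc) n))
... | no _ = trans (fromℕ-length-filter P? (f ∘ suc) n) (sym (ℚₚ.+-identityˡ (Σ< n (λ i → χ (P? (f (suc i)))))))

nCk*k!k′! : ∀ {n} k k′ → k ℕ.+ k′ ≡ n → (n C k) ℕ.* (k ! ℕ.* k′ !) ≡ n !
nCk*k!k′! {n} k k′ refl = begin
  (n C k) ℕ.* (k ! ℕ.* k′ !)                              ≡⟨ cong (λ m → (n C k) ℕ.* (k ! ℕ.* m !)) (ℕₚ.m+n∸m≡n k k′) ⟨
  (n C k) ℕ.* (k ! ℕ.* (n ∸ k) !)                         ≡⟨ cong (ℕ._* (k ! ℕ.* (n ∸ k) !)) (nCk≡n!/k![n-k]! (ℕₚ.m≤m+n k k′)) ⟩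
  (n ! ℕ/./ (k ! ℕ.* (n ∸ k) !)) ℕ.* (k ! ℕ.* (n ∸ k) !) ≡⟨ ℕ/.m/n*n≡m (k![n∸k]!∣n! (ℕₚ.m≤m+n k k′)) ⟩
  n !                                                   ∎
  where
  open ≡-Reasoning
  instance _ = k ℕₚ.!* (n ∸ k) !≢0

-- The numbers n C(n-1,k) behind the companion series get the same factorial form as the binomial
-- coefficients, so that one argument on factorials serves both.
n*[n-1]Ck*k!k′! : ∀ {n} k k′ → k ℕ.+ suc k′ ≡ n → n ℕ.* ((n ∸ 1) C k) ℕ.* (k ! ℕ.* k′ !) ≡ n !
n*[n-1]Ck*k!k′! {n} k k′ refl rewrite ℕₚ.+-suc k k′ =
  trans (ℕₚ.*-assoc (suc (k ℕ.+ k′)) ((k ℕ.+ k′) C k) (k ! ℕ.* k′ !))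
    (cong (suc (k ℕ.+ k′) ℕ.*_) (nCk*k!k′! k k′ refl))

module Carries {p : ℕ} (p-prime : Prime p) where

  private instance
    p≢0 : NonZero p
    p≢0 = prime⇒nonZero p-prime

  -- m and n have the same p-adic valuation.
  infix 4 _∼_
  record _∼_ (m n : ℕ) : Set where
    constructor mk∼
    field
      u u′   : ℕ
      p∤u    : p ∤ u
      p∤u′   : p ∤ u′
      equate : u ℕ.* m ≡ u′ ℕ.* n

  p∤* : ∀ {m n} → p ∤ m → p ∤ n → p ∤ m ℕ.* n
  p∤* {m} {n} p∤m p∤n p∣mn with euclidsLemma m n p-prime p∣mn
  ... | inj₁ p∣m = p∤m p∣m
  ... | inj₂ p∣n = p∤n p∣n

  p∤1 : p ∤ 1
  p∤1 p∣1 = ℕ.nonTrivial⇒≢1 {{prime⇒nonTrivial p-prime}} (∣1⇒≡1 p∣1)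

  ∼-reflexive : ∀ {m n} → m ≡ n → m ∼ n
  ∼-reflexive refl = mk∼ 1 1 p∤1 p∤1 refl

  ∼-sym : ∀ {m n} → m ∼ n → n ∼ m
  ∼-sym (mk∼ u u′ p∤u p∤u′ eq) = mk∼ u′ u p∤u′ p∤u (sym eq)

  ∼-trans : ∀ {l m n} → l ∼ m → m ∼ n → l ∼ n
  ∼-trans {l} {m} {n} (mk∼ u u′ p∤u p∤u′ eq) (mk∼ w w′ p∤w p∤w′ eq′) =
    mk∼ (w ℕ.* u) (u′ ℕ.* w′) (p∤* p∤w p∤u) (p∤* p∤u′ p∤w′) (begin
      w ℕ.* u ℕ.* l      ≡⟨ trans (ℕₚ.*-assoc w u l) (cong (w ℕ.*_) eq) ⟩
      w ℕ.* (u′ ℕ.* m)   ≡⟨ swap w u′ m ⟩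
      u′ ℕ.* (w ℕ.* m)   ≡⟨ trans (cong (u′ ℕ.*_) eq′) (sym (ℕₚ.*-assoc u′ w′ n)) ⟩
      u′ ℕ.* w′ ℕ.* n    ∎)
    where
    open ≡-Reasoning
    swap : ∀ a b c → a ℕ.* (b ℕ.* c) ≡ b ℕ.* (a ℕ.* c)
    swap = ℕ-Solver.solve-∀

  ∼-* : ∀ {k l m n} → k ∼ l → m ∼ n → (k ℕ.* m) ∼ (l ℕ.* n)
  ∼-* {k} {l} {m} {n} (mk∼ u u′ p∤u p∤u′ eq) (mk∼ w w′ p∤w p∤w′ eq′) =
    mk∼ (u ℕ.* w) (u′ ℕ.* w′) (p∤* p∤u p∤w) (p∤* p∤u′ p∤w′)
      (trans (interchange u w k m) (trans (cong₂ ℕ._*_ eq eq′) (sym (interchange u′ w′ l n))))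
    where
    interchange : ∀ a b c d → a ℕ.* b ℕ.* (c ℕ.* d) ≡ a ℕ.* c ℕ.* (b ℕ.* d)
    interchange = ℕ-Solver.solve-∀

  ∼-cancel : ∀ k {m n} .{{_ : NonZero k}} → (k ℕ.* m) ∼ (k ℕ.* n) → m ∼ n
  ∼-cancel k {m} {n} (mk∼ u u′ p∤u p∤u′ eq) = mk∼ u u′ p∤u p∤u′
    (ℕₚ.*-cancelˡ-≡ (u ℕ.* m) (u′ ℕ.* n) k (trans (swap k u m) (trans eq (sym (swap k u′ n)))))
    where
    swap : ∀ a b c → a ℕ.* (b ℕ.* c) ≡ b ℕ.* (a ℕ.* c)
    swap = ℕ-Solver.solve-∀

  p^∣-cancel : ∀ j {u m} → p ∤ u → p ℕ.^ j ∣ u ℕ.* m → p ℕ.^ j ∣ m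
  p^∣-cancel zero    p∤u _ = 1∣ _
  p^∣-cancel (suc j) {u} {m} p∤u p^∣um with euclidsLemma u m p-prime (∣-trans (m∣m*n (p ℕ.^ j)) p^∣um)
  ... | inj₁ p∣u = ⊥-elim (p∤u p∣u)
  ... | inj₂ (divides q refl) = subst (p ℕ.* p ℕ.^ j ∣_) (ℕₚ.*-comm p q)
    (*-monoʳ-∣ p (p^∣-cancel j p∤u (*-cancelˡ-∣ p (subst (p ℕ.* p ℕ.^ j ∣_) (swap u q p) p^∣um))))
    where
    swap : ∀ a b c → a ℕ.* (b ℕ.* c) ≡ c ℕ.* (a ℕ.* b)
    swap = ℕ-Solver.solve-∀

  ∼-∣ : ∀ {m n} j → m ∼ n → p ℕ.^ j ∣ m → p ℕ.^ j ∣ n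
  ∼-∣ {m} {n} j (mk∼ u u′ p∤u p∤u′ eq) p^∣m = p^∣-cancel j p∤u′ (subst (p ℕ.^ j ∣_) eq (∣n⇒∣m*n u p^∣m))

  ∼-Valuation : ∀ {m n j} → m ∼ n → Valuation p m j → Valuation p n j
  ∼-Valuation {j = j} m∼n (p^∣m , p^∤m) = ∼-∣ j m∼n p^∣m , λ p^∣n → p^∤m (∼-∣ (suc j) (∼-sym m∼n) p^∣n)

  χ-∼ : ∀ {m n} j → m ∼ n → χ (valuation? p m j) ≡ χ (valuation? p n j)
  χ-∼ {m} {n} j m∼n = χ-⇔ (valuation? p m j) (valuation? p n j) (∼-Valuation {j = j} m∼n) (∼-Valuation {j = j} (∼-sym m∼n))

  χ-p* : ∀ m j → χ (valuation? p (p ℕ.* m) (suc j)) ≡ χ (valuation? p m j)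
  χ-p* m j = χ-⇔ (valuation? p (p ℕ.* m) (suc j)) (valuation? p m j)
    (λ (d , ¬d) → *-cancelˡ-∣ p d , λ d′ → ¬d (*-monoʳ-∣ p d′))
    (λ (d , ¬d) → *-monoʳ-∣ p d , λ d′ → ¬d (*-cancelˡ-∣ p d′))

  χ-p*₀ : ∀ m → χ (valuation? p (p ℕ.* m) 0) ≡ 0ℚ
  χ-p*₀ m = χ-no (valuation? p (p ℕ.* m) 0)
    (λ (_ , ¬d) → ¬d (subst (_∣ p ℕ.* m) (sym (ℕₚ.*-identityʳ p)) (m∣m*n m)))

  -- Only the factors p, 2p, ..., np of the factorial are divisible by p, and their product is p^n
  -- n!.
  factorial-∼ : ∀ n s → s < p → (s ℕ.+ n ℕ.* p) ! ∼ (p ℕ.^ n ℕ.* n !)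
  factorial-∼ zero    zero    _     = ∼-reflexive refl
  factorial-∼ (suc n) zero    _     = ∼-trans (∼-reflexive (cong _! top))
    (∼-trans (∼-* (∼-reflexive (sym top)) (factorial-∼ n (ℕ.pred p) (ℕₚ.≤-reflexive (ℕₚ.suc-pred p))))
      (∼-reflexive (lemma p n (p ℕ.^ n) (n !))))
    where
    top : p ℕ.+ n ℕ.* p ≡ suc (ℕ.pred p ℕ.+ n ℕ.* p)
    top = cong (ℕ._+ n ℕ.* p) (sym (ℕₚ.suc-pred p))
    lemma : ∀ p n q m → (p ℕ.+ n ℕ.* p) ℕ.* (q ℕ.* m) ≡ p ℕ.* q ℕ.* (m ℕ.+ n ℕ.* m)
    lemma = ℕ-Solver.solve-∀
  factorial-∼ n       (suc s) 1+s<p = ∼-trans (mk∼ 1 (suc s ℕ.+ n ℕ.* p) p∤1 p∤1+s+np (ℕₚ.*-identityˡ _))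
    (factorial-∼ n s (ℕₚ.<-trans (ℕₚ.n<1+n s) 1+s<p))
    where
    p∤1+s+np : p ∤ suc s ℕ.+ n ℕ.* p
    p∤1+s+np d = >⇒∤ 1+s<p (∣m+n∣m⇒∣n (subst (p ∣_) (ℕₚ.+-comm (suc s) (n ℕ.* p)) d) (n∣m*n n))

  -- Whether adding two numbers carries out of the lowest digit is recorded by e ∈ {0, 1}.
  split-∼ : ∀ {n d s s′ t t′ b b′} e → d < p → s < p → s′ < p →
    b ℕ.* ((s ℕ.+ t ℕ.* p) ! ℕ.* (s′ ℕ.+ t′ ℕ.* p) !) ≡ (d ℕ.+ n ℕ.* p) ! →
    b′ ℕ.* (t ! ℕ.* t′ !) ≡ n ! → t ℕ.+ t′ ℕ.+ e ≡ n → b ∼ (p ℕ.^ e ℕ.* b′)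
  split-∼ {n} {d} {s} {s′} {t} {t′} {b} {b′} e d<p s<p s′<p eq eq′ refl =
    ∼-cancel (K ℕ.* K′) {{ℕₚ.m*n≢0 K K′}} (
    ∼-trans (∼-reflexive (ℕₚ.*-comm (K ℕ.* K′) b)) (
    ∼-trans (∼-* {b} (∼-reflexive refl) (∼-* (∼-sym (factorial-∼ t s s<p)) (∼-sym (factorial-∼ t′ s′ s′<p)))) (
    ∼-trans (∼-reflexive eq) (
    ∼-trans (factorial-∼ n d d<p) (∼-reflexive final)))))
    where
    open ≡-Reasoning
    K  = p ℕ.^ t ℕ.* t !
    K′ = p ℕ.^ t′ ℕ.* t′ !
    instance
      K≢0 : NonZero K
      K≢0 = ℕₚ.m*n≢0 (p ℕ.^ t) (t !) {{ℕₚ.m^n≢0 p t}} {{t ℕₚ.!≢0}}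
      K′≢0 : NonZero K′
      K′≢0 = ℕₚ.m*n≢0 (p ℕ.^ t′) (t′ !) {{ℕₚ.m^n≢0 p t′}} {{t′ ℕₚ.!≢0}}
    lemma : ∀ a b c d f g → a ℕ.* b ℕ.* c ℕ.* (d ℕ.* (f ℕ.* g)) ≡ a ℕ.* f ℕ.* (b ℕ.* g) ℕ.* (c ℕ.* d)
    lemma = ℕ-Solver.solve-∀
    final : p ℕ.^ n ℕ.* n ! ≡ K ℕ.* K′ ℕ.* (p ℕ.^ e ℕ.* b′)
    final = begin
      p ℕ.^ (t ℕ.+ t′ ℕ.+ e) ℕ.* n !                                        ≡⟨ cong₂ ℕ._*_ (trans (ℕₚ.^-distribˡ-+-* p (t ℕ.+ t′) e)
                                                                                (cong (ℕ._* p ℕ.^ e) (ℕₚ.^-distribˡ-+-* p t t′))) (sym eq′) ⟩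
      p ℕ.^ t ℕ.* p ℕ.^ t′ ℕ.* p ℕ.^ e ℕ.* (b′ ℕ.* (t ! ℕ.* t′ !))          ≡⟨ lemma (p ℕ.^ t) (p ℕ.^ t′) (p ℕ.^ e) b′ (t !) (t′ !) ⟩
      K ℕ.* K′ ℕ.* (p ℕ.^ e ℕ.* b′)                                         ∎

  -- The index is written as last digit plus t p. The summation range consists of n full periods of
  -- length p and an incomplete one with e entries, so t reaches n for the first e digits and stops
  -- at n-1 for the other q.
  digit-sum : ∀ n {e q} {f g h : ℕ → ℚ} → e ℕ.+ q ≡ p →
    (∀ t s → t < suc n → s < e → f (s ℕ.+ t ℕ.* p) ≡ g t) →
    (∀ t s → t < n → s < q → f (e ℕ.+ s ℕ.+ t ℕ.* p) ≡ h t) →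
    Σ< (e ℕ.+ n ℕ.* p) f ≡ fromℕ e ℚ.* Σ< (suc n) g ℚ.+ fromℕ q ℚ.* Σ< n h
  digit-sum zero {e} {q} {f} {g} {h} e+q f≡g f≡h = begin
    Σ< (e ℕ.+ 0) f                                 ≡⟨ cong (λ m → Σ< m f) (ℕₚ.+-identityʳ e) ⟩
    Σ< e f                                         ≡⟨ Σ<-const e (λ i i<e → trans (cong f (sym (ℕₚ.+-identityʳ i))) (f≡g 0 i (s≤s z≤n) i<e)) ⟩
    fromℕ e ℚ.* g 0                                ≡⟨ lemma (fromℕ e) (g 0) (fromℕ q) ⟩
    fromℕ e ℚ.* (g 0 ℚ.+ 0ℚ) ℚ.+ fromℕ q ℚ.* 0ℚ    ∎
    where
    open ≡-Reasoning
    lemma : ∀ a b c → a ℚ.* b ≡ a ℚ.* (b ℚ.+ 0ℚ) ℚ.+ c ℚ.* 0ℚ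
    lemma = solve-∀ ℚ-ring
  digit-sum (suc n) {e} {q} {f} {g} {h} e+q f≡g f≡h = begin
    Σ< (e ℕ.+ (p ℕ.+ n ℕ.* p)) f
      ≡⟨ cong (λ m → Σ< m f) (reorder e p (n ℕ.* p)) ⟩
    Σ< (p ℕ.+ (e ℕ.+ n ℕ.* p)) f
      ≡⟨ Σ<-split p (e ℕ.+ n ℕ.* p) f ⟩
    Σ< p f ℚ.+ Σ< (e ℕ.+ n ℕ.* p) (λ i → f (p ℕ.+ i))
      ≡⟨ cong₂ ℚ._+_ first (digit-sum n {e} {q} {λ i → f (p ℕ.+ i)} {g ∘ suc} {h ∘ suc} e+q
           (λ t s t<n s<e → trans (cong f (reorder p s (t ℕ.* p))) (f≡g (suc t) s (s≤s t<n) s<e))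
           (λ t s t<n s<q → trans (cong f (reorder p (e ℕ.+ s) (t ℕ.* p))) (f≡h (suc t) s (s≤s t<n) s<q))) ⟩
    (fromℕ e ℚ.* g 0 ℚ.+ fromℕ q ℚ.* h 0) ℚ.+ (fromℕ e ℚ.* Σ< (suc n) (g ∘ suc) ℚ.+ fromℕ q ℚ.* Σ< n (h ∘ suc))
      ≡⟨ lemma (fromℕ e) (fromℕ q) (g 0) (h 0) (Σ< (suc n) (g ∘ suc)) (Σ< n (h ∘ suc)) ⟩
    fromℕ e ℚ.* (g 0 ℚ.+ Σ< (suc n) (g ∘ suc)) ℚ.+ fromℕ q ℚ.* (h 0 ℚ.+ Σ< n (h ∘ suc)) ∎
    where
    open ≡-Reasoning
    reorder : ∀ a b c → a ℕ.+ (b ℕ.+ c) ≡ b ℕ.+ (a ℕ.+ c)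
    reorder = ℕ-Solver.solve-∀
    lemma : ∀ a b c d x y → (a ℚ.* c ℚ.+ b ℚ.* d) ℚ.+ (a ℚ.* x ℚ.+ b ℚ.* y) ≡ a ℚ.* (c ℚ.+ x) ℚ.+ b ℚ.* (d ℚ.+ y)
    lemma = solve-∀ ℚ-ring
    first : Σ< p f ≡ fromℕ e ℚ.* g 0 ℚ.+ fromℕ q ℚ.* h 0
    first = trans (cong (λ m → Σ< m f) (sym e+q)) (trans (Σ<-split e q f) (cong₂ ℚ._+_
      (Σ<-const e (λ i i<e → trans (cong f (sym (ℕₚ.+-identityʳ i))) (f≡g 0 i (s≤s z≤n) i<e)))
      (Σ<-const q (λ i i<q → trans (cong f (sym (ℕₚ.+-identityʳ (e ℕ.+ i)))) (f≡h 0 i (s≤s z≤n) i<q)))))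

  -- ν_p (p n C(n-1,t)) is the number of carries in t + (n-1-t) + 1 when the incoming 1 counts as a carry.
  τ υ : ℕ → PowerSeries
  τ n j = Σ< (suc n) (λ t → χ (valuation? p (n C t) j))
  υ n j = Σ< n (λ t → χ (valuation? p (p ℕ.* (n ℕ.* ((n ∸ 1) C t))) j))

  τ-ϑ : ∀ n j → fromℕ (ϑ p j n) ≡ τ n j
  τ-ϑ n j = fromℕ-length-filter (λ t → valuation? p (n C t) j) id (suc n)

  private
    tops : ∀ s s′ t t′ → (s ℕ.+ t ℕ.* p) ℕ.+ (s′ ℕ.+ t′ ℕ.* p) ≡ (s ℕ.+ s′) ℕ.+ (t ℕ.+ t′) ℕ.* p
    tops s s′ t t′ = go s s′ t t′ p
      where
      go : ∀ s s′ t t′ p → (s ℕ.+ t ℕ.* p) ℕ.+ (s′ ℕ.+ t′ ℕ.* p) ≡ (s ℕ.+ s′) ℕ.+ (t ℕ.+ t′) ℕ.* p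
      go = ℕ-Solver.solve-∀

    carry : ∀ {d s t n} → s < p → t < n →
      (d ℕ.+ s ℕ.+ t ℕ.* p) ℕ.+ suc ((p ∸ suc s) ℕ.+ (n ∸ suc t) ℕ.* p) ≡ d ℕ.+ n ℕ.* p
    carry {d} {s} {t} {n} s<p t<n = begin
      (d ℕ.+ s ℕ.+ t ℕ.* p) ℕ.+ suc ((p ∸ suc s) ℕ.+ (n ∸ suc t) ℕ.* p) ≡⟨ go d s t (p ∸ suc s) (n ∸ suc t) p ⟩
      d ℕ.+ (suc s ℕ.+ (p ∸ suc s)) ℕ.+ (t ℕ.+ (n ∸ suc t)) ℕ.* p     ≡⟨ cong (λ z → d ℕ.+ z ℕ.+ (t ℕ.+ (n ∸ suc t)) ℕ.* p) (ℕₚ.m+[n∸m]≡n s<p) ⟩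
      d ℕ.+ p ℕ.+ (t ℕ.+ (n ∸ suc t)) ℕ.* p                           ≡⟨ ℕₚ.+-assoc d p _ ⟩
      d ℕ.+ (suc t ℕ.+ (n ∸ suc t)) ℕ.* p                             ≡⟨ cong (λ z → d ℕ.+ z ℕ.* p) (ℕₚ.m+[n∸m]≡n t<n) ⟩
      d ℕ.+ n ℕ.* p                                                   ∎
      where
      open ≡-Reasoning
      go : ∀ d s t x y p → (d ℕ.+ s ℕ.+ t ℕ.* p) ℕ.+ suc (x ℕ.+ y ℕ.* p) ≡ d ℕ.+ (suc s ℕ.+ x) ℕ.+ (t ℕ.+ y) ℕ.* p
      go = ℕ-Solver.solve-∀

    e=1 : ∀ {t n} → t < n → t ℕ.+ (n ∸ suc t) ℕ.+ 1 ≡ n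
    e=1 {t} {n} t<n = trans (ℕₚ.+-comm (t ℕ.+ (n ∸ suc t)) 1) (ℕₚ.m+[n∸m]≡n t<n)

    e=1′ : ∀ {t n} → t < n → t ℕ.+ suc (n ∸ suc t) ≡ n
    e=1′ {t} {n} t<n = trans (ℕₚ.+-suc t (n ∸ suc t)) (ℕₚ.m+[n∸m]≡n t<n)

    e=0 : ∀ {t n} → t < suc n → t ℕ.+ (n ∸ t) ℕ.+ 0 ≡ n
    e=0 {t} {n} (s≤s t≤n) = trans (ℕₚ.+-identityʳ _) (ℕₚ.m+[n∸m]≡n t≤n)

    p∸< : ∀ {s} → s < p → p ∸ suc s < p
    p∸< {s} s<p = ℕₚ.∸-monoʳ-< {p} {suc s} {0} (s≤s z≤n) s<p

  -- Let s be the last digit of the lower index. The d+1 digits s ≤ d produce no carry, and the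
  -- quotients add up to n. The remaining digits produce one, the quotients add up to n-1, and the
  -- carry into the next position is what `υ` accounts for.
  τ-recurrence : ∀ d n j → d < p →
    τ (d ℕ.+ n ℕ.* p) j ≡ fromℕ (suc d) ℚ.* τ n j ℚ.+ fromℕ (p ∸ suc d) ℚ.* υ n j
  τ-recurrence d n j d<p = digit-sum n {suc d} {p ∸ suc d} {f} {λ t → χ (valuation? p (n C t) j)}
    {λ t → χ (valuation? p (p ℕ.* (n ℕ.* ((n ∸ 1) C t))) j)} (ℕₚ.m+[n∸m]≡n d<p)
    (λ { t s t≤n@(s≤s t≤n′) (s≤s s≤d) → χ-∼ j (∼-trans
      (split-∼ {n} {d} {s} {d ∸ s} {t} {n ∸ t} 0 d<p (ℕₚ.≤-<-trans s≤d d<p) (ℕₚ.≤-<-trans (ℕₚ.m∸n≤m d s) d<p)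
        (nCk*k!k′! (s ℕ.+ t ℕ.* p) (d ∸ s ℕ.+ (n ∸ t) ℕ.* p)
          (trans (tops s (d ∸ s) t (n ∸ t)) (cong₂ (λ x y → x ℕ.+ y ℕ.* p) (ℕₚ.m+[n∸m]≡n s≤d) (ℕₚ.m+[n∸m]≡n t≤n′))))
        (nCk*k!k′! {n} t (n ∸ t) (ℕₚ.m+[n∸m]≡n t≤n′))
        (e=0 t≤n))
      (∼-reflexive (ℕₚ.*-identityˡ (n C t)))) })
    (λ t s t<n s<q → χ-∼ j (∼-trans
      (split-∼ {n} {d} {suc d ℕ.+ s} {p ∸ suc s} {t} {n ∸ suc t} 1 d<p
        (ℕₚ.<-≤-trans (ℕₚ.+-monoʳ-< (suc d) s<q) (ℕₚ.≤-reflexive (ℕₚ.m+[n∸m]≡n d<p))) (p∸< (ℕₚ.<-≤-trans s<q (ℕₚ.m∸n≤m p (suc d))))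
        (nCk*k!k′! (suc d ℕ.+ s ℕ.+ t ℕ.* p) (p ∸ suc s ℕ.+ (n ∸ suc t) ℕ.* p)
          (trans (sym (ℕₚ.+-suc (d ℕ.+ s ℕ.+ t ℕ.* p) _)) (carry {d} (ℕₚ.<-≤-trans s<q (ℕₚ.m∸n≤m p (suc d))) t<n)))
        (n*[n-1]Ck*k!k′! {n} t (n ∸ suc t) (e=1′ t<n))
        (e=1 t<n))
      (∼-reflexive (cong (ℕ._* (n ℕ.* ((n ∸ 1) C t))) (ℕₚ.*-identityʳ p)))))
    where
    f : ℕ → ℚ
    f k = χ (valuation? p ((d ℕ.+ n ℕ.* p) C k) j)

  -- Now the two summands add up to one less than the number, so only the d digits s < d avoid a
  -- carry. The explicit factor p in `υ` is the incoming carry; removing it lowers the exponent from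
  -- `suc j` to `j`.
  υ-recurrence : ∀ d n j → d < p →
    υ (d ℕ.+ n ℕ.* p) (suc j) ≡ fromℕ d ℚ.* τ n j ℚ.+ fromℕ (p ∸ d) ℚ.* υ n j
  υ-recurrence d n j d<p = digit-sum n {d} {p ∸ d} {f} {λ t → χ (valuation? p (n C t) j)}
    {λ t → χ (valuation? p (p ℕ.* (n ℕ.* ((n ∸ 1) C t))) j)} (ℕₚ.m+[n∸m]≡n (ℕₚ.<⇒≤ d<p))
    (λ { t s t≤n@(s≤s t≤n′) s<d → trans (χ-p* (N ℕ.* ((N ∸ 1) C (s ℕ.+ t ℕ.* p))) j) (χ-∼ j (∼-trans
      (split-∼ {n} {d} {s} {d ∸ suc s} {t} {n ∸ t} 0 d<p (ℕₚ.<-trans s<d d<p) (ℕₚ.≤-<-trans (ℕₚ.m∸n≤m d (suc s)) d<p)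
        (n*[n-1]Ck*k!k′! {N} (s ℕ.+ t ℕ.* p) (d ∸ suc s ℕ.+ (n ∸ t) ℕ.* p)
          (trans (ℕₚ.+-suc (s ℕ.+ t ℕ.* p) _) (trans (cong suc (tops s (d ∸ suc s) t (n ∸ t)))
            (cong₂ (λ x y → x ℕ.+ y ℕ.* p) (ℕₚ.m+[n∸m]≡n s<d) (ℕₚ.m+[n∸m]≡n t≤n′)))))
        (nCk*k!k′! {n} t (n ∸ t) (ℕₚ.m+[n∸m]≡n t≤n′))
        (e=0 t≤n))
      (∼-reflexive (ℕₚ.*-identityˡ (n C t))))) })
    (λ t s t<n s<q → trans (χ-p* (N ℕ.* ((N ∸ 1) C (d ℕ.+ s ℕ.+ t ℕ.* p))) j) (χ-∼ j (∼-trans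
      (split-∼ {n} {d} {d ℕ.+ s} {p ∸ suc s} {t} {n ∸ suc t} 1 d<p
        (ℕₚ.<-≤-trans (ℕₚ.+-monoʳ-< d s<q) (ℕₚ.≤-reflexive (ℕₚ.m+[n∸m]≡n (ℕₚ.<⇒≤ d<p)))) (p∸< (ℕₚ.<-≤-trans s<q (ℕₚ.m∸n≤m p d)))
        (n*[n-1]Ck*k!k′! {N} (d ℕ.+ s ℕ.+ t ℕ.* p) (p ∸ suc s ℕ.+ (n ∸ suc t) ℕ.* p)
          (carry {d} (ℕₚ.<-≤-trans s<q (ℕₚ.m∸n≤m p d)) t<n))
        (n*[n-1]Ck*k!k′! {n} t (n ∸ suc t) (e=1′ t<n))
        (e=1 t<n))
      (∼-reflexive (cong (ℕ._* (n ℕ.* ((n ∸ 1) C t))) (ℕₚ.*-identityʳ p))))))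
    where
    N = d ℕ.+ n ℕ.* p
    f : ℕ → ℚ
    f k = χ (valuation? p (p ℕ.* (N ℕ.* ((N ∸ 1) C k))) (suc j))

  υ-coeff₀ : ∀ n → υ n 0 ≡ 0ℚ
  υ-coeff₀ n = Σ<-zero n (λ t _ → χ-p*₀ (n ℕ.* ((n ∸ 1) C t)))

-- Generating functions modulo powers of x

infix 4 _≈[_]_

_≈[_]_ : PowerSeries → ℕ → PowerSeries → Set
f ≈[ k ] g = ∀ i → i < k → f i ≡ g i

≋⇒≈[] : ∀ {f g k} → f ≋ g → f ≈[ k ] g
≋⇒≈[] f≋g i _ = f≋g i

≈[]-sym : ∀ {f g k} → f ≈[ k ] g → g ≈[ k ] f
≈[]-sym e i i<k = sym (e i i<k)

≈[]-trans : ∀ {f g h k} → f ≈[ k ] g → g ≈[ k ] h → f ≈[ k ] h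
≈[]-trans e e′ i i<k = trans (e i i<k) (e′ i i<k)

⊛-cong-≈[] : ∀ {f f′ g g′ k} → f ≈[ k ] f′ → g ≈[ k ] g′ → f ⊛ g ≈[ k ] f′ ⊛ g′
⊛-cong-≈[] {f} {f′} {g} {g′} e e′ i i<k = ⊛-cong-upto i {f} {f′} {g} {g′}
  (λ j j≤i → e j (ℕₚ.≤-<-trans j≤i i<k)) (λ j j≤i → e′ j (ℕₚ.≤-<-trans j≤i i<k))

⊕-cong-≈[] : ∀ {f f′ g g′ k} → f ≈[ k ] f′ → g ≈[ k ] g′ → f ⊕ g ≈[ k ] f′ ⊕ g′
⊕-cong-≈[] {f} {f′} {g} {g′} e e′ i i<k = trans (⊕-coeff f g i)
  (trans (cong₂ ℚ._+_ (e i i<k) (e′ i i<k)) (sym (⊕-coeff f′ g′ i)))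

⊛-cancelˡ-≈[] : ∀ {f g h k} → f 0 ≡ 1ℚ → f ⊛ g ≈[ k ] f ⊛ h → g ≈[ k ] h
⊛-cancelˡ-≈[] {f} {g} {h} {k} f₀ e = ≈[]-trans (≋⇒≈[] (𝕊.sym (cancel g)))
  (≈[]-trans (⊛-cong-≈[] {Series.recip f} {Series.recip f} (λ _ _ → refl) e) (≋⇒≈[] (cancel h)))
  where
  cancel : ∀ g → Series.recip f ⊛ (f ⊛ g) ≋ g
  cancel g = 𝕊.trans (𝕊.sym (𝕊.*-assoc (Series.recip f) f g))
    (𝕊.trans (𝕊.*-congʳ {g} (𝕊.trans (𝕊.*-comm (Series.recip f) f) (recip-inverse f f₀))) (𝕊.*-identityˡ g))

X : PowerSeries
X zero    = 0ℚ
X (suc n) = 𝟙 n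

X⊛-suc : ∀ g n → (X ⊛ g) (suc n) ≡ g n
X⊛-suc g n = begin
  (X ⊛ g) (suc n)                     ≡⟨ ⊛-suc X g n ⟩
  0ℚ ℚ.* g (suc n) ℚ.+ (𝟙 ⊛ g) n      ≡⟨ cong₂ ℚ._+_ (ℚₚ.*-zeroˡ (g (suc n))) (𝕊.*-identityˡ g n) ⟩
  0ℚ ℚ.+ g n                          ≡⟨ ℚₚ.+-identityˡ (g n) ⟩
  g n                                 ∎
  where open ≡-Reasoning

X⊛-zero : ∀ g → (X ⊛ g) 0 ≡ 0ℚ
X⊛-zero g = trans (⊛-coeff₀ X g) (ℚₚ.*-zeroˡ (g 0))

X⊛-≈[] : ∀ {f g k} → f ≈[ k ] g → X ⊛ f ≈[ suc k ] X ⊛ g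
X⊛-≈[] {f} {g} e zero    _         = trans (X⊛-zero f) (sym (X⊛-zero g))
X⊛-≈[] {f} {g} e (suc i) (s≤s i<k) = trans (X⊛-suc f i) (trans (e i i<k) (sym (X⊛-suc g i)))

module Normalised {p : ℕ} (p-prime : Prime p) where
  open Carries p-prime
  open Words p-prime using (T̄; ratio)

  private instance
    p≢0 : NonZero p
    p≢0 = prime⇒nonZero p-prime

  ϑ₀⁻¹ : ℕ → ℚ
  ϑ₀⁻¹ n = (+ 1 ℚ./ ϑ p 0 n) {{ ϑ₀-nonZero p-prime n }}

  ϑ₀⁻¹-inverse : ∀ n → τ n 0 ℚ.* ϑ₀⁻¹ n ≡ 1ℚ
  ϑ₀⁻¹-inverse n = trans (cong (ℚ._* ϑ₀⁻¹ n) (sym (τ-ϑ n 0))) (*-inverse (ϑ p 0 n) {{ ϑ₀-nonZero p-prime n }})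

  T̄-τ : ∀ n → T̄ n ≋ ϑ₀⁻¹ n ◂ τ n
  T̄-τ n j = begin
    ratio j n                        ≡⟨ /≡*1/ (ϑ p j n) (ϑ p 0 n) {{ ϑ₀-nonZero p-prime n }} ⟩
    fromℕ (ϑ p j n) ℚ.* ϑ₀⁻¹ n       ≡⟨ cong (ℚ._* ϑ₀⁻¹ n) (τ-ϑ n j) ⟩
    τ n j ℚ.* ϑ₀⁻¹ n                 ≡⟨ ℚₚ.*-comm (τ n j) (ϑ₀⁻¹ n) ⟩
    ϑ₀⁻¹ n ℚ.* τ n j                 ≡⟨ ◂-coeff (ϑ₀⁻¹ n) (τ n) j ⟨
    (ϑ₀⁻¹ n ◂ τ n) j                 ∎
    where open ≡-Reasoning

  T̄-coeff₀ : ∀ n → T̄ n 0 ≡ 1ℚ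
  T̄-coeff₀ n = trans (T̄-τ n 0) (trans (◂-coeff (ϑ₀⁻¹ n) (τ n) 0) (trans (ℚₚ.*-comm (ϑ₀⁻¹ n) (τ n 0)) (ϑ₀⁻¹-inverse n)))

  -- At x^0 the companion term disappears, so a digit d multiplies ϑ_p(0,n) by d+1. This is Fine's
  -- product formula, one digit at a time, and the source of the denominators d+1 in the transfer
  -- matrix.
  ϑ₀⁻¹-digit : ∀ d n → d < p → ϑ₀⁻¹ (d ℕ.+ n ℕ.* p) ≡ (+ 1 ℚ./ suc d) ℚ.* ϑ₀⁻¹ n
  ϑ₀⁻¹-digit d n d<p = begin
    c′                                             ≡⟨ arith c′ e (fromℕ (suc d)) (τ n 0) c (*-inverse (suc d)) (ϑ₀⁻¹-inverse n) ⟩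
    (fromℕ (suc d) ℚ.* τ n 0 ℚ.* c′) ℚ.* (e ℚ.* c) ≡⟨ cong (λ z → z ℚ.* c′ ℚ.* (e ℚ.* c)) τ₀ ⟨
    (τ N 0 ℚ.* c′) ℚ.* (e ℚ.* c)                   ≡⟨ cong (ℚ._* (e ℚ.* c)) (ϑ₀⁻¹-inverse N) ⟩
    1ℚ ℚ.* (e ℚ.* c)                               ≡⟨ ℚₚ.*-identityˡ (e ℚ.* c) ⟩
    e ℚ.* c                                        ∎
    where
    open ≡-Reasoning
    N  = d ℕ.+ n ℕ.* p
    c  = ϑ₀⁻¹ n
    c′ = ϑ₀⁻¹ N
    e  = + 1 ℚ./ suc d
    τ₀ : τ N 0 ≡ fromℕ (suc d) ℚ.* τ n 0
    τ₀ = trans (τ-recurrence d n 0 d<p) (trans (cong (λ z → fromℕ (suc d) ℚ.* τ n 0 ℚ.+ fromℕ (p ∸ suc d) ℚ.* z) (υ-coeff₀ n))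
      (go (fromℕ (suc d) ℚ.* τ n 0) (fromℕ (p ∸ suc d))))
      where
      go : ∀ a b → a ℚ.+ b ℚ.* 0ℚ ≡ a
      go = solve-∀ ℚ-ring
    arith : ∀ c′ e m t c → m ℚ.* e ≡ 1ℚ → t ℚ.* c ≡ 1ℚ → c′ ≡ (m ℚ.* t ℚ.* c′) ℚ.* (e ℚ.* c)
    arith c′ e m t c me tc = sym (trans (go c′ e m t c) (trans (cong₂ (λ y z → y ℚ.* z ℚ.* c′) me tc) (ℚₚ.*-identityˡ c′)))
      where
      go : ∀ c′ e m t c → (m ℚ.* t ℚ.* c′) ℚ.* (e ℚ.* c) ≡ m ℚ.* e ℚ.* (t ℚ.* c) ℚ.* c′
      go = solve-∀ ℚ-ring

  -- Scaled by the normalisation of `T̄`, so that the pair satisfies one linear recurrence.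
  Ῡ : ℕ → PowerSeries
  Ῡ n = ϑ₀⁻¹ n ◂ υ n

  -- Rational factors become series so that the semiring solver can treat matrix entries as ring
  -- elements.
  scalar : ℚ → PowerSeries
  scalar c = c ◂ 𝟙

  ◂-scalar : ∀ c f → c ◂ f ≋ scalar c ⊛ f
  ◂-scalar c f = 𝕊.trans (◂-cong {c} refl (𝕊.sym (𝕊.*-identityˡ f))) (𝕊.sym (◂-⊛-assoc c 𝟙 f))

  -- Reading the digit d multiplies (T̄ , Ῡ) by the matrix (1  A ; x B  x Γ).
  A B Γ : ℕ → PowerSeries
  A d = scalar (fromℕ (p ∸ suc d) ℚ.* (+ 1 ℚ./ suc d))
  B d = scalar (fromℕ d ℚ.* (+ 1 ℚ./ suc d))
  Γ d = scalar (fromℕ (p ∸ d) ℚ.* (+ 1 ℚ./ suc d))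

  T̄-digit : ∀ d n → d < p → T̄ (d ℕ.+ n ℕ.* p) ≋ T̄ n ⊕ A d ⊛ Ῡ n
  T̄-digit d n d<p j = begin
    T̄ N j                                                                  ≡⟨ trans (T̄-τ N j) (◂-coeff (ϑ₀⁻¹ N) (τ N) j) ⟩
    ϑ₀⁻¹ N ℚ.* τ N j                                                       ≡⟨ cong₂ ℚ._*_ (ϑ₀⁻¹-digit d n d<p) (τ-recurrence d n j d<p) ⟩
    e ℚ.* c ℚ.* (fromℕ (suc d) ℚ.* τ n j ℚ.+ fromℕ (p ∸ suc d) ℚ.* υ n j)  ≡⟨ arith e c (fromℕ (suc d)) (τ n j) (fromℕ (p ∸ suc d)) (υ n j) (*-inverse (suc d)) ⟩
    c ℚ.* τ n j ℚ.+ fromℕ (p ∸ suc d) ℚ.* e ℚ.* (c ℚ.* υ n j)              ≡⟨ cong₂ ℚ._+_ (trans (T̄-τ n j) (◂-coeff c (τ n) j))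
                                                                                (trans (sym (◂-scalar (fromℕ (p ∸ suc d) ℚ.* e) (Ῡ n) j)) (trans (◂-coeff (fromℕ (p ∸ suc d) ℚ.* e) (Ῡ n) j)
                                                                                  (cong (fromℕ (p ∸ suc d) ℚ.* e ℚ.*_) (◂-coeff c (υ n) j)))) ⟨
    T̄ n j ℚ.+ (A d ⊛ Ῡ n) j                                                ≡⟨ ⊕-coeff (T̄ n) (A d ⊛ Ῡ n) j ⟨
    (T̄ n ⊕ A d ⊛ Ῡ n) j                                                    ∎
    where
    open ≡-Reasoning
    N = d ℕ.+ n ℕ.* p
    c = ϑ₀⁻¹ n
    e = + 1 ℚ./ suc d
    arith : ∀ e c m t q u → m ℚ.* e ≡ 1ℚ → e ℚ.* c ℚ.* (m ℚ.* t ℚ.+ q ℚ.* u) ≡ c ℚ.* t ℚ.+ q ℚ.* e ℚ.* (c ℚ.* u)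
    arith e c m t q u me = trans (go e c m t q u) (cong (ℚ._+ q ℚ.* e ℚ.* (c ℚ.* u)) (trans (cong (ℚ._* (c ℚ.* t)) me) (ℚₚ.*-identityˡ (c ℚ.* t))))
      where
      go : ∀ e c m t q u → e ℚ.* c ℚ.* (m ℚ.* t ℚ.+ q ℚ.* u) ≡ m ℚ.* e ℚ.* (c ℚ.* t) ℚ.+ q ℚ.* e ℚ.* (c ℚ.* u)
      go = solve-∀ ℚ-ring

  Ῡ-digit : ∀ d n → d < p → Ῡ (d ℕ.+ n ℕ.* p) ≋ X ⊛ (B d ⊛ T̄ n ⊕ Γ d ⊛ Ῡ n)
  Ῡ-digit d n d<p zero = trans (◂-coeff (ϑ₀⁻¹ N) (υ N) 0) (trans (cong (ϑ₀⁻¹ N ℚ.*_) (υ-coeff₀ N))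
    (trans (ℚₚ.*-zeroʳ (ϑ₀⁻¹ N)) (sym (X⊛-zero (B d ⊛ T̄ n ⊕ Γ d ⊛ Ῡ n)))))
    where N = d ℕ.+ n ℕ.* p
  Ῡ-digit d n d<p (suc j) = begin
    Ῡ N (suc j)                                                            ≡⟨ ◂-coeff (ϑ₀⁻¹ N) (υ N) (suc j) ⟩
    ϑ₀⁻¹ N ℚ.* υ N (suc j)                                                 ≡⟨ cong₂ ℚ._*_ (ϑ₀⁻¹-digit d n d<p) (υ-recurrence d n j d<p) ⟩
    e ℚ.* c ℚ.* (fromℕ d ℚ.* τ n j ℚ.+ fromℕ (p ∸ d) ℚ.* υ n j)            ≡⟨ arith e c (fromℕ d) (τ n j) (fromℕ (p ∸ d)) (υ n j) ⟩
    fromℕ d ℚ.* e ℚ.* (c ℚ.* τ n j) ℚ.+ fromℕ (p ∸ d) ℚ.* e ℚ.* (c ℚ.* υ n j) ≡⟨ cong₂ ℚ._+_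
         (trans (sym (◂-scalar (fromℕ d ℚ.* e) (T̄ n) j)) (trans (◂-coeff (fromℕ d ℚ.* e) (T̄ n) j)
           (cong (fromℕ d ℚ.* e ℚ.*_) (trans (T̄-τ n j) (◂-coeff c (τ n) j)))))
         (trans (sym (◂-scalar (fromℕ (p ∸ d) ℚ.* e) (Ῡ n) j)) (trans (◂-coeff (fromℕ (p ∸ d) ℚ.* e) (Ῡ n) j)
           (cong (fromℕ (p ∸ d) ℚ.* e ℚ.*_) (◂-coeff c (υ n) j)))) ⟨
    (B d ⊛ T̄ n) j ℚ.+ (Γ d ⊛ Ῡ n) j                                        ≡⟨ ⊕-coeff (B d ⊛ T̄ n) (Γ d ⊛ Ῡ n) j ⟨
    (B d ⊛ T̄ n ⊕ Γ d ⊛ Ῡ n) j                                              ≡⟨ X⊛-suc (B d ⊛ T̄ n ⊕ Γ d ⊛ Ῡ n) j ⟨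
    (X ⊛ (B d ⊛ T̄ n ⊕ Γ d ⊛ Ῡ n)) (suc j)                                  ∎
    where
    open ≡-Reasoning
    N = d ℕ.+ n ℕ.* p
    c = ϑ₀⁻¹ n
    e = + 1 ℚ./ suc d
    arith : ∀ e c m t q u → e ℚ.* c ℚ.* (m ℚ.* t ℚ.+ q ℚ.* u) ≡ m ℚ.* e ℚ.* (c ℚ.* t) ℚ.+ q ℚ.* e ℚ.* (c ℚ.* u)
    arith = solve-∀ ℚ-ring

  -- The cross product T̄ m Ῡ n − T̄ n Ῡ m is multiplied by det (1  A ; x B  x Γ), hence gains a factor x.
  cross-digit : ∀ d m n k → d < p → T̄ m ⊛ Ῡ n ≈[ k ] T̄ n ⊛ Ῡ m →
    T̄ (d ℕ.+ m ℕ.* p) ⊛ Ῡ (d ℕ.+ n ℕ.* p) ≈[ suc k ] T̄ (d ℕ.+ n ℕ.* p) ⊛ Ῡ (d ℕ.+ m ℕ.* p)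
  cross-digit d m n k d<p e =
    ≈[]-trans (≋⇒≈[] (𝕊.trans (𝕊.*-cong (T̄-digit d m d<p) (Ῡ-digit d n d<p)) (expand (T̄ m) (Ῡ m) (T̄ n) (Ῡ n))))
    (≈[]-trans (X⊛-≈[] (⊕-cong-≈[] (λ _ _ → refl) (⊕-cong-≈[]
      (⊛-cong-≈[] {Γ d} {Γ d} (λ _ _ → refl) e) (⊛-cong-≈[] {A d ⊛ B d} {A d ⊛ B d} (λ _ _ → refl) (≈[]-sym e)))))
    (≋⇒≈[] (𝕊.sym (𝕊.trans (𝕊.*-cong (T̄-digit d n d<p) (Ῡ-digit d m d<p)) (expand′ (T̄ m) (Ῡ m) (T̄ n) (Ῡ n))))))
    where
    expand : ∀ t u t′ u′ → (t ⊕ A d ⊛ u) ⊛ (X ⊛ (B d ⊛ t′ ⊕ Γ d ⊛ u′)) ≋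
      X ⊛ ((B d ⊛ (t ⊛ t′) ⊕ A d ⊛ Γ d ⊛ (u ⊛ u′)) ⊕ (Γ d ⊛ (t ⊛ u′) ⊕ (A d ⊛ B d) ⊛ (t′ ⊛ u)))
    expand t u t′ u′ = 𝕊-solve 8 (λ t u t′ u′ a b c x → (t :+ a :* u) :* (x :* (b :* t′ :+ c :* u′)) :=
      x :* ((b :* (t :* t′) :+ a :* c :* (u :* u′)) :+ (c :* (t :* u′) :+ (a :* b) :* (t′ :* u)))) 𝕊.refl t u t′ u′ (A d) (B d) (Γ d) X
    expand′ : ∀ t u t′ u′ → (t′ ⊕ A d ⊛ u′) ⊛ (X ⊛ (B d ⊛ t ⊕ Γ d ⊛ u)) ≋
      X ⊛ ((B d ⊛ (t ⊛ t′) ⊕ A d ⊛ Γ d ⊛ (u ⊛ u′)) ⊕ (Γ d ⊛ (t′ ⊛ u) ⊕ (A d ⊛ B d) ⊛ (t ⊛ u′)))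
    expand′ t u t′ u′ = 𝕊-solve 8 (λ t u t′ u′ a b c x → (t′ :+ a :* u′) :* (x :* (b :* t :+ c :* u)) :=
      x :* ((b :* (t :* t′) :+ a :* c :* (u :* u′)) :+ (c :* (t′ :* u) :+ (a :* b) :* (t :* u′)))) 𝕊.refl t u t′ u′ (A d) (B d) (Γ d) X

  -- The two numbers differ only by the top digit `a`. Nothing is claimed modulo x^0, and each
  -- common lower digit in `u` gains one factor x.
  cross : ∀ (u : List (Fin p)) a → T̄ (fromDigits (u ++ a ∷ [])) ⊛ Ῡ (fromDigits u) ≈[ length u ] T̄ (fromDigits u) ⊛ Ῡ (fromDigits (u ++ a ∷ []))
  cross []      a = λ _ ()
  cross (d ∷ u) a = cross-digit (toℕ d) (fromDigits (u ++ a ∷ [])) (fromDigits u) (length u) (Finₚ.toℕ<n d) (cross u a)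

  -- The lowest digit enters as T̄ + A Ῡ, so the difference of the two sides is A times the cross
  -- product. With denominators cleared, this is the congruence r_v ≡ 1 for a word v with middle
  -- part `u`.
  T̄-quotient-≈[] : ∀ b (u : List (Fin p)) a →
    T̄ (fromDigits (b ∷ u ++ a ∷ [])) ⊛ T̄ (fromDigits u) ≈[ length u ] T̄ (fromDigits (u ++ a ∷ [])) ⊛ T̄ (fromDigits (b ∷ u))
  T̄-quotient-≈[] b u a =
    ≈[]-trans (≋⇒≈[] (𝕊.trans (𝕊.*-congʳ {T̄ n} (T̄-digit d m (Finₚ.toℕ<n b))) (expand (T̄ m) (Ῡ m) (T̄ n) (A d))))
    (≈[]-trans (⊕-cong-≈[] (λ _ _ → refl) (⊛-cong-≈[] {A d} {A d} (λ _ _ → refl) (≈[]-sym (cross u a))))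
    (≋⇒≈[] (𝕊.sym (𝕊.trans (𝕊.*-congˡ {T̄ m} (T̄-digit d n (Finₚ.toℕ<n b))) (expand′ (T̄ m) (T̄ n) (Ῡ n) (A d))))))
    where
    d = toℕ b
    m = fromDigits (u ++ a ∷ [])
    n = fromDigits u
    expand : ∀ t u t′ a → (t ⊕ a ⊛ u) ⊛ t′ ≋ t ⊛ t′ ⊕ a ⊛ (t′ ⊛ u)
    expand = 𝕊-solve 4 (λ t u t′ a → (t :+ a :* u) :* t′ := t :* t′ :+ a :* (t′ :* u)) 𝕊.refl
    expand′ : ∀ t t′ u′ a → t ⊛ (t′ ⊕ a ⊛ u′) ≋ t ⊛ t′ ⊕ a ⊛ (t ⊛ u′)
    expand′ = 𝕊-solve 4 (λ t t′ u′ a → t :* (t′ :+ a :* u′) := t :* t′ :+ a :* (t :* u′)) 𝕊.refl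

  -- The matrix entry `A d` has the factor p - (d+1), which is zero here.
  T̄-maximal-digit : ∀ d n → d < p → d ≡ p ∸ 1 → T̄ (d ℕ.+ n ℕ.* p) ≋ T̄ n
  T̄-maximal-digit d n d<p d≡ = 𝕊.trans (T̄-digit d n d<p) (𝕊.trans (𝕊.+-congˡ {T̄ n} (𝕊.trans (𝕊.*-congʳ {Ῡ n} A≋𝟘) (𝕊.zeroˡ (Ῡ n)))) (𝕊.+-identityʳ (T̄ n)))
    where
    A≋𝟘 : A d ≋ 𝟘
    A≋𝟘 = 𝕊.trans (◂-cong {fromℕ (p ∸ suc d) ℚ.* (+ 1 ℚ./ suc d)} {0ℚ}
      (trans (cong (λ m → fromℕ m ℚ.* (+ 1 ℚ./ suc d)) (trans (cong (λ m → p ∸ suc m) d≡) (trans (cong (p ∸_) (ℕₚ.suc-pred p)) (ℕₚ.n∸n≡0 p))))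
        (ℚₚ.*-zeroˡ (+ 1 ℚ./ suc d))) 𝕊.refl) (◂-zero 𝟙)

  T̄-zero : T̄ 0 ≋ 𝟙
  T̄-zero zero    = trans (T̄-coeff₀ 0) (sym 𝟙-coeff₀)
  T̄-zero (suc j) = begin
    T̄ 0 (suc j)                      ≡⟨ trans (T̄-τ 0 (suc j)) (◂-coeff (ϑ₀⁻¹ 0) (τ 0) (suc j)) ⟩
    ϑ₀⁻¹ 0 ℚ.* τ 0 (suc j)           ≡⟨ cong (ϑ₀⁻¹ 0 ℚ.*_) (trans (ℚₚ.+-identityʳ (χ (valuation? p 1 (suc j)))) (χ-no (valuation? p 1 (suc j))
                                          (λ (d , _) → p∤1 (∣-trans (m∣m*n (p ℕ.^ j)) d)))) ⟩
    ϑ₀⁻¹ 0 ℚ.* 0ℚ                    ≡⟨ ℚₚ.*-zeroʳ (ϑ₀⁻¹ 0) ⟩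
    0ℚ                               ≡⟨ one j ⟨
    𝟙 (suc j)                        ∎
    where
    open ≡-Reasoning
    one : ∀ j → 𝟙 (suc j) ≡ 0ℚ
    one j = cong-app 𝟙-def (suc j)

  T̄-single-digit : ∀ d → d < p → T̄ (d ℕ.+ 0 ℕ.* p) ≋ 𝟙
  T̄-single-digit d d<p = 𝕊.trans (T̄-digit d 0 d<p) (𝕊.trans (𝕊.+-congˡ {T̄ 0} (𝕊.trans (𝕊.*-congˡ {A d} Ῡ-zero) (𝕊.zeroʳ (A d))))
    (𝕊.trans (𝕊.+-identityʳ (T̄ 0)) T̄-zero))
    where
    Ῡ-zero : Ῡ 0 ≋ 𝟘
    Ῡ-zero j = trans (◂-coeff (ϑ₀⁻¹ 0) (υ 0) j) (trans (ℚₚ.*-zeroʳ (ϑ₀⁻¹ 0)) (sym (𝟘-coeff j)))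

-- Finite products of power series

∏ : {A : Set} → List A → (A → PowerSeries) → PowerSeries
∏ []      F = 𝟙
∏ (x ∷ S) F = F x ⊛ ∏ S F

∏-cong : ∀ {A : Set} (S : List A) {F G} → (∀ x → x ∈ S → F x ≋ G x) → ∏ S F ≋ ∏ S G
∏-cong []      e = 𝕊.refl
∏-cong (x ∷ S) e = 𝕊.*-cong (e x (here refl)) (∏-cong S (λ y y∈S → e y (there y∈S)))

∏-⊛ : ∀ {A : Set} (S : List A) F G → ∏ S (λ x → F x ⊛ G x) ≋ ∏ S F ⊛ ∏ S G
∏-⊛ []      F G = 𝕊.sym (𝕊.*-identityˡ 𝟙)
∏-⊛ (x ∷ S) F G = 𝕊.trans (𝕊.*-congˡ {F x ⊛ G x} (∏-⊛ S F G)) (interchange (F x) (G x) (∏ S F) (∏ S G))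
  where
  interchange : ∀ a b c d → a ⊛ b ⊛ (c ⊛ d) ≋ a ⊛ c ⊛ (b ⊛ d)
  interchange = 𝕊-solve 4 (λ a b c d → a :* b :* (c :* d) := a :* c :* (b :* d)) 𝕊.refl

∏-𝟙 : ∀ {A : Set} (S : List A) {F} → (∀ x → x ∈ S → F x ≋ 𝟙) → ∏ S F ≋ 𝟙
∏-𝟙 []      e = 𝕊.refl
∏-𝟙 (x ∷ S) e = 𝕊.trans (𝕊.*-cong (e x (here refl)) (∏-𝟙 S (λ y y∈S → e y (there y∈S)))) (𝕊.*-identityˡ 𝟙)

-- Used both to single out the factor of one word and to split one variable off a monomial.
∏-extract : ∀ {A : Set} {S : List A} {F G x} → Unique S → x ∈ S → G x ≋ 𝟙 →
  (∀ y → y ≢ x → F y ≋ G y) → ∏ S F ≋ F x ⊛ ∏ S G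
∏-extract {S = x ∷ S} {F} {G} (x∉S ∷ _) (here refl) Gx e = 𝕊.*-congˡ {F x} (𝕊.trans
  (∏-cong S (λ y y∈S → e y (λ y≡x → All.lookup x∉S y∈S (sym y≡x))))
  (𝕊.sym (𝕊.trans (𝕊.*-congʳ {∏ S G} Gx) (𝕊.*-identityˡ (∏ S G)))))
∏-extract {S = y ∷ S} {F} {G} {x} (y∉S ∷ S!) (there x∈S) Gx e = 𝕊.trans
  (𝕊.*-cong (e y (All.lookup y∉S x∈S)) (∏-extract S! x∈S Gx e)) (swap (G y) (F x) (∏ S G))
  where
  swap : ∀ a b c → a ⊛ (b ⊛ c) ≋ b ⊛ (a ⊛ c)
  swap = 𝕊-solve 3 (λ a b c → a :* (b :* c) := b :* (a :* c)) 𝕊.refl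

∏-single : ∀ {A : Set} {S : List A} {F x} → Unique S → x ∈ S → (∀ y → y ≢ x → F y ≋ 𝟙) → ∏ S F ≋ F x
∏-single {S = S} {F} {x} S! x∈S e = 𝕊.trans (∏-extract {G = λ _ → 𝟙} S! x∈S 𝕊.refl e)
  (𝕊.trans (𝕊.*-congˡ {F x} (∏-𝟙 S (λ _ _ → 𝕊.refl))) (𝕊.*-identityʳ (F x)))

-- Words and their occurrences

find-here : ∀ {A : Set} {P : A → Set} (P? : Decidable P) {x} xs → P x → find P? (x ∷ xs) ≡ just x
find-here P? {x} xs Px rewrite dec-true (P? x) Px = refl

find-there : ∀ {A : Set} {P : A → Set} (P? : Decidable P) {x} xs → ¬ P x → find P? (x ∷ xs) ≡ find P? xs
find-there P? {x} xs ¬Px rewrite dec-false (P? x) ¬Px = refl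

inits-snoc : ∀ {A : Set} (xs : List A) x → inits (xs ++ x ∷ []) ≡ inits xs ++ (xs ++ x ∷ []) ∷ []
inits-snoc []       x = refl
inits-snoc (y ∷ xs) x = cong ([] ∷_) (trans (cong (map (y ∷_)) (inits-snoc xs x)) (Listₚ.map-++ (y ∷_) (inits xs) _))

reverse-inits-snoc : ∀ {A : Set} (xs : List A) x → reverse (inits (xs ++ x ∷ [])) ≡ (xs ++ x ∷ []) ∷ reverse (inits xs)
reverse-inits-snoc xs x = trans (cong reverse (inits-snoc xs x)) (Listₚ.reverse-++ (inits xs) _)

module Occurrences {p : ℕ} where

  -- Least significant digit first, as for fromDigits, hence in the order opposite to Word.
  Digits : Set
  Digits = List (Fin p)

  -- `pre` and `same` are indicators with values in ℕ, so that they can serve as exponents of `r`.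
  -- With the lowest digit first, an occurrence at position i is a prefix of what remains after i
  -- digits are dropped. There is no zero padding: a word longer than the list does not match.
  pre : Digits → Digits → ℕ
  pre []      _        = 1
  pre (x ∷ v) []       = 0
  pre (x ∷ v) (y ∷ ds) with x Finₚ.≟ y
  ... | yes _ = pre v ds
  ... | no  _ = 0

  same : Digits → Digits → ℕ
  same []      []       = 1
  same []      (y ∷ ds) = 0
  same (x ∷ v) []       = 0
  same (x ∷ v) (y ∷ ds) with x Finₚ.≟ y
  ... | yes _ = same v ds
  ... | no  _ = 0

  occ : Digits → Digits → ℕ
  occ v []       = 0
  occ v (d ∷ ds) = pre v (d ∷ ds) ℕ.+ occ v ds

  same-refl : ∀ v → same v v ≡ 1
  same-refl []      = refl
  same-refl (x ∷ v) with x Finₚ.≟ x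
  ... | yes _  = same-refl v
  ... | no x≢x = ⊥-elim (x≢x refl)

  same-≢ : ∀ {v w} → v ≢ w → same v w ≡ 0
  same-≢ {[]}    {[]}    v≢w = ⊥-elim (v≢w refl)
  same-≢ {[]}    {_ ∷ _} v≢w = refl
  same-≢ {_ ∷ _} {[]}    v≢w = refl
  same-≢ {x ∷ v} {y ∷ w} v≢w with x Finₚ.≟ y
  ... | yes refl = same-≢ (v≢w ∘ cong (x ∷_))
  ... | no _     = refl

  -- A further top digit can complete only one new prefix, the whole list. This is the combinatorial
  -- half of the telescoping.
  pre-snoc : ∀ v ds a → pre v (ds ++ a ∷ []) ≡ pre v ds ℕ.+ same v (ds ++ a ∷ [])
  pre-snoc []          []       a = refl
  pre-snoc []          (y ∷ ds) a = refl
  pre-snoc (x ∷ v)     []       a with x Finₚ.≟ a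
  pre-snoc (x ∷ [])    []       a | yes _ = refl
  pre-snoc (x ∷ _ ∷ _) []       a | yes _ = refl
  pre-snoc (x ∷ v)     []       a | no _  = refl
  pre-snoc (x ∷ v)     (y ∷ ds) a with x Finₚ.≟ y
  ... | yes _ = pre-snoc v ds a
  ... | no _  = refl

  pre-short : ∀ v ds → length ds < length v → pre v ds ≡ 0
  pre-short (x ∷ v) []       _ = refl
  pre-short (x ∷ v) (y ∷ ds) (s≤s l) with x Finₚ.≟ y
  ... | yes _ = pre-short v ds l
  ... | no _  = refl

-- Truncations of words and the factors r_w

module Factors {p : ℕ} (p-prime : Prime p) where
  open Occurrences {p} public
  open Words p-prime
  open Normalised p-prime

  private instance
    p≢0 : NonZero p
    p≢0 = prime⇒nonZero p-prime

  leadingNonzero? : ∀ w → Dec (LeadingNonzero w)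
  leadingNonzero? []      = no λ ()
  leadingNonzero? (d ∷ _) = ¬? (toℕ d ℕ.≟ 0)

  lastNotMax? : ∀ w → Dec (LastNotMax w)
  lastNotMax? []           = no λ ()
  lastNotMax? (d ∷ [])     = ¬? (toℕ d ℕ.≟ p ∸ 1)
  lastNotMax? (_ ∷ d ∷ ds) = lastNotMax? (d ∷ ds)

  admissible? : ∀ w → Dec (Admissible w)
  admissible? w = (2 ℕ.≤? length w) ×-dec leadingNonzero? w ×-dec lastNotMax? w

  -- The proof stored in `W` is irrelevant; decidability recovers one that can be inspected.
  admissible : ∀ (w : W) → Admissible (value w)
  admissible (w , [ a ]) = recompute (admissible? w) a

  lastNotMax⁺ : ∀ xs {b} → toℕ b ≢ p ∸ 1 → LastNotMax (xs ++ b ∷ [])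
  lastNotMax⁺ []           b≢ = b≢
  lastNotMax⁺ (x ∷ [])     b≢ = b≢
  lastNotMax⁺ (x ∷ y ∷ xs) b≢ = lastNotMax⁺ (y ∷ xs) b≢

  lastNotMax⁻ : ∀ xs {b} → LastNotMax (xs ++ b ∷ []) → toℕ b ≢ p ∸ 1
  lastNotMax⁻ []           b≢ = b≢
  lastNotMax⁻ (x ∷ [])     b≢ = b≢
  lastNotMax⁻ (x ∷ y ∷ xs) b≢ = lastNotMax⁻ (y ∷ xs) b≢

  -- The form a u b, from which r_w takes the numbers of aub, au, ub and u. Both reading orders are
  -- kept, since `Word` lists the top digit first and `fromDigits` the bottom digit.
  record Decomposition (w : W) : Set where
    constructor decomposition
    field
      {top bottom} : Fin p
      {middle}     : Digits
      reversed     : reverse (value w) ≡ bottom ∷ middle ++ top ∷ []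
      top≢0        : toℕ top ≢ 0
      bottom≢max   : toℕ bottom ≢ p ∸ 1
      original     : value w ≡ top ∷ reverse middle ++ bottom ∷ []

  reverse-factor : ∀ (a : Fin p) xs b → reverse (a ∷ xs ++ b ∷ []) ≡ b ∷ reverse xs ++ a ∷ []
  reverse-factor a xs b = trans (Listₚ.unfold-reverse a (xs ++ b ∷ [])) (cong (_++ a ∷ []) (Listₚ.reverse-++ xs (b ∷ [])))

  decompose-∷ : ∀ w a ys → value w ≡ a ∷ ys → Admissible (a ∷ ys) → Decomposition w
  decompose-∷ w a ys eq (_ , a≢0 , _) with initLast ys
  decompose-∷ w a _ eq (s≤s () , _)        | []
  decompose-∷ w a _ eq (_ , a≢0 , last)    | xs ∷ʳ′ b =
    decomposition (trans (cong reverse eq) (reverse-factor a xs b)) a≢0 (lastNotMax⁻ (a ∷ xs) last)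
      (trans eq (cong (λ ys → a ∷ ys ++ b ∷ []) (sym (Listₚ.reverse-involutive xs))))

  decompose : ∀ w → Decomposition w
  decompose w with value w in eq | admissible w
  ... | a ∷ ys | adm = decompose-∷ w a ys eq adm

  factor : ∀ a u b → toℕ a ≢ 0 → toℕ b ≢ p ∸ 1 → ∃ λ (w : W) → reverse (value w) ≡ b ∷ u ++ a ∷ []
  factor a u b a≢0 b≢max = (v , [ two v refl , a≢0 , lastNotMax⁺ (a ∷ reverse u) b≢max ]) ,
    trans (reverse-factor a (reverse u) b) (cong (λ ys → b ∷ ys ++ a ∷ []) (Listₚ.reverse-involutive u))
    where
    v = a ∷ reverse u ++ b ∷ []
    two : ∀ v → v ≡ a ∷ reverse u ++ b ∷ [] → 2 ≤ length v
    two _ refl = s≤s (ℕₚ.≤-trans (ℕₚ.m≤n+m 1 (length (reverse u))) (ℕₚ.≤-reflexive (sym (Listₚ.length-++ (reverse u)))))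

  reversed-injective : ∀ {v w : W} → reverse (value v) ≡ reverse (value w) → v ≡ w
  reversed-injective eq = value-injective (Listₚ.reverse-injective eq)

  fromDigits-zero : ∀ (u : Digits) a → toℕ a ≡ 0 → fromDigits (u ++ a ∷ []) ≡ fromDigits u
  fromDigits-zero []      a a≡0 = trans (ℕₚ.+-identityʳ (toℕ a)) a≡0
  fromDigits-zero (d ∷ u) a a≡0 = cong (λ n → toℕ d ℕ.+ n ℕ.* p) (fromDigits-zero u a a≡0)

  ⟦⟧-zero : ∀ a w → toℕ a ≡ 0 → ⟦ a ∷ w ⟧ ≡ ⟦ w ⟧
  ⟦⟧-zero a w a≡0 = trans (cong fromDigits (Listₚ.unfold-reverse a w)) (fromDigits-zero (reverse w) a a≡0)

  -- Deletes leading zeros. `left (d ∷ w)` computes to `strip w`.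
  strip : Word → Word
  strip w = fromMaybe [] (find W̃ε? (tails w))

  strip-≢0 : ∀ d w → toℕ d ≢ 0 → strip (d ∷ w) ≡ d ∷ w
  strip-≢0 d w d≢0 = cong (fromMaybe []) (find-here W̃ε? (tails w) d≢0)

  strip-≡0 : ∀ d w → toℕ d ≡ 0 → strip (d ∷ w) ≡ strip w
  strip-≡0 d w d≡0 = cong (fromMaybe []) (find-there W̃ε? (tails w) (λ d≢0 → d≢0 d≡0))

  ⟦strip⟧ : ∀ w → ⟦ strip w ⟧ ≡ ⟦ w ⟧
  ⟦strip⟧ [] = refl
  ⟦strip⟧ (d ∷ w) with toℕ d ℕ.≟ 0
  ... | no  d≢0 = cong ⟦_⟧ (strip-≢0 d w d≢0)
  ... | yes d≡0 = trans (cong ⟦_⟧ (strip-≡0 d w d≡0)) (trans (⟦strip⟧ w) (sym (⟦⟧-zero d w d≡0)))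

  longest-prefix : ∀ w → W̃ε w → fromMaybe [] (find W̃ε? (reverse (inits w))) ≡ w
  longest-prefix w w∈ with initLast w
  ... | []      = refl
  ... | xs ∷ʳ′ x = cong (fromMaybe []) (trans (cong (find W̃ε?) (reverse-inits-snoc xs x)) (find-here W̃ε? (reverse (inits xs)) w∈))

  right-snoc : ∀ w b → W̃ε w → right (w ++ b ∷ []) ≡ w
  right-snoc w b w∈ = trans (cong (λ z → fromMaybe [] (find W̃ε? (drop 1 z))) (reverse-inits-snoc w b)) (longest-prefix w w∈)

  -- Leading zeros do not affect the value, and the right truncation then drops b. If `xs` consists
  -- of zeros, at most b survives the stripping and the truncation is ε, whose value 0 is also that
  -- of `xs`.
  ⟦right-strip⟧ : ∀ xs b → ⟦ right (strip (xs ++ b ∷ [])) ⟧ ≡ ⟦ xs ⟧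
  ⟦right-strip⟧ [] b with toℕ b ℕ.≟ 0
  ... | no  b≢0 = cong (⟦_⟧ ∘ right) (strip-≢0 b [] b≢0)
  ... | yes b≡0 = cong (⟦_⟧ ∘ right) (strip-≡0 b [] b≡0)
  ⟦right-strip⟧ (d ∷ xs) b with toℕ d ℕ.≟ 0
  ... | no  d≢0 = cong ⟦_⟧ (trans (cong right (strip-≢0 d (xs ++ b ∷ []) d≢0)) (right-snoc (d ∷ xs) b d≢0))
  ... | yes d≡0 = trans (cong (⟦_⟧ ∘ right) (strip-≡0 d (xs ++ b ∷ []) d≡0)) (trans (⟦right-strip⟧ xs b) (sym (⟦⟧-zero d xs d≡0)))

  T̄⊛T̄-coeff₀ : ∀ m n → (T̄ m ⊛ T̄ n) 0 ≡ 1ℚ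
  T̄⊛T̄-coeff₀ m n = trans (⊛-coeff₀ (T̄ m) (T̄ n)) (cong₂ ℚ._*_ (T̄-coeff₀ m) (T̄-coeff₀ n))

  r-def : ∀ w → r w ≡ (T̄ ⟦ w ⟧ ⊛ T̄ ⟦ right (left w) ⟧) ⊛ Series.recip (T̄ ⟦ right w ⟧ ⊛ T̄ ⟦ left w ⟧)
  r-def w = sym (trans (⊛-def (T̄ ⟦ w ⟧ ⊛ T̄ ⟦ right (left w) ⟧) (Series.recip (T̄ ⟦ right w ⟧ ⊛ T̄ ⟦ left w ⟧)))
    (cong₂ (λ f g → f Series.* Series.recip g) (⊛-def (T̄ ⟦ w ⟧) (T̄ ⟦ right (left w) ⟧)) (⊛-def (T̄ ⟦ right w ⟧) (T̄ ⟦ left w ⟧))))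

  r-coeff₀ : ∀ w → r w 0 ≡ 1ℚ
  r-coeff₀ w = begin
    r w 0                        ≡⟨ cong-app (r-def w) 0 ⟩
    (N ⊛ Series.recip D) 0       ≡⟨ ⊛-coeff₀ N (Series.recip D) ⟩
    N 0 ℚ.* Series.recip D 0     ≡⟨ cong₂ ℚ._*_ (T̄⊛T̄-coeff₀ ⟦ w ⟧ ⟦ right (left w) ⟧) recip₀ ⟩
    1ℚ ℚ.* 1ℚ                    ≡⟨⟩
    1ℚ                           ∎
    where
    open ≡-Reasoning
    N = T̄ ⟦ w ⟧ ⊛ T̄ ⟦ right (left w) ⟧
    D = T̄ ⟦ right w ⟧ ⊛ T̄ ⟦ left w ⟧
    recip₀ : Series.recip D 0 ≡ 1ℚ
    -- At x^0 the reciprocal is the single summand m = 0, a zeroth power.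
    recip₀ = refl

  -- The definition of r_w with denominators cleared. The truncations differ from au, ub and u at
  -- most by leading zeros, which do not change their values.
  r-relation : ∀ w (d : Decomposition w) → let open Decomposition d in
    r (value w) ⊛ (T̄ (fromDigits (middle ++ top ∷ [])) ⊛ T̄ (fromDigits (bottom ∷ middle)))
      ≋ T̄ (fromDigits (bottom ∷ middle ++ top ∷ [])) ⊛ T̄ (fromDigits middle)
  r-relation w (decomposition {a} {b} {u} reversed a≢0 b≢max refl) = begin
    r v ⊛ (T̄ (fromDigits (u ++ a ∷ [])) ⊛ T̄ (fromDigits (b ∷ u)))
      ≡⟨ cong₂ _⊛_ (sym (r-def v)) (cong₂ (λ m n → T̄ m ⊛ T̄ n) ⟦right⟧ ⟦left⟧) ⟨
    N ⊛ Series.recip D ⊛ D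
      ≈⟨ 𝕊.*-assoc N (Series.recip D) D ⟩
    N ⊛ (Series.recip D ⊛ D)
      ≈⟨ 𝕊.*-congˡ {N} (𝕊.trans (𝕊.*-comm (Series.recip D) D) (recip-inverse D (T̄⊛T̄-coeff₀ ⟦ right v ⟧ ⟦ left v ⟧))) ⟩
    N ⊛ 𝟙
      ≈⟨ 𝕊.*-identityʳ N ⟩
    N
      ≡⟨ cong₂ (λ m n → T̄ m ⊛ T̄ n) (cong fromDigits reversed) (trans (⟦right-strip⟧ (reverse u) b) (cong fromDigits (Listₚ.reverse-involutive u))) ⟩
    T̄ (fromDigits (b ∷ u ++ a ∷ [])) ⊛ T̄ (fromDigits u) ∎
    where
    open 𝕊-Reasoning
    v = a ∷ reverse u ++ b ∷ []
    N = T̄ ⟦ v ⟧ ⊛ T̄ ⟦ right (left v) ⟧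
    D = T̄ ⟦ right v ⟧ ⊛ T̄ ⟦ left v ⟧
    ⟦right⟧ : ⟦ right v ⟧ ≡ fromDigits (u ++ a ∷ [])
    ⟦right⟧ = cong fromDigits (trans (cong reverse (right-snoc (a ∷ reverse u) b a≢0))
      (trans (Listₚ.unfold-reverse a (reverse u)) (cong (_++ a ∷ []) (Listₚ.reverse-involutive u))))
    ⟦left⟧ : ⟦ left v ⟧ ≡ fromDigits (b ∷ u)
    ⟦left⟧ = trans (⟦strip⟧ (reverse u ++ b ∷ [])) (cong fromDigits
      (trans (Listₚ.reverse-++ (reverse u) (b ∷ [])) (cong (b ∷_) (Listₚ.reverse-involutive u))))

-- The product formula modulo x^k, for a finite set of words

module ProductFormula {p : ℕ} (p-prime : Prime p) (S : List (Words.W p-prime)) (S! : Unique S)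
  (k : ℕ) (complete : ∀ (w : Words.W p-prime) → length (value w) ≤ suc k → w ∈ S) where
  open Words p-prime
  open Factors p-prime
  open Normalised p-prime
  open Decomposition
  open DecMembership _≟W_ using (_∈?_)

  private instance
    p≢0 : NonZero p
    p≢0 = prime⇒nonZero p-prime

  rv : W → Digits
  rv w = reverse (value w)

  same-none : ∀ v → (∀ w → w ∈ S → rv w ≢ v) → ∏ S (λ w → r (value w) ^ same (rv w) v) ≋ 𝟙
  same-none v none = ∏-𝟙 S (λ w w∈S → ^-congʳ (r (value w)) (same-≢ (none w w∈S)))

  -- For an admissible word v = aub the quotient of `outer` by `inner` is r_v. The selector is r_v
  -- if v belongs to `S`, and 1 otherwise.
  outer inner selector : Fin p → Digits → Fin p → PowerSeries
  outer b u a = T̄ (fromDigits (b ∷ u ++ a ∷ [])) ⊛ T̄ (fromDigits u)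
  inner b u a = T̄ (fromDigits (u ++ a ∷ [])) ⊛ T̄ (fromDigits (b ∷ u))
  selector b u a = ∏ S (λ w → r (value w) ^ same (rv w) (b ∷ u ++ a ∷ []))

  single-none : ∀ b u a → (∀ w → w ∈ S → rv w ≢ b ∷ u ++ a ∷ []) →
    inner b u a ≈[ k ] outer b u a → selector b u a ⊛ inner b u a ≈[ k ] outer b u a
  single-none b u a none e = ≈[]-trans (≋⇒≈[] (𝕊.trans
    (𝕊.*-congʳ {inner b u a} {selector b u a} {𝟙} (same-none (b ∷ u ++ a ∷ []) none)) (𝕊.*-identityˡ (inner b u a)))) e

  single-zero : ∀ b u a → toℕ a ≡ 0 → selector b u a ⊛ inner b u a ≈[ k ] outer b u a
  single-zero b u a a≡0 = single-none b u a none (≋⇒≈[] (𝕊.trans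
    (𝕊.reflexive (cong₂ (λ m n → T̄ m ⊛ T̄ n) (fromDigits-zero u a a≡0) (sym (fromDigits-zero (b ∷ u) a a≡0))))
    (𝕊.*-comm (T̄ (fromDigits u)) (T̄ (fromDigits (b ∷ u ++ a ∷ []))))))
    where
    none : ∀ w → w ∈ S → rv w ≢ b ∷ u ++ a ∷ []
    none w _ eq = top≢0 (decompose w) (trans (cong toℕ (Listₚ.∷ʳ-injectiveʳ (bottom (decompose w) ∷ middle (decompose w)) (b ∷ u)
      (trans (sym (reversed (decompose w))) eq))) a≡0)

  single-maximal : ∀ b u a → toℕ b ≡ p ∸ 1 → selector b u a ⊛ inner b u a ≈[ k ] outer b u a
  single-maximal b u a b≡max = single-none b u a none (≋⇒≈[] (𝕊.*-cong
    (𝕊.sym (T̄-maximal-digit (toℕ b) (fromDigits (u ++ a ∷ [])) (Finₚ.toℕ<n b) b≡max))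
    (T̄-maximal-digit (toℕ b) (fromDigits u) (Finₚ.toℕ<n b) b≡max)))
    where
    none : ∀ w → w ∈ S → rv w ≢ b ∷ u ++ a ∷ []
    none w _ eq = bottom≢max (decompose w) (trans (cong toℕ (Listₚ.∷-injectiveˡ (trans (sym (reversed (decompose w))) eq))) b≡max)

  single-∈ : ∀ b u a w → rv w ≡ b ∷ u ++ a ∷ [] → toℕ a ≢ 0 → toℕ b ≢ p ∸ 1 → w ∈ S → selector b u a ⊛ inner b u a ≈[ k ] outer b u a
  single-∈ b u a w rvw a≢0 b≢max w∈S = ≋⇒≈[] (𝕊.trans
    (𝕊.*-congʳ {inner b u a} {selector b u a} {r (value w)} (𝕊.trans
      (∏-single S! w∈S (λ y y≢w → ^-congʳ (r (value y)) (same-≢ (λ eq → y≢w (reversed-injective (trans eq (sym rvw)))))))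
      (𝕊.trans (^-congʳ (r (value w)) (trans (cong (λ v → same v (b ∷ u ++ a ∷ [])) rvw) (same-refl (b ∷ u ++ a ∷ []))))
        (𝕊.*-identityʳ (r (value w))))))
    (r-relation w (decomposition rvw a≢0 b≢max original′)))
    where
    original′ : value w ≡ a ∷ reverse u ++ b ∷ []
    original′ = Listₚ.reverse-injective (trans rvw (sym (trans (reverse-factor a (reverse u) b) (cong (λ v → b ∷ v ++ a ∷ []) (Listₚ.reverse-involutive u)))))

  -- A word outside `S` is longer than k+1, so its middle has at least k digits and r_v is 1 modulo
  -- x^k.
  single-∉ : ∀ b u a w → rv w ≡ b ∷ u ++ a ∷ [] → w ∉ S → selector b u a ⊛ inner b u a ≈[ k ] outer b u a
  single-∉ b u a w rvw w∉S = single-none b u a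
    (λ y y∈S eq → w∉S (subst (_∈ S) (reversed-injective (trans eq (sym rvw))) y∈S))
    (≈[]-sym (λ i i<k → T̄-quotient-≈[] b u a i (ℕₚ.<-≤-trans i<k k≤length)))
    where
    length-w : length (value w) ≡ 2 ℕ.+ length u
    length-w = trans (sym (Listₚ.length-reverse (value w)))
      (trans (cong length rvw) (cong suc (trans (Listₚ.length-++ u) (ℕₚ.+-comm (length u) 1))))
    k≤length : k ≤ length u
    k≤length = ℕₚ.≮⇒≥ (λ u<k → w∉S (complete w (ℕₚ.≤-trans (ℕₚ.≤-reflexive length-w) (s≤s u<k))))

  single-factor : ∀ b u a w → rv w ≡ b ∷ u ++ a ∷ [] → toℕ a ≢ 0 → toℕ b ≢ p ∸ 1 → Dec (w ∈ S) → selector b u a ⊛ inner b u a ≈[ k ] outer b u a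
  single-factor b u a w rvw a≢0 b≢max (yes w∈S) = single-∈ b u a w rvw a≢0 b≢max w∈S
  single-factor b u a w rvw a≢0 b≢max (no w∉S)  = single-∉ b u a w rvw w∉S

  single-cases : ∀ b u a → Dec (toℕ a ≡ 0) → Dec (toℕ b ≡ p ∸ 1) → selector b u a ⊛ inner b u a ≈[ k ] outer b u a
  single-cases b u a (yes a≡0) _           = single-zero b u a a≡0
  single-cases b u a (no a≢0)  (yes b≡max) = single-maximal b u a b≡max
  single-cases b u a (no a≢0)  (no b≢max)  = single-factor b u a (proj₁ w) (proj₂ w) a≢0 b≢max (proj₁ w ∈? S)
    where w = factor a u b a≢0 b≢max

  single : ∀ b u a → selector b u a ⊛ inner b u a ≈[ k ] outer b u a
  single b u a = single-cases b u a (toℕ a ℕ.≟ 0) (toℕ b ℕ.≟ p ∸ 1)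

  -- Telescoping from the top: the digit `a` multiplies the quotient of T̄(ub) by T̄(u) by `outer`
  -- over `inner`, and creates exactly one new prefix.
  prefixes : ∀ b {u} → Reverse u →
    ∏ S (λ w → r (value w) ^ pre (rv w) (b ∷ u)) ⊛ T̄ (fromDigits u) ≈[ k ] T̄ (fromDigits (b ∷ u))
  prefixes b [] = ≋⇒≈[] (begin
    ∏ S (λ w → r (value w) ^ pre (rv w) (b ∷ [])) ⊛ T̄ 0   ≈⟨ 𝕊.*-cong (∏-𝟙 S (λ w _ → ^-congʳ (r (value w)) (pre-short (rv w) (b ∷ []) (long w)))) T̄-zero ⟩
    𝟙 ⊛ 𝟙                                                 ≈⟨ 𝕊.*-identityˡ 𝟙 ⟩
    𝟙                                                     ≈⟨ T̄-single-digit (toℕ b) (Finₚ.toℕ<n b) ⟨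
    T̄ (fromDigits (b ∷ []))                               ∎)
    where
    open 𝕊-Reasoning
    long : ∀ w → 2 ≤ length (rv w)
    long w = ℕₚ.≤-trans (proj₁ (admissible w)) (ℕₚ.≤-reflexive (sym (Listₚ.length-reverse (value w))))
  -- Multiplying the claim by T̄(ub), which is invertible, produces `inner`, so that `single`
  -- applies without a division.
  prefixes b (u ∶ us ∶ʳ a) = ⊛-cancelˡ-≈[] (T̄-coeff₀ (fromDigits (b ∷ u)))
    (≈[]-trans (≋⇒≈[] (𝕊.trans (𝕊.*-congˡ {Tb} (𝕊.*-congʳ {Ta} split)) (rearrange Tb Q (selector b u a) Ta)))
    (≈[]-trans (⊛-cong-≈[] {Q} {Q} (λ _ _ → refl) (single b u a))
    (≈[]-trans (≋⇒≈[] (rearrange′ Q Tba T))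
    (≈[]-trans (⊛-cong-≈[] {_} {_} {Tba} {Tba} (prefixes b us) (λ _ _ → refl)) (≋⇒≈[] 𝕊.refl)))))
    where
    Tb  = T̄ (fromDigits (b ∷ u))
    Ta  = T̄ (fromDigits (u ++ a ∷ []))
    Tba = T̄ (fromDigits (b ∷ u ++ a ∷ []))
    T   = T̄ (fromDigits u)
    Q   = ∏ S (λ w → r (value w) ^ pre (rv w) (b ∷ u))
    split : ∏ S (λ w → r (value w) ^ pre (rv w) (b ∷ u ++ a ∷ [])) ≋ Q ⊛ selector b u a
    split = 𝕊.trans (∏-cong S (λ w _ → 𝕊.trans (^-congʳ (r (value w)) (pre-snoc (rv w) (b ∷ u) a))
      (^-homo-* (r (value w)) (pre (rv w) (b ∷ u)) (same (rv w) (b ∷ u ++ a ∷ []))))) (∏-⊛ S _ _)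
    rearrange : ∀ t q d a → t ⊛ (q ⊛ d ⊛ a) ≋ q ⊛ (d ⊛ (a ⊛ t))
    rearrange = 𝕊-solve 4 (λ t q d a → t :* (q :* d :* a) := q :* (d :* (a :* t))) 𝕊.refl
    rearrange′ : ∀ q b t → q ⊛ (b ⊛ t) ≋ q ⊛ t ⊛ b
    rearrange′ = 𝕊-solve 3 (λ q b t → q :* (b :* t) := q :* t :* b) 𝕊.refl

  -- A new lowest digit adds exactly the occurrences at position 0, and `prefixes` evaluates their
  -- contribution.
  product-formula : ∀ ds → ∏ S (λ w → r (value w) ^ occ (rv w) ds) ≈[ k ] T̄ (fromDigits ds)
  product-formula []       = ≋⇒≈[] (𝕊.trans (∏-𝟙 S (λ _ _ → 𝕊.refl)) (𝕊.sym T̄-zero))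
  product-formula (d ∷ ds) = ≈[]-trans (≋⇒≈[] (𝕊.trans (∏-cong S (λ w _ → ^-homo-* (r (value w)) (pre (rv w) (d ∷ ds)) (occ (rv w) ds)))
      (∏-⊛ S (λ w → r (value w) ^ pre (rv w) (d ∷ ds)) (λ w → r (value w) ^ occ (rv w) ds))))
    (≈[]-trans (⊛-cong-≈[] (λ _ _ → refl) (product-formula ds)) (prefixes d (reverseView ds)))

-- Occurrences in digit lists, and blocks put on top of them

module Windows {p : ℕ} (p-prime : Prime p) where
  open Factors p-prime
  open Words p-prime

  private instance
    p≢0 : NonZero p
    p≢0 = prime⇒nonZero p-prime

  Proper : Digits → Set
  Proper []          = ⊤
  Proper (a ∷ [])    = toℕ a ≢ 0
  Proper (_ ∷ d ∷ v) = Proper (d ∷ v)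

  Proper-tail : ∀ x v → Proper (x ∷ v) → Proper v
  Proper-tail x []      _      = tt
  Proper-tail x (_ ∷ _) proper = proper

  Proper-snoc : ∀ u a → toℕ a ≢ 0 → Proper (u ++ a ∷ [])
  Proper-snoc []          a a≢0 = a≢0
  Proper-snoc (_ ∷ [])    a a≢0 = a≢0
  Proper-snoc (_ ∷ d ∷ u) a a≢0 = Proper-snoc (d ∷ u) a a≢0

  Proper-reverse : ∀ (w : W) → Proper (reverse (value w))
  Proper-reverse w = subst Proper (sym (Decomposition.reversed (decompose w)))
    (Proper-snoc (Decomposition.bottom (decompose w) ∷ Decomposition.middle (decompose w)) _ (Decomposition.top≢0 (decompose w)))

  0F maxF : Fin p
  0F   = fromℕ< {0} (ℕₚ.n≢0⇒n>0 (ℕ.≢-nonZero⁻¹ p))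
  maxF = fromℕ< {p ∸ 1} (ℕₚ.≤-reflexive (ℕₚ.suc-pred p))

  toℕ-0F : toℕ 0F ≡ 0
  toℕ-0F = Finₚ.toℕ-fromℕ< _

  toℕ-maxF : toℕ maxF ≡ p ∸ 1
  toℕ-maxF = Finₚ.toℕ-fromℕ< _

  toℕ-digit : ∀ n i → toℕ (digit n i) ≡ ((n ℕ/./ p ℕ.^ i) {{ℕₚ.m^n≢0 p i}}) ℕ/.% p
  toℕ-digit n i = Finₚ.toℕ-fromℕ< _

  digit-zero : ∀ d n → digit (toℕ d ℕ.+ n ℕ.* p) 0 ≡ d
  digit-zero d n = Finₚ.toℕ-injective (begin
    toℕ (digit (toℕ d ℕ.+ n ℕ.* p) 0)         ≡⟨ toℕ-digit (toℕ d ℕ.+ n ℕ.* p) 0 ⟩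
    ((toℕ d ℕ.+ n ℕ.* p) ℕ/./ 1) ℕ/.% p       ≡⟨ cong (ℕ/._% p) (ℕ/.n/1≡n (toℕ d ℕ.+ n ℕ.* p)) ⟩
    (toℕ d ℕ.+ n ℕ.* p) ℕ/.% p                ≡⟨ ℕ/.[m+kn]%n≡m%n (toℕ d) n p ⟩
    toℕ d ℕ/.% p                              ≡⟨ ℕ/.m<n⇒m%n≡m (Finₚ.toℕ<n d) ⟩
    toℕ d                                     ∎)
    where open ≡-Reasoning

  digit-suc : ∀ d n i → d < p → digit (d ℕ.+ n ℕ.* p) (suc i) ≡ digit n i
  digit-suc d n i d<p = Finₚ.toℕ-injective (begin
    toℕ (digit (d ℕ.+ n ℕ.* p) (suc i))       ≡⟨ toℕ-digit (d ℕ.+ n ℕ.* p) (suc i) ⟩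
    (d ℕ.+ n ℕ.* p) ℕ/./ (p ℕ.* p ℕ.^ i) ℕ/.% p ≡⟨ cong (ℕ/._% p) (ℕ/.m/n/o≡m/[n*o] (d ℕ.+ n ℕ.* p) p (p ℕ.^ i)) ⟨
    (d ℕ.+ n ℕ.* p) ℕ/./ p ℕ/./ (p ℕ.^ i) ℕ/.% p ≡⟨ cong (λ m → m ℕ/./ (p ℕ.^ i) ℕ/.% p) quotient ⟩
    n ℕ/./ (p ℕ.^ i) ℕ/.% p                   ≡⟨ toℕ-digit n i ⟨
    toℕ (digit n i)                           ∎)
    where
    open ≡-Reasoning
    instance
      p^i≢0 : NonZero (p ℕ.^ i)
      p^i≢0 = ℕₚ.m^n≢0 p i
      p^1+i≢0 : NonZero (p ℕ.* p ℕ.^ i)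
      p^1+i≢0 = ℕₚ.m^n≢0 p (suc i)
    quotient : (d ℕ.+ n ℕ.* p) ℕ/./ p ≡ n
    quotient = trans (ℕ/.+-distrib-/-∣ʳ d (Data.Nat.Divisibility.n∣m*n n)) (trans (cong₂ ℕ._+_ (ℕ/.m<n⇒m/n≡0 d<p) (ℕ/.m*n/n≡m n p)) refl)
      where import Data.Nat.Divisibility

  digit-beyond : ∀ {n i} → n < p ℕ.^ i → toℕ (digit n i) ≡ 0
  digit-beyond {n} {i} n<p^i = trans (toℕ-digit n i) (trans (cong (ℕ/._% p) (ℕ/.m<n⇒m/n≡0 n<p^i)) (ℕ/.m<n⇒m%n≡m (ℕₚ.n≢0⇒n>0 (ℕ.≢-nonZero⁻¹ p))))
    where
    instance
      p^i≢0 : NonZero (p ℕ.^ i)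
      p^i≢0 = ℕₚ.m^n≢0 p i

  window-suc : ∀ d n i μ → d < p → window (d ℕ.+ n ℕ.* p) (suc i) μ ≡ window n i μ
  window-suc d n i μ d<p = Listₚ.map-cong (λ k → digit-suc d n (i ℕ.+ k) d<p) (downFrom μ)

  window-snoc : ∀ n μ → window n 0 (suc μ) ≡ window n 1 μ ++ digit n 0 ∷ []
  window-snoc n μ = begin
    map (digit n) (downFrom (suc μ))                  ≡⟨ Listₚ.map-downFrom (digit n) (suc μ) ⟩
    applyDownFrom (digit n) (suc μ)                   ≡⟨ Listₚ.applyDownFrom-∷ʳ (digit n) μ ⟨
    applyDownFrom (digit n ∘ suc) μ ++ digit n 0 ∷ [] ≡⟨ cong (_++ digit n 0 ∷ []) (Listₚ.map-downFrom (digit n ∘ suc) μ) ⟨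
    window n 1 μ ++ digit n 0 ∷ []                    ∎
    where open ≡-Reasoning

  -- Unlike `pre`, this respects the zero padding of the expansion.
  low : ℕ → Digits → Digits
  low zero    _        = []
  low (suc μ) []       = 0F ∷ low μ []
  low (suc μ) (d ∷ ds) = d ∷ low μ ds

  window-low : ∀ μ ds → window (fromDigits ds) 0 μ ≡ reverse (low μ ds)
  window-low zero    _  = refl
  window-low (suc μ) [] = begin
    window 0 0 (suc μ)                    ≡⟨ window-snoc 0 μ ⟩
    window 0 1 μ ++ digit 0 0 ∷ []        ≡⟨ cong₂ (λ ys y → ys ++ y ∷ []) (trans (window-suc 0 0 0 μ 0<p) (window-low μ []))
                                               (Finₚ.toℕ-injective (trans (digit-beyond {0} {0} (s≤s z≤n)) (sym toℕ-0F))) ⟩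
    reverse (low μ []) ++ 0F ∷ []         ≡⟨ Listₚ.unfold-reverse 0F (low μ []) ⟨
    reverse (0F ∷ low μ [])               ∎
    where
    open ≡-Reasoning
    0<p = ℕₚ.n≢0⇒n>0 (ℕ.≢-nonZero⁻¹ p)
  window-low (suc μ) (d ∷ ds) = begin
    window n 0 (suc μ)                    ≡⟨ window-snoc n μ ⟩
    window n 1 μ ++ digit n 0 ∷ []        ≡⟨ cong₂ (λ ys y → ys ++ y ∷ []) (trans (window-suc (toℕ d) (fromDigits ds) 0 μ (Finₚ.toℕ<n d)) (window-low μ ds))
                                               (digit-zero d (fromDigits ds)) ⟩
    reverse (low μ ds) ++ d ∷ []          ≡⟨ Listₚ.unfold-reverse d (low μ ds) ⟨
    reverse (d ∷ low μ ds)                ∎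
    where
    open ≡-Reasoning
    n = toℕ d ℕ.+ fromDigits ds ℕ.* p

  low-[]-≢ : ∀ x v → Proper (x ∷ v) → low (suc (length v)) [] ≢ x ∷ v
  low-[]-≢ x []      proper eq = proper (trans (cong toℕ (sym (Listₚ.∷-injectiveˡ eq))) toℕ-0F)
  low-[]-≢ x (y ∷ v) proper eq = low-[]-≢ y v proper (Listₚ.∷-injectiveʳ eq)

  -- A match cannot reach into the padding, because the top digit of v would then be 0.
  pre-low : ∀ v ds → Proper v → low (length v) ds ≡ v → pre v ds ≡ 1
  pre-low []      ds       _      _  = refl
  pre-low (x ∷ v) []       proper eq = ⊥-elim (low-[]-≢ x v proper eq)
  pre-low (x ∷ v) (y ∷ ds) proper eq with x Finₚ.≟ y
  ... | yes _  = pre-low v ds (Proper-tail x v proper) (Listₚ.∷-injectiveʳ eq)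
  ... | no x≢y = ⊥-elim (x≢y (sym (Listₚ.∷-injectiveˡ eq)))

  pre-low-≢ : ∀ v ds → low (length v) ds ≢ v → pre v ds ≡ 0
  pre-low-≢ []      ds       neq = ⊥-elim (neq refl)
  pre-low-≢ (x ∷ v) []       neq = refl
  pre-low-≢ (x ∷ v) (y ∷ ds) neq with x Finₚ.≟ y
  ... | yes refl = pre-low-≢ v ds (neq ∘ cong (x ∷_))
  ... | no _     = refl

  match : ℕ → Word → ℕ → ℚ
  match n w i = χ (Listₚ.≡-dec Finₚ._≟_ (window n i (length w)) w)

  match-pre : ∀ (w : W) ds → match (fromDigits ds) (value w) 0 ≡ fromℕ (pre (reverse (value w)) ds)
  match-pre w ds with Listₚ.≡-dec Finₚ._≟_ (window (fromDigits ds) 0 (length (value w))) (value w)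
  ... | yes eq = cong fromℕ (sym (pre-low (reverse (value w)) ds (Proper-reverse w)
    (trans (cong (λ μ → low μ ds) (Listₚ.length-reverse (value w))) (Listₚ.reverse-injective
      (trans (sym (window-low (length (value w)) ds)) (trans eq (sym (Listₚ.reverse-involutive (value w)))))))))
  ... | no neq = cong fromℕ (sym (pre-low-≢ (reverse (value w)) ds (λ eq → neq
    (trans (window-low (length (value w)) ds) (trans (cong reverse (trans (cong (λ μ → low μ ds) (sym (Listₚ.length-reverse (value w)))) eq))
      (Listₚ.reverse-involutive (value w)))))))

  match-occ : ∀ (w : W) ds → Σ< (length ds) (match (fromDigits ds) (value w)) ≡ fromℕ (occ (reverse (value w)) ds)
  match-occ w []       = refl
  match-occ w (d ∷ ds) = trans
    (cong₂ ℚ._+_ (match-pre w (d ∷ ds)) (trans (Σ<-cong (length ds) (λ i _ → cong (λ ys → χ (Listₚ.≡-dec Finₚ._≟_ ys (value w)))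
      (window-suc (toℕ d) (fromDigits ds) i (length (value w)) (Finₚ.toℕ<n d)))) (match-occ w ds)))
    (sym (fromℕ-homo-+ (pre (reverse (value w)) (d ∷ ds)) (occ (reverse (value w)) ds)))

  -- The top digit of such a window lies beyond the expansion of n and is 0, whereas the word starts
  -- with a nonzero digit.
  match-beyond : ∀ (w : W) {n i} → n < p ℕ.^ i → match n (value w) i ≡ 0ℚ
  match-beyond w {n} {i} n<p^i = χ-no (Listₚ.≡-dec Finₚ._≟_ (window n i (length (value w))) (value w)) (mismatch (value w) (proj₁ (proj₂ (admissible w))))
    where
    mismatch : ∀ v → LeadingNonzero v → window n i (length v) ≢ v
    mismatch (a ∷ v) a≢0 eq = a≢0 (trans (cong toℕ (sym (Listₚ.∷-injectiveˡ eq)))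
      (digit-beyond {n} {i ℕ.+ length v} (ℕₚ.<-≤-trans n<p^i (ℕₚ.^-monoʳ-≤ p (ℕₚ.m≤m+n i (length v))))))

  n<p^n : ∀ n → n < p ℕ.^ n
  n<p^n zero    = s≤s z≤n
  n<p^n (suc n) = ℕₚ.≤-trans (s≤s (n<p^n n)) (ℕₚ.≤-trans (ℕₚ.≤-trans (ℕₚ.+-monoˡ-≤ (p ℕ.^ n) (ℕ.>-nonZero⁻¹ (p ℕ.^ n) {{ℕₚ.m^n≢0 p n}}))
      (ℕₚ.≤-reflexive (cong (p ℕ.^ n ℕ.+_) (sym (ℕₚ.+-identityʳ (p ℕ.^ n))))))
    (ℕₚ.*-monoˡ-≤ (p ℕ.^ n) (ℕ.nonTrivial⇒n>1 p {{prime⇒nonTrivial p-prime}})))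

  fromDigits<p^length : ∀ (ds : Digits) → fromDigits ds < p ℕ.^ length ds
  fromDigits<p^length []       = s≤s z≤n
  fromDigits<p^length (d ∷ ds) = ℕₚ.<-≤-trans (ℕₚ.+-monoˡ-< (fromDigits ds ℕ.* p) (Finₚ.toℕ<n d))
    (ℕₚ.≤-trans (ℕₚ.*-monoˡ-≤ p (fromDigits<p^length ds)) (ℕₚ.≤-reflexive (ℕₚ.*-comm (p ℕ.^ length ds) p)))

  -- The positions below n and those below the length of `ds` are both extended to a common range;
  -- nothing matches at the positions that are added.
  occurrences-occ : ∀ (w : W) ds → fromℕ (occurrences (fromDigits ds) (value w)) ≡ fromℕ (occ (reverse (value w)) ds)
  occurrences-occ w ds = begin
    fromℕ (occurrences n (value w))               ≡⟨ fromℕ-length-filter (λ i → Listₚ.≡-dec Finₚ._≟_ (window n i (length (value w))) (value w)) id n ⟩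
    Σ< n (match n (value w))                      ≡⟨ Σ<-extend (match n (value w)) (ℕₚ.m≤m+n n (length ds))
                                                       (λ i n≤i → match-beyond w {n} {i} (ℕₚ.<-≤-trans (n<p^n n) (ℕₚ.^-monoʳ-≤ p n≤i))) ⟨
    Σ< (n ℕ.+ length ds) (match n (value w))      ≡⟨ Σ<-extend (match n (value w)) (ℕₚ.m≤n+m (length ds) n)
                                                       (λ i l≤i → match-beyond w {n} {i} (ℕₚ.<-≤-trans (fromDigits<p^length ds) (ℕₚ.^-monoʳ-≤ p l≤i))) ⟩
    Σ< (length ds) (match n (value w))            ≡⟨ match-occ w ds ⟩
    fromℕ (occ (reverse (value w)) ds)            ∎
    where
    open ≡-Reasoning
    n = fromDigits ds

  zeros-mismatch : ∀ M x v z → Proper (x ∷ v) → suc (length v) ≤ M → pre (x ∷ v) (replicate M 0F ++ z) ≡ 0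
  zeros-mismatch (suc M) x v z proper (s≤s l) with x Finₚ.≟ 0F
  zeros-mismatch (suc M) x []      z proper (s≤s l) | yes refl = ⊥-elim (proper toℕ-0F)
  zeros-mismatch (suc M) x (y ∷ v) z proper (s≤s l) | yes _    = zeros-mismatch M y v z proper l
  zeros-mismatch (suc M) x v       z proper (s≤s l) | no _     = refl

  pre-zeros : ∀ M v x z → Proper v → length v ≤ M → pre v (x ++ replicate M 0F ++ z) ≡ pre v x
  pre-zeros M []      x       z proper l = refl
  pre-zeros M (c ∷ v) []      z proper l = zeros-mismatch M c v z proper l
  pre-zeros M (c ∷ v) (y ∷ x) z proper l with c Finₚ.≟ y
  ... | yes _ = pre-zeros M v x z (Proper-tail c v proper) (ℕₚ.<⇒≤ l)
  ... | no _  = refl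

  -- A match that begins in x cannot leave it: its top digit would be one of the M zeros.
  occ-zeros : ∀ M v x z → Proper v → length v ≤ M → occ v (x ++ replicate M 0F ++ z) ≡ occ v x ℕ.+ occ v (replicate M 0F ++ z)
  occ-zeros M v []      z proper l = refl
  occ-zeros M v (d ∷ x) z proper l = trans (cong₂ ℕ._+_ (pre-zeros M v (d ∷ x) z proper l) (occ-zeros M v x z proper l))
    (sym (ℕₚ.+-assoc (pre v (d ∷ x)) (occ v x) (occ v (replicate M 0F ++ z))))

  pre-++ : ∀ v x z → length v ≤ length x → pre v (x ++ z) ≡ pre v x
  pre-++ []      x       z _       = refl
  pre-++ (c ∷ v) (y ∷ x) z (s≤s l) with c Finₚ.≟ y
  ... | yes _ = pre-++ v x z l
  ... | no _  = refl

  occ-maximal : ∀ M b v z → toℕ b ≢ p ∸ 1 → occ (b ∷ v) (replicate M maxF ++ z) ≡ occ (b ∷ v) z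
  occ-maximal zero    b v z b≢max = refl
  occ-maximal (suc M) b v z b≢max with b Finₚ.≟ maxF
  ... | yes refl = ⊥-elim (b≢max toℕ-maxF)
  ... | no _     = occ-maximal M b v z b≢max

  -- No match begins at a digit p-1, and one that begins below the run is too short to get past it.
  occ-separator : ∀ M b v x z → toℕ b ≢ p ∸ 1 → suc (length v) ≤ M →
    occ (b ∷ v) (x ++ replicate M maxF ++ z) ≡ occ (b ∷ v) (x ++ replicate M maxF) ℕ.+ occ (b ∷ v) z
  occ-separator M b v [] z b≢max l = trans (occ-maximal M b v z b≢max)
    (cong (ℕ._+ occ (b ∷ v) z) (sym (trans (cong (occ (b ∷ v)) (sym (Listₚ.++-identityʳ (replicate M maxF)))) (occ-maximal M b v [] b≢max))))
  occ-separator M b v (d ∷ x) z b≢max l = trans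
    (cong₂ ℕ._+_ (trans (cong (λ y → pre (b ∷ v) (d ∷ y)) (sym (Listₚ.++-assoc x (replicate M maxF) z)))
        (pre-++ (b ∷ v) (d ∷ x ++ replicate M maxF) z (ℕₚ.≤-trans l fits)))
      (occ-separator M b v x z b≢max l))
    (sym (ℕₚ.+-assoc (pre (b ∷ v) (d ∷ x ++ replicate M maxF)) (occ (b ∷ v) (x ++ replicate M maxF)) (occ (b ∷ v) z)))
    where
    fits : M ≤ length (d ∷ x ++ replicate M maxF)
    fits = ℕₚ.m≤n⇒m≤1+n (ℕₚ.≤-trans (ℕₚ.≤-reflexive (sym (Listₚ.length-replicate M)))
      (ℕₚ.≤-trans (ℕₚ.m≤n+m (length (replicate M maxF)) (length x)) (ℕₚ.≤-reflexive (sym (Listₚ.length-++ x)))))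

  separator : ℕ → Digits
  separator M = replicate M 0F ++ replicate M maxF

  -- A word of length ≤ M that starts with a nonzero digit and does not end in p-1 cannot straddle either end of
  -- 0^M (p-1)^M u, so this block on top of x contributes a constant plus the occurrences in u.
  occ-block-∷ : ∀ M b v x u → Proper (b ∷ v) → toℕ b ≢ p ∸ 1 → suc (length v) ≤ M →
    occ (b ∷ v) (x ++ separator M ++ u) ≡ occ (b ∷ v) x ℕ.+ (occ (b ∷ v) (separator M) ℕ.+ occ (b ∷ v) u)
  occ-block-∷ M b v x u proper b≢max l = trans
    (cong (λ y → occ (b ∷ v) (x ++ y)) (Listₚ.++-assoc (replicate M 0F) (replicate M maxF) u))
    (trans (occ-zeros M (b ∷ v) x (replicate M maxF ++ u) proper l)
      (cong (occ (b ∷ v) x ℕ.+_) (occ-separator M b v (replicate M 0F) u b≢max l)))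

  occ-block : ∀ M (w : W) x u → length (value w) ≤ M → let v = reverse (value w) in
    occ v (x ++ separator M ++ u) ≡ occ v x ℕ.+ (occ v (separator M) ℕ.+ occ v u)
  occ-block M w x u l = subst (λ v → occ v (x ++ separator M ++ u) ≡ occ v x ℕ.+ (occ v (separator M) ℕ.+ occ v u)) (sym reversed)
    (occ-block-∷ M bottom (middle ++ top ∷ []) x u (subst Proper reversed (Proper-reverse w)) bottom≢max
      (ℕₚ.≤-trans (ℕₚ.≤-reflexive (trans (sym (cong length reversed)) (Listₚ.length-reverse (value w)))) l))
    where open Decomposition (decompose w)

  -- Inclusion-exclusion: an occurrence in aub lies in au or in ub unless it is the whole word, and
  -- it lies in both exactly if it lies in u.
  occ-telescope : ∀ v b u a → occ v (b ∷ u ++ a ∷ []) ℕ.+ occ v u ≡ (occ v (u ++ a ∷ []) ℕ.+ occ v (b ∷ u)) ℕ.+ same v (b ∷ u ++ a ∷ [])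
  occ-telescope v b u a = trans (cong (λ m → m ℕ.+ occ v (u ++ a ∷ []) ℕ.+ occ v u) (pre-snoc v (b ∷ u) a))
    (lemma (pre v (b ∷ u)) (same v (b ∷ u ++ a ∷ [])) (occ v (u ++ a ∷ [])) (occ v u))
    where
    lemma : ∀ a b c d → a ℕ.+ b ℕ.+ c ℕ.+ d ≡ (c ℕ.+ (a ℕ.+ d)) ℕ.+ b
    lemma = ℕ-Solver.solve-∀

-- Polynomial identities on the occurrence vectors

horner : List ℚ → ℚ → ℚ
horner []      s = 0ℚ
horner (a ∷ l) s = a ℚ.+ s ℚ.* horner l s

-- Synthetic division: the coefficients of the quotient of `a ∷ l` by s - c. The constant
-- coefficient a enters only the remainder.
quotient : ℚ → List ℚ → List ℚ
quotient c []      = []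
quotient c (b ∷ l) = horner (b ∷ l) c ∷ quotient c l

length-quotient : ∀ c l → length (quotient c l) ≡ length l
length-quotient c []      = refl
length-quotient c (_ ∷ l) = cong suc (length-quotient c l)

horner-quotient : ∀ a l c s → horner (a ∷ l) s ≡ horner (a ∷ l) c ℚ.+ (s ℚ.- c) ℚ.* horner (quotient c l) s
horner-quotient a [] c s = lemma a c s
  where
  lemma : ∀ a c s → a ℚ.+ s ℚ.* 0ℚ ≡ a ℚ.+ c ℚ.* 0ℚ ℚ.+ (s ℚ.+ (ℚ.- c)) ℚ.* 0ℚ
  lemma = solve-∀ ℚ-ring
horner-quotient a (b ∷ l) c s = trans (cong (λ z → a ℚ.+ s ℚ.* z) (horner-quotient b l c s))
  (lemma a (horner (b ∷ l) c) c s (horner (quotient c l) s))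
  where
  lemma : ∀ a h c s q → a ℚ.+ s ℚ.* (h ℚ.+ (s ℚ.+ (ℚ.- c)) ℚ.* q) ≡ a ℚ.+ c ℚ.* h ℚ.+ (s ℚ.+ (ℚ.- c)) ℚ.* (h ℚ.+ s ℚ.* q)
  lemma = solve-∀ ℚ-ring

-- The roots c, c+1, ... are divided out one by one, each division shortening the list. The bound c
-- is variable because the quotient is known to vanish only beyond the root just removed.
horner-zero : ∀ n l → length l ≡ n → ∀ c → (∀ m → c ≤ m → horner l (fromℕ m) ≡ 0ℚ) → ∀ s → horner l s ≡ 0ℚ
horner-zero n       []      _    c vanish s = refl
horner-zero (suc n) (a ∷ l) refl c vanish s = begin
  horner (a ∷ l) s                                                        ≡⟨ horner-quotient a l (fromℕ c) s ⟩
  horner (a ∷ l) (fromℕ c) ℚ.+ (s ℚ.- fromℕ c) ℚ.* horner (quotient (fromℕ c) l) s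
    ≡⟨ cong₂ (λ y z → y ℚ.+ (s ℚ.- fromℕ c) ℚ.* z) (vanish c ℕₚ.≤-refl)
         (horner-zero n (quotient (fromℕ c) l) (length-quotient (fromℕ c) l) (suc c) vanish′ s) ⟩
  0ℚ ℚ.+ (s ℚ.- fromℕ c) ℚ.* 0ℚ                                           ≡⟨ trans (ℚₚ.+-identityˡ ((s ℚ.- fromℕ c) ℚ.* 0ℚ)) (ℚₚ.*-zeroʳ (s ℚ.- fromℕ c)) ⟩
  0ℚ                                                                      ∎
  where
  open ≡-Reasoning
  vanish′ : ∀ m → suc c ≤ m → horner (quotient (fromℕ c) l) (fromℕ m) ≡ 0ℚ
  vanish′ m c<m = fromℕ-cancel (m ∸ c) {{ℕ.>-nonZero (ℕₚ.m<n⇒0<n∸m c<m)}} (begin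
    fromℕ (m ∸ c) ℚ.* q                                  ≡⟨ cong (ℚ._* q) difference ⟩
    (fromℕ m ℚ.- fromℕ c) ℚ.* q                          ≡⟨ ℚₚ.+-identityˡ ((fromℕ m ℚ.- fromℕ c) ℚ.* q) ⟨
    0ℚ ℚ.+ (fromℕ m ℚ.- fromℕ c) ℚ.* q                   ≡⟨ cong (ℚ._+ (fromℕ m ℚ.- fromℕ c) ℚ.* q) (vanish c ℕₚ.≤-refl) ⟨
    horner (a ∷ l) (fromℕ c) ℚ.+ (fromℕ m ℚ.- fromℕ c) ℚ.* q ≡⟨ horner-quotient a l (fromℕ c) (fromℕ m) ⟨
    horner (a ∷ l) (fromℕ m)                             ≡⟨ vanish m (ℕₚ.<⇒≤ c<m) ⟩
    0ℚ                                                   ≡⟨ ℚₚ.*-zeroʳ (fromℕ (m ∸ c)) ⟨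
    fromℕ (m ∸ c) ℚ.* 0ℚ                                 ∎)
    where
    q = horner (quotient (fromℕ c) l) (fromℕ m)
    difference : fromℕ (m ∸ c) ≡ fromℕ m ℚ.- fromℕ c
    difference = trans (lemma (fromℕ (m ∸ c)) (fromℕ c)) (cong (ℚ._- fromℕ c)
      (trans (sym (fromℕ-homo-+ (m ∸ c) c)) (cong fromℕ (ℕₚ.m∸n+n≡m (ℕₚ.<⇒≤ c<m)))))
      where
      lemma : ∀ a b → a ≡ a ℚ.+ b ℚ.+ (ℚ.- b)
      lemma = solve-∀ ℚ-ring

-- At s = 0 the constant coefficient vanishes. At positive integers s the factor s can then be
-- cancelled, so the rest vanishes from c = 1 on, hence everywhere.
coefficients-zero : ∀ l → (∀ s → horner l s ≡ 0ℚ) → All (_≡ 0ℚ) l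
coefficients-zero []      vanish = []
coefficients-zero (a ∷ l) vanish = a≡0 ∷ coefficients-zero l
  (horner-zero (length l) l refl 1 λ { m@(suc m-1) _ → fromℕ-cancel m (begin
    fromℕ m ℚ.* horner l (fromℕ m)          ≡⟨ ℚₚ.+-identityˡ (fromℕ m ℚ.* horner l (fromℕ m)) ⟨
    0ℚ ℚ.+ fromℕ m ℚ.* horner l (fromℕ m)   ≡⟨ cong (ℚ._+ fromℕ m ℚ.* horner l (fromℕ m)) a≡0 ⟨
    horner (a ∷ l) (fromℕ m)                ≡⟨ vanish (fromℕ m) ⟩
    0ℚ                                      ≡⟨ ℚₚ.*-zeroʳ (fromℕ m) ⟨
    fromℕ m ℚ.* 0ℚ                          ∎) })
  where
  open ≡-Reasoning
  a≡0 : a ≡ 0ℚ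
  a≡0 = trans (sym (trans (cong (a ℚ.+_) (ℚₚ.*-zeroˡ (horner l 0ℚ))) (ℚₚ.+-identityʳ a))) (vanish 0ℚ)

powerSum : ℕ → (ℕ → ℚ) → ℚ → ℚ
powerSum K a s = Σ< K (λ k → (s ^ℚ k) ℚ.* a k)

powerSum-suc : ∀ K a s → powerSum (suc K) a s ≡ a 0 ℚ.+ s ℚ.* powerSum K (a ∘ suc) s
powerSum-suc K a s = cong₂ ℚ._+_ (ℚₚ.*-identityˡ (a 0)) (trans
  (Σ<-cong K (λ k _ → ℚₚ.*-assoc s (s ^ℚ k) (a (suc k))))
  (sym (Σ<-distribˡ K s (λ k → (s ^ℚ k) ℚ.* a (suc k)))))

differences : ℕ → (a b : ℕ → ℚ) → List ℚ
differences zero    a b = []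
differences (suc K) a b = (a 0 ℚ.- b 0) ∷ differences K (a ∘ suc) (b ∘ suc)

horner-differences : ∀ K a b s → horner (differences K a b) s ≡ powerSum K a s ℚ.- powerSum K b s
horner-differences zero    a b s = refl
horner-differences (suc K) a b s = trans (cong (λ z → a 0 ℚ.- b 0 ℚ.+ s ℚ.* z) (horner-differences K (a ∘ suc) (b ∘ suc) s))
  (trans (lemma (a 0) (b 0) s (powerSum K (a ∘ suc) s) (powerSum K (b ∘ suc) s))
    (sym (cong₂ ℚ._-_ (powerSum-suc K a s) (powerSum-suc K b s))))
  where
  lemma : ∀ a b s x y → a ℚ.+ (ℚ.- b) ℚ.+ s ℚ.* (x ℚ.+ (ℚ.- y)) ≡ (a ℚ.+ s ℚ.* x) ℚ.+ (ℚ.- (b ℚ.+ s ℚ.* y))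
  lemma = solve-∀ ℚ-ring

differences-zero : ∀ K {a b} → All (_≡ 0ℚ) (differences K a b) → ∀ {k} → k < K → a k ≡ b k
differences-zero (suc K) {a} {b} (e ∷ _) {zero}  _         = lemma (a 0) (b 0) e
  where
  lemma : ∀ x y → x ℚ.- y ≡ 0ℚ → x ≡ y
  lemma x y e = trans (go x y) (trans (cong (ℚ._+ y) e) (ℚₚ.+-identityˡ y))
    where
    go : ∀ x y → x ≡ x ℚ.+ (ℚ.- y) ℚ.+ y
    go = solve-∀ ℚ-ring
differences-zero (suc K) (_ ∷ es) {suc k} (s≤s k<K) = differences-zero K es k<K

powerSum-injective : ∀ K {a b} → (∀ s → powerSum K a s ≡ powerSum K b s) → ∀ {k} → k < K → a k ≡ b k
powerSum-injective K {a} {b} e = differences-zero K (coefficients-zero (differences K a b)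
  (λ s → trans (horner-differences K a b s) (trans (cong (ℚ._- powerSum K b s) (e s)) (ℚₚ.+-inverseʳ (powerSum K b s)))))

IsPolynomial : (ℚ → ℚ) → Set
IsPolynomial g = ∃ λ l → ∀ s → g s ≡ horner l s

add : List ℚ → List ℚ → List ℚ
add []      l        = l
add (a ∷ k) []       = a ∷ k
add (a ∷ k) (b ∷ l)  = a ℚ.+ b ∷ add k l

horner-add : ∀ k l s → horner (add k l) s ≡ horner k s ℚ.+ horner l s
horner-add []      l       s = sym (ℚₚ.+-identityˡ (horner l s))
horner-add (a ∷ k) []      s = sym (ℚₚ.+-identityʳ (horner (a ∷ k) s))
horner-add (a ∷ k) (b ∷ l) s = trans (cong (λ z → a ℚ.+ b ℚ.+ s ℚ.* z) (horner-add k l s)) (lemma a b s (horner k s) (horner l s))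
  where
  lemma : ∀ a b s x y → a ℚ.+ b ℚ.+ s ℚ.* (x ℚ.+ y) ≡ a ℚ.+ s ℚ.* x ℚ.+ (b ℚ.+ s ℚ.* y)
  lemma = solve-∀ ℚ-ring

horner-scale : ∀ c l s → horner (map (c ℚ.*_) l) s ≡ c ℚ.* horner l s
horner-scale c []      s = sym (ℚₚ.*-zeroʳ c)
horner-scale c (a ∷ l) s = trans (cong (λ z → c ℚ.* a ℚ.+ s ℚ.* z) (horner-scale c l s)) (lemma c a s (horner l s))
  where
  lemma : ∀ c a s x → c ℚ.* a ℚ.+ s ℚ.* (c ℚ.* x) ≡ c ℚ.* (a ℚ.+ s ℚ.* x)
  lemma = solve-∀ ℚ-ring

mul : List ℚ → List ℚ → List ℚ
mul []      l = []
mul (a ∷ k) l = add (map (a ℚ.*_) l) (0ℚ ∷ mul k l)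

horner-mul : ∀ k l s → horner (mul k l) s ≡ horner k s ℚ.* horner l s
horner-mul []      l s = sym (ℚₚ.*-zeroˡ (horner l s))
horner-mul (a ∷ k) l s = trans (horner-add (map (a ℚ.*_) l) (0ℚ ∷ mul k l) s)
  (trans (cong₂ (λ y z → y ℚ.+ (0ℚ ℚ.+ s ℚ.* z)) (horner-scale a l s) (horner-mul k l s)) (lemma a s (horner k s) (horner l s)))
  where
  lemma : ∀ a s x y → a ℚ.* y ℚ.+ (0ℚ ℚ.+ s ℚ.* (x ℚ.* y)) ≡ (a ℚ.+ s ℚ.* x) ℚ.* y
  lemma = solve-∀ ℚ-ring

poly-const : ∀ c → IsPolynomial (λ _ → c)
poly-const c = c ∷ [] , λ s → sym (trans (cong (c ℚ.+_) (ℚₚ.*-zeroʳ s)) (ℚₚ.+-identityʳ c))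

poly-id : IsPolynomial id
poly-id = 0ℚ ∷ 1ℚ ∷ [] , lemma
  where
  lemma : ∀ s → s ≡ 0ℚ ℚ.+ s ℚ.* (1ℚ ℚ.+ s ℚ.* 0ℚ)
  lemma = solve-∀ ℚ-ring

poly-+ : ∀ {g h} → IsPolynomial g → IsPolynomial h → IsPolynomial (λ s → g s ℚ.+ h s)
poly-+ (k , e) (l , e′) = add k l , λ s → trans (cong₂ ℚ._+_ (e s) (e′ s)) (sym (horner-add k l s))

poly-* : ∀ {g h} → IsPolynomial g → IsPolynomial h → IsPolynomial (λ s → g s ℚ.* h s)
poly-* (k , e) (l , e′) = mul k l , λ s → trans (cong₂ ℚ._*_ (e s) (e′ s)) (sym (horner-mul k l s))

poly-cong : ∀ {g h} → (∀ s → g s ≡ h s) → IsPolynomial g → IsPolynomial h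
poly-cong e (l , e′) = l , λ s → trans (sym (e s)) (e′ s)

poly-^ : ∀ {g} k → IsPolynomial g → IsPolynomial (λ s → (g s) ^ℚ k)
poly-^ zero    pg = poly-const 1ℚ
poly-^ (suc k) pg = poly-* pg (poly-^ k pg)

poly-Σ< : ∀ n {F : ℕ → ℚ → ℚ} → (∀ i → IsPolynomial (F i)) → IsPolynomial (λ s → Σ< n (λ i → F i s))
poly-Σ< zero    pF = poly-const 0ℚ
poly-Σ< (suc n) pF = poly-+ (pF 0) (poly-Σ< n (λ i → pF (suc i)))

poly-⊛ : ∀ {F G : ℚ → PowerSeries} → (∀ i → IsPolynomial (λ s → F s i)) → (∀ i → IsPolynomial (λ s → G s i)) →
  ∀ n → IsPolynomial (λ s → (F s ⊛ G s) n)
poly-⊛ {F} {G} pF pG zero    = poly-cong (λ s → sym (⊛-coeff₀ (F s) (G s))) (poly-* (pF 0) (pG 0))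
poly-⊛ {F} {G} pF pG (suc n) = poly-cong (λ s → sym (⊛-suc (F s) (G s) n))
  (poly-+ (poly-* (pF 0) (pG (suc n))) (poly-⊛ {λ s → shift (F s)} {G} (λ i → pF (suc i)) pG n))

-- At x^n only the powers up to n enter the exponential series, so its coefficient is a polynomial
-- in the multiplier of G.
poly-exp : ∀ G {g} → IsPolynomial g → ∀ n → IsPolynomial (λ s → exp G (g s) n)
poly-exp G {g} pg n = poly-Σ< (suc n) (λ k → poly-cong (λ s → sym (◂-coeff ((g s) ^ℚ k) (dividedPower G k) n))
  (poly-* (poly-^ k pg) (poly-const (dividedPower G k n))))

poly-∏ : ∀ {A : Set} (S : List A) {F : ℚ → A → PowerSeries} → (∀ x i → IsPolynomial (λ s → F s x i)) →
  ∀ n → IsPolynomial (λ s → ∏ S (F s) n)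
poly-∏ []      pF n = poly-const (𝟙 n)
poly-∏ (x ∷ S) {F} pF n = poly-⊛ {λ s → F s x} {λ s → ∏ S (F s)} (pF x) (poly-∏ S pF) n

module _ {V : Set} where

  poly-evalMonomial : ∀ {ρ : ℚ → V → ℚ} → (∀ v → IsPolynomial (λ s → ρ s v)) → ∀ m → IsPolynomial (λ s → evalMonomial (ρ s) m)
  poly-evalMonomial pρ []      = poly-const 1ℚ
  poly-evalMonomial pρ (v ∷ m) = poly-* (pρ v) (poly-evalMonomial pρ m)

  poly-eval : ∀ {ρ : ℚ → V → ℚ} → (∀ v → IsPolynomial (λ s → ρ s v)) → ∀ P → IsPolynomial (λ s → eval (ρ s) P)
  poly-eval pρ []            = poly-const 0ℚ
  poly-eval pρ ((c , m) ∷ P) = poly-+ (poly-* (poly-const c) (poly-evalMonomial pρ m)) (poly-eval pρ P)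

  VariablesIn : List V → Polynomial V → Set
  VariablesIn S P = All (λ { (_ , m) → All (_∈ S) m }) P

  evalMonomial-cong : ∀ {S : List V} {ρ ρ′} → (∀ v → v ∈ S → ρ v ≡ ρ′ v) → ∀ {m} → All (_∈ S) m → evalMonomial ρ m ≡ evalMonomial ρ′ m
  evalMonomial-cong e []         = refl
  evalMonomial-cong e (v∈S ∷ m∈) = cong₂ ℚ._*_ (e _ v∈S) (evalMonomial-cong e m∈)

  eval-cong : ∀ {S : List V} {ρ ρ′} → (∀ v → v ∈ S → ρ v ≡ ρ′ v) → ∀ {P} → VariablesIn S P → eval ρ P ≡ eval ρ′ P
  eval-cong e []                       = refl
  eval-cong e {(c , m) ∷ P} (m∈ ∷ P∈) = cong₂ (λ y z → c ℚ.* y ℚ.+ z) (evalMonomial-cong e m∈) (eval-cong e P∈)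

poly-unique : ∀ {g h} → IsPolynomial g → IsPolynomial h → (∀ m → g (fromℕ m) ≡ h (fromℕ m)) → ∀ s → g s ≡ h s
poly-unique {g} {h} pg ph e s = lemma (g s) (h s) (trans (proj₂ d s) (horner-zero (length (proj₁ d)) (proj₁ d) refl 0
  (λ m _ → trans (sym (proj₂ d (fromℕ m))) (trans (cong (ℚ._+ (ℚ.- 1ℚ) ℚ.* h (fromℕ m)) (e m)) (cancel (h (fromℕ m))))) s))
  where
  d : IsPolynomial (λ s → g s ℚ.+ (ℚ.- 1ℚ) ℚ.* h s)
  d = poly-+ pg (poly-* (poly-const (ℚ.- 1ℚ)) ph)
  cancel : ∀ x → x ℚ.+ (ℚ.- 1ℚ) ℚ.* x ≡ 0ℚ
  cancel = solve-∀ ℚ-ring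
  lemma : ∀ x y → x ℚ.+ (ℚ.- 1ℚ) ℚ.* y ≡ 0ℚ → x ≡ y
  lemma x y e = trans (go x y) (trans (cong (ℚ._+ y) e) (ℚₚ.+-identityˡ y))
    where
    go : ∀ x y → x ≡ x ℚ.+ (ℚ.- 1ℚ) ℚ.* y ℚ.+ y
    go = solve-∀ ℚ-ring

-- Agreement of P_j with the product of exponentials at all rational points

module Density {p : ℕ} (p-prime : Prime p) (S : List (Words.W p-prime)) (S! : Unique S) (j : ℕ)
  (complete : ∀ (w : Words.W p-prime) → length (value w) ≤ suc (suc j) → w ∈ S)
  (P : Polynomial (Words.W p-prime)) (represents : Words.Represents p-prime j P) (P∈S : VariablesIn S P)
  (M : ℕ) (short : ∀ (w : Words.W p-prime) → w ∈ S → length (value w) ≤ M) where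
  open Words p-prime
  open Factors p-prime
  open Windows p-prime
  -- Coefficient j is determined modulo x^(j+1); this fixes the length j+2 up to which `S` must be
  -- complete.
  open ProductFormula p-prime S S! (suc j) complete

  expansion : (W → ℚ) → PowerSeries
  expansion ρ = ∏ S (λ w → exp (Series.log (r (value w))) (ρ w))

  -- The change of the occurrence vector when 0^M (p-1)^M u is put on top of a word.
  increment : Digits → W → ℚ
  increment u w = fromℕ (occ (rv w) (separator M) ℕ.+ occ (rv w) u)

  combination : List (ℚ × Digits) → W → ℚ
  combination []            w = 0ℚ
  combination ((s , u) ∷ L) w = s ℚ.* increment u w ℚ.+ combination L w

  point : Digits → List (ℚ × Digits) → W → ℚ
  point ds L w = fromℕ (occ (rv w) ds) ℚ.+ combination L w

  expansion-cong : ∀ {ρ ρ′} → (∀ w → w ∈ S → ρ w ≡ ρ′ w) → expansion ρ j ≡ expansion ρ′ j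
  expansion-cong e = ∏-cong S (λ w w∈S i → cong (λ s → exp (Series.log (r (value w))) s i) (e w w∈S)) j

  agree-cong : ∀ {ρ ρ′} → (∀ w → w ∈ S → ρ w ≡ ρ′ w) → eval ρ P ≡ expansion ρ j → eval ρ′ P ≡ expansion ρ′ j
  agree-cong e agree = trans (sym (eval-cong e P∈S)) (trans agree (expansion-cong e))

  agree-occ : ∀ ds → eval (λ w → fromℕ (occ (rv w) ds)) P ≡ expansion (λ w → fromℕ (occ (rv w) ds)) j
  agree-occ ds = trans (sym (eval-cong (λ w _ → occurrences-occ w ds) P∈S)) (trans (sym (represents (fromDigits ds)))
    (trans (sym (product-formula ds j ℕₚ.≤-refl))
      (∏-cong S (λ w _ → 𝕊.sym (exp-log (r (value w)) (r-coeff₀ (value w)) (occ (rv w) ds))) j)))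

  repeat : ℕ → Digits → Digits → Digits
  repeat zero    u ds = ds
  repeat (suc m) u ds = repeat m u ds ++ separator M ++ u

  occ-repeat : ∀ m u ds w → w ∈ S → fromℕ (occ (rv w) (repeat m u ds)) ≡ fromℕ (occ (rv w) ds) ℚ.+ fromℕ m ℚ.* increment u w
  occ-repeat zero    u ds w w∈S = lemma (fromℕ (occ (rv w) ds)) (increment u w)
    where
    lemma : ∀ a b → a ≡ a ℚ.+ 0ℚ ℚ.* b
    lemma = solve-∀ ℚ-ring
  occ-repeat (suc m) u ds w w∈S = begin
    fromℕ (occ (rv w) (repeat m u ds ++ separator M ++ u))                      ≡⟨ cong fromℕ (occ-block M w (repeat m u ds) u (short w w∈S)) ⟩
    fromℕ (occ (rv w) (repeat m u ds) ℕ.+ (occ (rv w) (separator M) ℕ.+ occ (rv w) u)) ≡⟨ fromℕ-homo-+ (occ (rv w) (repeat m u ds)) _ ⟩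
    fromℕ (occ (rv w) (repeat m u ds)) ℚ.+ increment u w                        ≡⟨ cong (ℚ._+ increment u w) (occ-repeat m u ds w w∈S) ⟩
    fromℕ (occ (rv w) ds) ℚ.+ fromℕ m ℚ.* increment u w ℚ.+ increment u w       ≡⟨ lemma (fromℕ (occ (rv w) ds)) (fromℕ m) (increment u w) ⟩
    fromℕ (occ (rv w) ds) ℚ.+ (1ℚ ℚ.+ fromℕ m) ℚ.* increment u w                ≡⟨ cong (λ z → fromℕ (occ (rv w) ds) ℚ.+ z ℚ.* increment u w) (fromℕ-homo-+ 1 m) ⟨
    fromℕ (occ (rv w) ds) ℚ.+ fromℕ (suc m) ℚ.* increment u w                   ∎
    where
    open ≡-Reasoning
    lemma : ∀ a b c → a ℚ.+ b ℚ.* c ℚ.+ c ≡ a ℚ.+ (1ℚ ℚ.+ b) ℚ.* c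
    lemma = solve-∀ ℚ-ring

  -- Induction frees one coefficient at a time. At s = m the block is absorbed into the base word as
  -- m copies, which the induction hypothesis covers since it holds for every base; `poly-unique`
  -- then passes from natural to rational s.
  agree-point : ∀ L ds → eval (point ds L) P ≡ expansion (point ds L) j
  agree-point []            ds = agree-cong (λ w _ → sym (ℚₚ.+-identityʳ (fromℕ (occ (rv w) ds)))) (agree-occ ds)
  agree-point ((s , u) ∷ L) ds = poly-unique {λ s → eval (line s) P} {λ s → expansion (line s) j}
    (poly-eval line-poly P) (poly-∏ S (λ w → poly-exp (Series.log (r (value w))) (line-poly w)) j)
    (λ m → agree-cong (λ w w∈S → trans (cong (ℚ._+ combination L w) (occ-repeat m u ds w w∈S))
        (ℚₚ.+-assoc (fromℕ (occ (rv w) ds)) (fromℕ m ℚ.* increment u w) (combination L w)))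
      (agree-point L (repeat m u ds))) s
    where
    line : ℚ → W → ℚ
    line s w = fromℕ (occ (rv w) ds) ℚ.+ (s ℚ.* increment u w ℚ.+ combination L w)
    line-poly : ∀ w → IsPolynomial (λ s → line s w)
    line-poly w = poly-+ (poly-const (fromℕ (occ (rv w) ds))) (poly-+ (poly-* poly-id (poly-const (increment u w))) (poly-const (combination L w)))

  -- By telescoping, these four blocks change only the coordinate x.
  unit : W → ℚ → List (ℚ × Digits) → List (ℚ × Digits)
  unit x s L = (s , bottom ∷ middle ++ top ∷ []) ∷ (ℚ.- s , middle ++ top ∷ []) ∷ (ℚ.- s , bottom ∷ middle) ∷ (s , middle) ∷ L
    where open Decomposition (decompose x)

  -- The weights s, -s, -s, s sum to zero, so the contributions of the separators cancel and the
  -- inclusion-exclusion of `occ-telescope` remains.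
  combination-unit : ∀ x s L w → combination (unit x s L) w ≡ s ℚ.* fromℕ (same (rv w) (rv x)) ℚ.+ combination L w
  combination-unit x s L w = begin
    combination (unit x s L) w
      ≡⟨ cong₂ (λ y z → s ℚ.* y ℚ.+ ((ℚ.- s) ℚ.* z ℚ.+ ((ℚ.- s) ℚ.* increment (b ∷ u) w ℚ.+ (s ℚ.* increment u w ℚ.+ combination L w))))
           (fromℕ-homo-+ e (occ v (b ∷ u ++ a ∷ []))) (fromℕ-homo-+ e (occ v (u ++ a ∷ []))) ⟩
    s ℚ.* (E ℚ.+ A) ℚ.+ ((ℚ.- s) ℚ.* (E ℚ.+ B) ℚ.+ ((ℚ.- s) ℚ.* increment (b ∷ u) w ℚ.+ (s ℚ.* increment u w ℚ.+ combination L w)))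
      ≡⟨ cong₂ (λ y z → s ℚ.* (E ℚ.+ A) ℚ.+ ((ℚ.- s) ℚ.* (E ℚ.+ B) ℚ.+ ((ℚ.- s) ℚ.* y ℚ.+ (s ℚ.* z ℚ.+ combination L w))))
           (fromℕ-homo-+ e (occ v (b ∷ u))) (fromℕ-homo-+ e (occ v u)) ⟩
    s ℚ.* (E ℚ.+ A) ℚ.+ ((ℚ.- s) ℚ.* (E ℚ.+ B) ℚ.+ ((ℚ.- s) ℚ.* (E ℚ.+ B′) ℚ.+ (s ℚ.* (E ℚ.+ A′) ℚ.+ combination L w)))
      ≡⟨ collect s E A B B′ A′ (combination L w) ⟩
    s ℚ.* (A ℚ.+ A′ ℚ.- (B ℚ.+ B′)) ℚ.+ combination L w
      ≡⟨ cong (λ z → s ℚ.* (z ℚ.- (B ℚ.+ B′)) ℚ.+ combination L w) telescope ⟩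
    s ℚ.* (B ℚ.+ B′ ℚ.+ F ℚ.- (B ℚ.+ B′)) ℚ.+ combination L w
      ≡⟨ cong (λ z → s ℚ.* z ℚ.+ combination L w) (cancel (B ℚ.+ B′) F) ⟩
    s ℚ.* F ℚ.+ combination L w
      ≡⟨ cong (λ z → s ℚ.* fromℕ (same v z) ℚ.+ combination L w) (Decomposition.reversed (decompose x)) ⟨
    s ℚ.* fromℕ (same v (rv x)) ℚ.+ combination L w ∎
    where
    open ≡-Reasoning
    a = Decomposition.top (decompose x)
    b = Decomposition.bottom (decompose x)
    u = Decomposition.middle (decompose x)
    v = rv w
    e = occ v (separator M)
    E = fromℕ e
    A = fromℕ (occ v (b ∷ u ++ a ∷ []))
    B = fromℕ (occ v (u ++ a ∷ []))
    B′ = fromℕ (occ v (b ∷ u))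
    A′ = fromℕ (occ v u)
    F = fromℕ (same v (b ∷ u ++ a ∷ []))
    telescope : A ℚ.+ A′ ≡ B ℚ.+ B′ ℚ.+ F
    telescope = trans (sym (fromℕ-homo-+ (occ v (b ∷ u ++ a ∷ [])) (occ v u))) (trans (cong fromℕ (occ-telescope v b u a))
      (trans (fromℕ-homo-+ (occ v (u ++ a ∷ []) ℕ.+ occ v (b ∷ u)) (same v (b ∷ u ++ a ∷ [])))
        (cong (ℚ._+ F) (fromℕ-homo-+ (occ v (u ++ a ∷ [])) (occ v (b ∷ u))))))
    collect : ∀ s e a b c d l → s ℚ.* (e ℚ.+ a) ℚ.+ ((ℚ.- s) ℚ.* (e ℚ.+ b) ℚ.+ ((ℚ.- s) ℚ.* (e ℚ.+ c) ℚ.+ (s ℚ.* (e ℚ.+ d) ℚ.+ l)))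
      ≡ s ℚ.* (a ℚ.+ d ℚ.+ (ℚ.- (b ℚ.+ c))) ℚ.+ l
    collect = solve-∀ ℚ-ring
    cancel : ∀ x y → x ℚ.+ y ℚ.+ (ℚ.- x) ≡ y
    cancel = solve-∀ ℚ-ring

  units : (W → ℚ) → List W → List (ℚ × Digits)
  units ρ []      = []
  units ρ (x ∷ S) = unit x (ρ x) (units ρ S)

  same-rv-≢ : ∀ {w x} → w ≢ x → same (rv w) (rv x) ≡ 0
  same-rv-≢ w≢x = same-≢ (w≢x ∘ reversed-injective)

  units-∉ : ∀ ρ S w → All (w ≢_) S → combination (units ρ S) w ≡ 0ℚ
  units-∉ ρ []      w _             = refl
  units-∉ ρ (x ∷ S) w (w≢x ∷ w∉S) = trans (combination-unit x (ρ x) (units ρ S) w)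
    (trans (cong₂ (λ y z → ρ x ℚ.* fromℕ y ℚ.+ z) (same-rv-≢ w≢x) (units-∉ ρ S w w∉S)) (lemma (ρ x)))
    where
    lemma : ∀ a → a ℚ.* 0ℚ ℚ.+ 0ℚ ≡ 0ℚ
    lemma = solve-∀ ℚ-ring

  units-∈ : ∀ ρ S w → Unique S → w ∈ S → combination (units ρ S) w ≡ ρ w
  units-∈ ρ (x ∷ S) w (x∉S ∷ _)  (here refl)  = trans (combination-unit x (ρ x) (units ρ S) w)
    (trans (cong₂ (λ y z → ρ x ℚ.* fromℕ y ℚ.+ z) (same-refl (rv w)) (units-∉ ρ S w x∉S)) (lemma (ρ x)))
    where
    lemma : ∀ a → a ℚ.* 1ℚ ℚ.+ 0ℚ ≡ a
    lemma = solve-∀ ℚ-ring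
  units-∈ ρ (x ∷ S) w (x∉S ∷ S!) (there w∈S) = trans (combination-unit x (ρ x) (units ρ S) w)
    (trans (cong₂ (λ y z → ρ x ℚ.* fromℕ y ℚ.+ z) (same-rv-≢ (λ w≡x → All.lookup x∉S w∈S (sym w≡x))) (units-∈ ρ S w S! w∈S)) (lemma (ρ x) (ρ w)))
    where
    lemma : ∀ a b → a ℚ.* 0ℚ ℚ.+ b ≡ b
    lemma = solve-∀ ℚ-ring

  -- The empty base word has occurrence vector zero, and the units then set every coordinate in `S`.
  agree : ∀ ρ → eval ρ P ≡ expansion ρ j
  agree ρ = agree-cong (λ w w∈S → trans (ℚₚ.+-identityˡ (combination (units ρ S) w)) (units-∈ ρ S w S! w∈S)) (agree-point (units ρ S) [])

-- Extraction of coefficients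

Σ<-insert : ∀ {K e f g x} → e < K → f e ≡ x ℚ.+ g e → (∀ k → k ≢ e → f k ≡ g k) → Σ< K f ≡ x ℚ.+ Σ< K g
Σ<-insert {suc K} {zero} {f} {g} {x} _ fe f≡g = trans
  (cong₂ ℚ._+_ fe (Σ<-cong K (λ i _ → f≡g (suc i) (λ ()))))
  (ℚₚ.+-assoc x (g 0) (Σ< K (g ∘ suc)))
Σ<-insert {suc K} {suc e} {f} {g} {x} (s≤s e<K) fe f≡g = trans
  (cong₂ ℚ._+_ (f≡g 0 (λ ())) (Σ<-insert {K} {e} {f ∘ suc} {g ∘ suc} {x} e<K fe (λ k k≢e → f≡g (suc k) (k≢e ∘ ℕₚ.suc-injective))))
  (lemma (g 0) x (Σ< K (g ∘ suc)))
  where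
  lemma : ∀ a b c → a ℚ.+ (b ℚ.+ c) ≡ b ℚ.+ (a ℚ.+ c)
  lemma = solve-∀ ℚ-ring

module Coefficients {V : Set} (_≟_ : DecidableEquality V) where

  exp# : V → Monomial V → ℕ
  exp# = exponent _≟_

  exponent-∷-≡ : ∀ v m → exp# v (v ∷ m) ≡ suc (exp# v m)
  exponent-∷-≡ v m = cong length (Listₚ.filter-accept (v ≟_) refl)

  exponent-∷-≢ : ∀ {v u} m → v ≢ u → exp# v (u ∷ m) ≡ exp# v m
  exponent-∷-≢ {v} m v≢u = cong length (Listₚ.filter-reject (v ≟_) v≢u)

  exponent-++ : ∀ v m m′ → exp# v (m ++ m′) ≡ exp# v m ℕ.+ exp# v m′
  exponent-++ v m m′ = trans (cong length (Listₚ.filter-++ (v ≟_) m m′)) (Listₚ.length-++ (filter (v ≟_) m))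

  exponent-∉ : ∀ {v} m → v ∉ m → exp# v m ≡ 0
  exponent-∉ []      v∉m = refl
  exponent-∉ (u ∷ m) v∉m = trans (exponent-∷-≢ m (v∉m ∘ here)) (exponent-∉ m (v∉m ∘ there))

  exponent-replicate-≡ : ∀ n v → exp# v (replicate n v) ≡ n
  exponent-replicate-≡ zero    v = refl
  exponent-replicate-≡ (suc n) v = trans (exponent-∷-≡ v (replicate n v)) (cong suc (exponent-replicate-≡ n v))

  exponent-replicate-≢ : ∀ n {v u} → v ≢ u → exp# v (replicate n u) ≡ 0
  exponent-replicate-≢ zero    v≢u = refl
  exponent-replicate-≢ (suc n) {u = u} v≢u = trans (exponent-∷-≢ (replicate n u) v≢u) (exponent-replicate-≢ n v≢u)

  remove : V → Monomial V → Monomial V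
  remove v = filter (λ u → ¬? (v ≟ u))

  exponent-remove-≡ : ∀ v m → exp# v (remove v m) ≡ 0
  exponent-remove-≡ v []      = refl
  exponent-remove-≡ v (u ∷ m) with v ≟ u
  ... | yes refl = exponent-remove-≡ v m
  ... | no v≢u   = trans (exponent-∷-≢ (remove v m) v≢u) (exponent-remove-≡ v m)

  exponent-remove-≢ : ∀ {v u} m → u ≢ v → exp# u (remove v m) ≡ exp# u m
  exponent-remove-≢ [] u≢v = refl
  exponent-remove-≢ {v} {u} (x ∷ m) u≢v with v ≟ x
  ... | yes refl = trans (exponent-remove-≢ m u≢v) (sym (exponent-∷-≢ m u≢v))
  ... | no v≢x with u ≟ x
  ...   | yes refl = cong suc (exponent-remove-≢ m u≢v)
  ...   | no u≢x   = exponent-remove-≢ m u≢v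

  SameMonomial⇒exponent : ∀ {m m′} → SameMonomial _≟_ m m′ → ∀ v → exp# v m ≡ exp# v m′
  SameMonomial⇒exponent {m} {m′} same v with Any.any? (v ≟_) (m ++ m′)
  ... | yes v∈ = All.lookup same v∈
  ... | no  v∉ = trans (exponent-∉ m (v∉ ∘ ∈-++⁺ˡ)) (sym (exponent-∉ m′ (v∉ ∘ ∈-++⁺ʳ m)))

  exponent⇒SameMonomial : ∀ m m′ → (∀ v → exp# v m ≡ exp# v m′) → SameMonomial _≟_ m m′
  exponent⇒SameMonomial m m′ e = All.tabulate (λ {v} _ → e v)

  remove-SameMonomial : ∀ v {m m′} → SameMonomial _≟_ m m′ → SameMonomial _≟_ (remove v m) (remove v m′)
  remove-SameMonomial v {m} {m′} same = exponent⇒SameMonomial (remove v m) (remove v m′) λ u → eq u (u ≟ v)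
    where
    eq : ∀ u → Dec (u ≡ v) → exp# u (remove v m) ≡ exp# u (remove v m′)
    eq u (yes refl) = trans (exponent-remove-≡ v m) (sym (exponent-remove-≡ v m′))
    eq u (no u≢v)   = trans (exponent-remove-≢ m u≢v) (trans (SameMonomial⇒exponent {m} {m′} same u) (sym (exponent-remove-≢ m′ u≢v)))

  unremove-SameMonomial : ∀ v {m m′} → exp# v m ≡ exp# v m′ → SameMonomial _≟_ (remove v m) (remove v m′) → SameMonomial _≟_ m m′
  unremove-SameMonomial v {m} {m′} e same = exponent⇒SameMonomial m m′ λ u → eq u (u ≟ v)
    where
    eq : ∀ u → Dec (u ≡ v) → exp# u m ≡ exp# u m′
    eq u (yes refl) = e
    eq u (no u≢v)   = trans (sym (exponent-remove-≢ m u≢v)) (trans (SameMonomial⇒exponent {remove v m} {remove v m′} same u) (exponent-remove-≢ m′ u≢v))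

  -- The coefficient of X_v^k when P is read as a polynomial in X_v over the remaining variables.
  slice : V → ℕ → Polynomial V → Polynomial V
  slice v k []            = []
  slice v k ((c , m) ∷ P) with exp# v m ℕ.≟ k
  ... | yes _ = (c , remove v m) ∷ slice v k P
  ... | no  _ = slice v k P

  coeff-slice : ∀ v m P → coeff _≟_ m P ≡ coeff _≟_ (remove v m) (slice v (exp# v m) P)
  coeff-slice v m []             = refl
  coeff-slice v m ((c , m′) ∷ P) with sameMonomial? _≟_ m m′ | exp# v m′ ℕ.≟ exp# v m
  ... | no _     | no _  = coeff-slice v m P
  ... | yes same | no ≢  = ⊥-elim (≢ (sym (SameMonomial⇒exponent {m} {m′} same v)))
  ... | yes same | yes _ with sameMonomial? _≟_ (remove v m) (remove v m′)
  ...   | yes _ = cong (c ℚ.+_) (coeff-slice v m P)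
  ...   | no ¬s = ⊥-elim (¬s (remove-SameMonomial v {m} {m′} same))
  coeff-slice v m ((c , m′) ∷ P) | no ¬same | yes e with sameMonomial? _≟_ (remove v m) (remove v m′)
  ...   | yes s = ⊥-elim (¬same (unremove-SameMonomial v {m} {m′} (sym e) s))
  ...   | no _  = coeff-slice v m P

  evalMonomial-remove : ∀ ρ v m → evalMonomial ρ m ≡ (ρ v ^ℚ exp# v m) ℚ.* evalMonomial ρ (remove v m)
  evalMonomial-remove ρ v []      = refl
  evalMonomial-remove ρ v (u ∷ m) with v ≟ u
  ... | yes refl = trans (cong (ρ v ℚ.*_) (evalMonomial-remove ρ v m)) (sym (ℚₚ.*-assoc (ρ v) (ρ v ^ℚ exp# v m) (evalMonomial ρ (remove v m))))
  ... | no _     = trans (cong (ρ u ℚ.*_) (evalMonomial-remove ρ v m)) (lemma (ρ u) (ρ v ^ℚ exp# v m) (evalMonomial ρ (remove v m)))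
    where
    lemma : ∀ a b c → a ℚ.* (b ℚ.* c) ≡ b ℚ.* (a ℚ.* c)
    lemma = solve-∀ ℚ-ring

  DegreeBound : V → ℕ → Polynomial V → Set
  DegreeBound v K P = All (λ { (_ , m) → exp# v m < K }) P

  -- The bound may be enlarged, because the comparison below also has to exceed j and the exponent
  -- in question.
  degreeBound : ∀ v P → ∃ λ K → ∀ K′ → K ≤ K′ → DegreeBound v K′ P
  degreeBound v []            = 0 , λ _ _ → []
  degreeBound v ((c , m) ∷ P) = let K , bound = degreeBound v P in
    suc (exp# v m) ⊔ K , λ K′ ≤K′ → ℕₚ.≤-trans (ℕₚ.m≤m⊔n (suc (exp# v m)) K) ≤K′ ∷ bound K′ (ℕₚ.≤-trans (ℕₚ.m≤n⊔m (suc (exp# v m)) K) ≤K′)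

  slice-∷-≡ : ∀ v c m P → slice v (exp# v m) ((c , m) ∷ P) ≡ (c , remove v m) ∷ slice v (exp# v m) P
  slice-∷-≡ v c m P with exp# v m ℕ.≟ exp# v m
  ... | yes _ = refl
  ... | no ≢  = ⊥-elim (≢ refl)

  slice-∷-≢ : ∀ v {k} c m P → k ≢ exp# v m → slice v k ((c , m) ∷ P) ≡ slice v k P
  slice-∷-≢ v {k} c m P k≢ with exp# v m ℕ.≟ k
  ... | yes e = ⊥-elim (k≢ (sym e))
  ... | no _  = refl

  eval-slice : ∀ ρ v {K} P → DegreeBound v K P → eval ρ P ≡ powerSum K (λ k → eval ρ (slice v k P)) (ρ v)
  eval-slice ρ v {K} []            _          = sym (Σ<-zero K (λ k _ → ℚₚ.*-zeroʳ (ρ v ^ℚ k)))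
  eval-slice ρ v {K} ((c , m) ∷ P) (e<K ∷ bound) = trans (cong (c ℚ.* evalMonomial ρ m ℚ.+_) (eval-slice ρ v P bound))
    (sym (Σ<-insert {K} {exp# v m} {λ k → (ρ v ^ℚ k) ℚ.* eval ρ (slice v k ((c , m) ∷ P))} {λ k → (ρ v ^ℚ k) ℚ.* eval ρ (slice v k P)} {c ℚ.* evalMonomial ρ m} e<K
      (trans (cong (λ Q → (ρ v ^ℚ exp# v m) ℚ.* eval ρ Q) (slice-∷-≡ v c m P))
        (trans (lemma (ρ v ^ℚ exp# v m) c (evalMonomial ρ (remove v m)) (eval ρ (slice v (exp# v m) P)))
          (cong (λ z → c ℚ.* z ℚ.+ (ρ v ^ℚ exp# v m) ℚ.* eval ρ (slice v (exp# v m) P)) (sym (evalMonomial-remove ρ v m)))))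
      (λ k k≢e → cong (λ Q → (ρ v ^ℚ k) ℚ.* eval ρ Q) (slice-∷-≢ v c m P k≢e))))
    where
    lemma : ∀ a b c d → a ℚ.* (b ℚ.* c ℚ.+ d) ≡ b ℚ.* (a ℚ.* c) ℚ.+ a ℚ.* d
    lemma = solve-∀ ℚ-ring

  remove-∈ : ∀ {v S} m → All (_∈ v ∷ S) m → All (_∈ S) (remove v m)
  remove-∈ []      []        = []
  remove-∈ {v} (u ∷ m) (u∈ ∷ m∈) with v ≟ u | u∈
  ... | yes _  | _         = remove-∈ m m∈
  ... | no v≢u | here u≡v  = ⊥-elim (v≢u (sym u≡v))
  ... | no _   | there u∈S = u∈S ∷ remove-∈ m m∈

  slice-VariablesIn : ∀ {v S} k P → VariablesIn (v ∷ S) P → VariablesIn S (slice v k P)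
  slice-VariablesIn k []            []        = []
  slice-VariablesIn {v} k ((c , m) ∷ P) (m∈ ∷ P∈) with exp# v m ℕ.≟ k
  ... | yes _ = remove-∈ m m∈ ∷ slice-VariablesIn k P P∈
  ... | no _  = slice-VariablesIn k P P∈

  update : (V → ℚ) → V → ℚ → V → ℚ
  update ρ v s u with u ≟ v
  ... | yes _ = s
  ... | no _  = ρ u

  update-≡ : ∀ ρ v s → update ρ v s v ≡ s
  update-≡ ρ v s with v ≟ v
  ... | yes _  = refl
  ... | no v≢v = ⊥-elim (v≢v refl)

  update-≢ : ∀ ρ v s {u} → u ≢ v → update ρ v s u ≡ ρ u
  update-≢ ρ v s {u} u≢v with u ≟ v
  ... | yes u≡v = ⊥-elim (u≢v u≡v)
  ... | no _    = refl

  coeff-constant : ∀ ρ P → VariablesIn [] P → coeff _≟_ [] P ≡ eval ρ P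
  coeff-constant ρ []             _          = refl
  coeff-constant ρ ((c , []) ∷ P) ([] ∷ P∈) = cong₂ ℚ._+_ (sym (ℚₚ.*-identityʳ c)) (coeff-constant ρ P P∈)

  -- The terms with k > j vanish at x^j, so every K > j gives the same polynomial in s.
  exp-powerSum : ∀ {G} → Ord 1 G → ∀ A j K s → j < K → (A ⊛ exp G s) j ≡ powerSum K (λ k → (A ⊛ dividedPower G k) j) s
  exp-powerSum {G} o A j K s j<K = begin
    (A ⊛ exp G s) j                               ≡⟨ ⊛-Sum A (expTerm-Ord s o) j ⟩
    Sum (λ k → A ⊛ expTerm G s k) j               ≡⟨ Sum-truncate (λ k → Ord-⊛ʳ A (expTerm-Ord s o k)) j<K ⟨
    Σ< K (λ k → (A ⊛ expTerm G s k) j)            ≡⟨ Σ<-cong K (λ k _ → trans (⊛-◂-assoc (s ^ℚ k) A (dividedPower G k) j) (◂-coeff (s ^ℚ k) (A ⊛ dividedPower G k) j)) ⟩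
    Σ< K (λ k → (s ^ℚ k) ℚ.* (A ⊛ dividedPower G k) j) ∎
    where open ≡-Reasoning

  module _ (G : V → PowerSeries) (o : ∀ v → Ord 1 (G v)) (j : ℕ) where

    -- With the other variables fixed, both sides are polynomials in the value s of x, and equality
    -- for all s forces equality of the coefficients of s^k.
    slice-exp : ∀ {x S} → All (x ≢_) S → ∀ H P → VariablesIn (x ∷ S) P →
      (∀ ρ → eval ρ P ≡ (H ⊛ ∏ (x ∷ S) (λ v → exp (G v) (ρ v))) j) →
      ∀ k ρ → eval ρ (slice x k P) ≡ ((H ⊛ dividedPower (G x) k) ⊛ ∏ S (λ v → exp (G v) (ρ v))) j
    slice-exp {x} {S} x∉S H P P∈ agree k ρ = trans
      (powerSum-injective K {λ k → eval ρ (slice x k P)} {λ k → ((H ⊛ R) ⊛ dividedPower (G x) k) j} (λ s → begin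
        powerSum K (λ k → eval ρ (slice x k P)) s
          ≡⟨ Σ<-cong K (λ k _ → cong ((s ^ℚ k) ℚ.*_) (eval-cong (λ v v∈S → update-≢ ρ x s (v≢x v∈S)) (slice-VariablesIn k P P∈))) ⟨
        powerSum K (λ k → eval (update ρ x s) (slice x k P)) s
          ≡⟨ cong (powerSum K (λ k → eval (update ρ x s) (slice x k P))) (update-≡ ρ x s) ⟨
        powerSum K (λ k → eval (update ρ x s) (slice x k P)) (update ρ x s x)
          ≡⟨ eval-slice (update ρ x s) x P (proj₂ bound K (ℕₚ.m≤n+m (proj₁ bound) (suc j ℕ.+ suc k))) ⟨
        eval (update ρ x s) P
          ≡⟨ agree (update ρ x s) ⟩
        (H ⊛ (exp (G x) (update ρ x s x) ⊛ ∏ S (λ v → exp (G v) (update ρ x s v)))) j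
          ≡⟨ 𝕊.*-congˡ {H} (𝕊.*-cong (λ i → cong (λ z → exp (G x) z i) (update-≡ ρ x s))
               (∏-cong S (λ v v∈S i → cong (λ z → exp (G v) z i) (update-≢ ρ x s (v≢x v∈S))))) j ⟩
        (H ⊛ (exp (G x) s ⊛ R)) j
          ≡⟨ rotate H (exp (G x) s) R j ⟩
        ((H ⊛ R) ⊛ exp (G x) s) j
          ≡⟨ exp-powerSum (o x) (H ⊛ R) j K s (ℕₚ.≤-trans (ℕₚ.m≤m+n (suc j) (suc k)) (ℕₚ.m≤m+n (suc j ℕ.+ suc k) (proj₁ bound))) ⟩
        powerSum K (λ k → ((H ⊛ R) ⊛ dividedPower (G x) k) j) s ∎)
        (ℕₚ.≤-trans (ℕₚ.m≤n+m (suc k) (suc j)) (ℕₚ.m≤m+n (suc j ℕ.+ suc k) (proj₁ bound))))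
      (swap H R (dividedPower (G x) k) j)
      where
      open ≡-Reasoning
      R = ∏ S (λ v → exp (G v) (ρ v))
      bound = degreeBound x P
      -- Large enough for three purposes: it exceeds j, the exponent k, and the degree of P in x.
      K = suc j ℕ.+ suc k ℕ.+ proj₁ bound
      v≢x : ∀ {v} → v ∈ S → v ≢ x
      v≢x v∈S v≡x = All.lookup x∉S v∈S (sym v≡x)
      rotate : ∀ a b c → a ⊛ (b ⊛ c) ≋ (a ⊛ c) ⊛ b
      rotate = 𝕊-solve 3 (λ a b c → a :* (b :* c) := (a :* c) :* b) 𝕊.refl
      swap : ∀ a b c → (a ⊛ b) ⊛ c ≋ (a ⊛ c) ⊛ b
      swap = 𝕊-solve 3 (λ a b c → (a :* b) :* c := (a :* c) :* b) 𝕊.refl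

    -- Induction over the variables. `H` collects the divided powers of those already extracted, so
    -- that the remaining identity keeps its form.
    coeff-exp : ∀ S → Unique S → ∀ H P → VariablesIn S P →
      (∀ ρ → eval ρ P ≡ (H ⊛ ∏ S (λ v → exp (G v) (ρ v))) j) →
      ∀ m → All (_∈ S) m → coeff _≟_ m P ≡ (H ⊛ ∏ S (λ v → dividedPower (G v) (exp# v m))) j
    coeff-exp []      _          H P P∈ agree []      _ = trans (coeff-constant (λ _ → 0ℚ) P P∈) (agree (λ _ → 0ℚ))
    coeff-exp []      _          H P P∈ agree (_ ∷ _) (() ∷ _)
    coeff-exp (x ∷ S) (x∉S ∷ S!) H P P∈ agree m m∈ = begin
      coeff _≟_ m P
        ≡⟨ coeff-slice x m P ⟩
      coeff _≟_ (remove x m) (slice x (exp# x m) P)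
        ≡⟨ coeff-exp S S! (H ⊛ dividedPower (G x) (exp# x m)) (slice x (exp# x m) P) (slice-VariablesIn (exp# x m) P P∈)
             (slice-exp x∉S H P P∈ agree (exp# x m)) (remove x m) (remove-∈ m m∈) ⟩
      ((H ⊛ dividedPower (G x) (exp# x m)) ⊛ ∏ S (λ v → dividedPower (G v) (exp# v (remove x m)))) j
        ≡⟨ 𝕊.trans (𝕊.*-assoc H (dividedPower (G x) (exp# x m)) _) (𝕊.*-congˡ {H} (𝕊.*-congˡ {dividedPower (G x) (exp# x m)}
             (∏-cong S (λ v v∈S i → cong (λ e → dividedPower (G v) e i) (exponent-remove-≢ m (λ v≡x → All.lookup x∉S v∈S (sym v≡x))))))) j ⟩
      (H ⊛ (dividedPower (G x) (exp# x m) ⊛ ∏ S (λ v → dividedPower (G v) (exp# v m)))) j ∎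
      where open ≡-Reasoning

  monomial-∈ : ∀ {S ℓ} (w : Vector V ℓ) k → (∀ i → w i ∈ S) → All (_∈ S) (monomial w k)
  monomial-∈ {ℓ = zero}  w k w∈S = []
  monomial-∈ {ℓ = suc ℓ} w k w∈S = Allₚ.++⁺ (Allₚ.replicate⁺ (k fzero) (w∈S fzero)) (monomial-∈ (w ∘ fsuc) (k ∘ fsuc) (w∈S ∘ fsuc))

  exponent-monomial-∉ : ∀ {ℓ} {v} (w : Vector V ℓ) k → (∀ i → v ≢ w i) → exp# v (monomial w k) ≡ 0
  exponent-monomial-∉ {zero}      w k v≢ = refl
  exponent-monomial-∉ {suc ℓ} {v} w k v≢ = trans (exponent-++ v (replicate (k fzero) (w fzero)) (monomial (w ∘ fsuc) (k ∘ fsuc)))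
    (cong₂ ℕ._+_ (exponent-replicate-≢ (k fzero) (v≢ fzero)) (exponent-monomial-∉ (w ∘ fsuc) (k ∘ fsuc) (v≢ ∘ fsuc)))

  -- Variables outside the monomial contribute the zeroth divided power, which is 1. By injectivity
  -- the first variable does not return in the rest of the monomial, so its exponent is exactly the
  -- first entry of k.
  ∏-monomial : ∀ (G : V → PowerSeries) {S} → Unique S → ∀ {ℓ} (w : Vector V ℓ) k → Injective _≡_ _≡_ w → (∀ i → w i ∈ S) →
    ∏ S (λ v → dividedPower (G v) (exp# v (monomial w k))) ≋ Series.product (λ i → Series.divPow (G (w i)) (k i))
  ∏-monomial G {S} S! {zero}  w k inj w∈S = 𝕊.trans (∏-𝟙 S (λ v _ → dividedPower-zero (G v))) (𝕊.reflexive 𝟙-def)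
  ∏-monomial G {S} S! {suc ℓ} w k inj w∈S = begin
    ∏ S (λ v → dividedPower (G v) (exp# v (monomial w k)))
      ≈⟨ ∏-extract {F = λ v → dividedPower (G v) (exp# v (monomial w k))} {λ v → dividedPower (G v) (exp# v m′)} S! (w∈S fzero)
           (𝕊.trans (exponent-cong (w fzero) absent) (dividedPower-zero (G (w fzero))))
           (λ v v≢w → exponent-cong v (trans (exponent-++ v first m′) (cong (ℕ._+ exp# v m′) (exponent-replicate-≢ (k fzero) v≢w)))) ⟩
    dividedPower (G (w fzero)) (exp# (w fzero) (monomial w k)) ⊛ ∏ S (λ v → dividedPower (G v) (exp# v m′))
      ≈⟨ 𝕊.*-cong (exponent-cong (w fzero) (trans (exponent-++ (w fzero) first m′)
           (trans (cong₂ ℕ._+_ (exponent-replicate-≡ (k fzero) (w fzero)) absent) (ℕₚ.+-identityʳ (k fzero)))))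
           (∏-monomial G S! (w ∘ fsuc) (k ∘ fsuc) (λ eq → Finₚ.suc-injective (inj eq)) (w∈S ∘ fsuc)) ⟩
    dividedPower (G (w fzero)) (k fzero) ⊛ Series.product (λ i → Series.divPow (G (w (fsuc i))) (k (fsuc i)))
      ≡⟨ trans (⊛-def (dividedPower (G (w fzero)) (k fzero)) _)
           (cong (Series._* Series.product (λ i → Series.divPow (G (w (fsuc i))) (k (fsuc i)))) (sym (divPow-def (G (w fzero)) (k fzero)))) ⟩
    Series.product (λ i → Series.divPow (G (w i)) (k i)) ∎
    where
    open 𝕊-Reasoning
    first = replicate (k fzero) (w fzero)
    m′ = monomial (w ∘ fsuc) (k ∘ fsuc)
    exponent-cong : ∀ v {e e′} → e ≡ e′ → dividedPower (G v) e ≋ dividedPower (G v) e′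
    exponent-cong v refl = 𝕊.refl
    absent : exp# (w fzero) m′ ≡ 0
    absent = exponent-monomial-∉ (w ∘ fsuc) (k ∘ fsuc) (λ i eq → Finₚ.0≢1+n (inj eq))

  variables : Polynomial V → List V
  variables = concatMap proj₂

  variables-VariablesIn : ∀ {S} P → (∀ {v} → v ∈ variables P → v ∈ S) → VariablesIn S P
  variables-VariablesIn []            ⊆ = []
  variables-VariablesIn ((_ , m) ∷ P) ⊆ = All.tabulate (⊆ ∘ ∈-++⁺ˡ) ∷ variables-VariablesIn P (⊆ ∘ ∈-++⁺ʳ m)

-- Enumeration of the admissible words of bounded length

module Enumeration {p : ℕ} (p-prime : Prime p) where
  open Words p-prime
  open Factors p-prime

  words : ℕ → List Word
  words zero    = [] ∷ []
  words (suc n) = [] ∷ concatMap (λ d → map (d ∷_) (words n)) (allFin p)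

  ∈-words : ∀ n w → length w ≤ n → w ∈ words n
  ∈-words zero    []      _       = here refl
  ∈-words (suc n) []      _       = here refl
  ∈-words (suc n) (d ∷ w) (s≤s l) = there (∈-concatMap⁺ (λ d → map (d ∷_) (words n))
    (Any.map (λ { refl → ∈-map⁺ (d ∷_) (∈-words n w l) }) (∈-allFin d)))

  toW : Word → List W
  toW w with admissible? w
  ... | yes a = (w , [ a ]) ∷ []
  ... | no _  = []

  ∈-toW : ∀ w → w ∈ toW (value w)
  ∈-toW w with admissible? (value w)
  ... | yes _ = here (value-injective refl)
  ... | no ¬a = ⊥-elim (¬a (admissible w))

  admissibleWords : ℕ → List W
  admissibleWords n = concatMap toW (words n)

  ∈-admissibleWords : ∀ n w → length (value w) ≤ n → w ∈ admissibleWords n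
  ∈-admissibleWords n w l = ∈-concatMap⁺ toW (Any.map (λ { refl → ∈-toW w }) (∈-words n (value w) l))

  -- Supplies the block parameter M, which no word of `S` may exceed in length.
  longest : List W → ℕ
  longest []      = 0
  longest (w ∷ S) = length (value w) ⊔ longest S

  length≤longest : ∀ S w → w ∈ S → length (value w) ≤ longest S
  length≤longest (w ∷ S) _ (here refl) = ℕₚ.m≤m⊔n (length (value w)) (longest S)
  length≤longest (x ∷ S) w (there w∈S) = ℕₚ.≤-trans (length≤longest S w w∈S) (ℕₚ.m≤n⊔m (length (value x)) (longest S))

theorem2p3 : (p : ℕ) (p-prime : Prime p) →
    let open Words p-prime
        open Series
    in
    (P : ℕ → Polynomial W) → (∀ j → Represents j (P j)) →
    (ℓ : ℕ) (w : Vector W ℓ) (k : Vector ℕ ℓ) →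
    Injective _≡_ _≡_ w → (∀ i → 0 < k i) →
    (λ j → coeff _≟W_ (monomial w k) (P j))
      ≈ product (λ i → divPow (log (r (value (w i)))) (k i))
theorem2p3 p p-prime P represents ℓ w k w-injective _ j = begin
  coeff _≟W_ (monomial w k) (P j)
    ≡⟨ coeff-exp G G-Ord j S S! 𝟙 (P j) P∈S
         (λ ρ → trans (agree ρ) (sym (𝕊.*-identityˡ (expansion ρ) j))) (monomial w k) (monomial-∈ w k w∈S) ⟩
  (𝟙 ⊛ ∏ S (λ v → dividedPower (G v) (exp# v (monomial w k)))) j
    ≡⟨ 𝕊.*-identityˡ (∏ S (λ v → dividedPower (G v) (exp# v (monomial w k)))) j ⟩
  ∏ S (λ v → dividedPower (G v) (exp# v (monomial w k))) j
    ≡⟨ ∏-monomial G S! w k w-injective w∈S j ⟩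
  Series.product (λ i → Series.divPow (G (w i)) (k i)) j ∎
  where
  open ≡-Reasoning
  open Words p-prime
  open Enumeration p-prime
  open Coefficients _≟W_
  G : W → PowerSeries
  G v = Series.log (r (value v))
  G-Ord : ∀ v → Ord 1 (G v)
  G-Ord v = log-Ord (r (value v))
  pool S : List W
  -- The short words serve the product formula modulo x^(j+1), the variables of `P j` its evaluation
  -- on `S`, and the given words put the monomial over `S`.
  pool = admissibleWords (2 ℕ.+ j) ++ variables (P j) ++ tabulate w
  S = deduplicate _≟W_ pool
  S! : Unique S
  S! = deduplicate-! _≟W_ pool
  P∈S : VariablesIn S (P j)
  P∈S = variables-VariablesIn (P j) (λ v∈ → ∈-deduplicate⁺ _≟W_ (∈-++⁺ʳ (admissibleWords (2 ℕ.+ j)) (∈-++⁺ˡ v∈)))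
  w∈S : ∀ i → w i ∈ S
  w∈S i = ∈-deduplicate⁺ _≟W_ (∈-++⁺ʳ (admissibleWords (2 ℕ.+ j)) (∈-++⁺ʳ (variables (P j)) (∈-tabulate⁺ i)))
  open Density p-prime S S! j (λ v l → ∈-deduplicate⁺ _≟W_ (∈-++⁺ˡ (∈-admissibleWords (2 ℕ.+ j) v l)))
    (P j) (represents j) P∈S (longest S) (length≤longest S) using (agree; expansion)
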